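{- Let $\mathcal{C}\subseteq\mathsf{RPD}_{m,n}$ be a union of full subcrystals of $\mathsf{RPD}_{m,n}$. Suppose $i\in[n-1]$ and $w\in S_n$ satisfy $w(i)<w(i+1)$. Then $$\mathcal{C}_{ws_i}=\mathfrak{D}_i(\mathcal{C}_w)\quad\text{and}\quad \mathsf{ch}(\mathcal{C}_{ws_i})=\pi^K_i(\mathsf{ch}(\mathcal{C}_w)).$$
   Context: Permutations compose as functions, $s_k=(k,k+1)$. $\mathsf{RPD}_{m,n}$ is the set of $n\times m$ arrays (rows $1..n$ top to bottom, columns $1..m$) of tiles, each a bump tile (pipe from left edge to top edge and pipe from bottom edge to right edge) or a crossing tile. The pipe entering the left of row $r$ is labeled $r$, the pipe entering the bottom of column $j$ is labeled $n+j$; in a bump tile the left label exits at the top and the bottom label at the right; in a crossing tile with left label $a$ and bottom label $b$, $\max(a,b)$ exits at the top, $\min(a,b)$ at the right. $\sigma_D\in S_{m+n}$ has one-line notation: top-edge labels left to right, then right-edge labels top to bottom. For $v\in S_n$, $1^m\times v\in S_{m+n}$ fixes $[m]$ and sends $m+i\mapsto m+v(i)$; $S_n\subseteq S_{m+n}$ permutes $\{1,\dots,n\}$. $\bar\sigma_D$ is the unique element of $\{u\sigma_D(1^m\times v^{ -1}):u,v\in S_n\}$ with $\bar\sigma_D^{ -1}(1)>\dots>\bar\sigma_D^{ -1}(n)$ and $\bar\sigma_D(m+1)>\dots>\bar\sigma_D(m+n)$. Crystal structure: $\mathbf{e}_k$ standard basis of $\mathbb{Z}^n$. For $T\subseteq[n]$,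 $\mathrm{wt}(T)=\sum_{j\in T}\mathbf{e}_j$, $e_i(T)=T\cup\{i\}$ if $T\cap\{i,i+1\}=\{i+1\}$, $T\setminus\{i+1\}$ if $T\cap\{i,i+1\}=\{i,i+1\}$, else $0$; $f_i(T)=T\cup\{i+1\}$ if $T\cap\{i,i+1\}=\{i\}$, $T\setminus\{i\}$ if $T\cap\{i,i+1\}=\{i,i+1\}$, else $0$. With $\varepsilon_i,\varphi_i$ the maximal numbers of applications of $e_i,f_i$ before reaching $0$, tensor products have additive weight, $e_i(b\otimes c)=b\otimes e_i(c)$ if $\varepsilon_i(b)\le\varphi_i(c)$ else $e_i(b)\otimes c$, $f_i(b\otimes c)=b\otimes f_i(c)$ if $\varepsilon_i(b)<\varphi_i(c)$ else $f_i(b)\otimes c$, $b\otimes0=0\otimes c=0$. $m$-tuples of subsets of $[n]$ form a crystal via $S\leftrightarrow S_1\otimes\cdots\otimes S_m$, transported to $\mathsf{RPD}_{m,n}$ via the bijection whose tile at row $r$, column $j$ is a bump tile iff $r\in S_j$; thus $\mathrm{wt}(D)_r$ is the number of bump tiles in row $r$. Full subcrystals are weakly connected components of the graph with edges $D\to f_i(D)\ne0$. $\le$ is the (strong) Bruhat order on $S_n$. For $w\in S_n$, $\mathcal{C}_w=\{c\in\mathcal{C}:\sigma_c=u\,\bar\sigma_c\,(1^m\times v)\text{ for some }u,v\in S_n\text{ with }v\le w\}$ and $\mathsf{ch}(\mathcal{C}_w)=\sum_{c\in\mathcal{C}_w}x^{\mathrm{wt}(c)}$, $x^\alpha=x_1^{\alpha_1}\cdots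 x_n^{\alpha_n}$. For $X\subseteq\mathcal{C}$, $\mathfrak{D}_i(X)=\{b\in\mathcal{C}:e_i^k(b)\in X\text{ for some }k\in\mathbb{N}\}$. On $\mathbb{Z}[x_1,\dots,x_n]$, $\partial_i(f)=\frac{f-s_if}{x_i-x_{i+1}}$ where $s_if$ swaps $x_i,x_{i+1}$, and $\pi^K_i(f)=\partial_i((1+x_{i+1})x_if)$. -}

module Defs where

open import Data.Bool using (Bool; true; false; if_then_else_; _∧_)
open import Data.Nat using (ℕ; zero; suc; _+_; _*_; _∸_; _^_; _≤_; _<_; _≤ᵇ_; _<ᵇ_; _⊔_; _⊓_)
open import Data.Nat.Properties using (_<?_)
open import Data.Integer as ℤ using (ℤ; +_)
open import Data.Fin using (Fin; toℕ; fromℕ<)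
open import Data.Fin.Permutation using (Permutation′; _⟨$⟩ʳ_; _⟨$⟩ˡ_; _∘ₚ_; flip)
open import Data.Vec as Vec using (Vec; []; _∷_; replicate; transpose; zipWith)
open import Data.Vec.Properties using (≡-dec)
open import Data.List as List using (List; []; _∷_; _++_; concatMap; upTo; length; filterᵇ)
open import Data.List.Membership.Propositional using (_∈_)
open import Data.List.Relation.Unary.Unique.Propositional using (Unique)
open import Data.Maybe using (Maybe; just; nothing)
open import Data.Product using (Σ; ∃; ∃-syntax; _×_; _,_; proj₁; proj₂)
open import Relation.Nullary using (yes; no)
open import Relation.Binary.PropositionalEquality using (_≡_)
open import Relation.Binary.Construct.Closure.Equivalence using (EqClosure)
open import Function.Bundles using (_⇔_)

import Data.Nat as ℕ

-- Generic 1-indexed access to vectors (out-of-range: default / no-op)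

get0 : ∀ {A : Set} {k} → A → Vec A k → ℕ → A
get0 d [] _ = d
get0 d (x ∷ xs) zero = x
get0 d (x ∷ xs) (suc j) = get0 d xs j

get : ∀ {A : Set} {k} → A → Vec A k → ℕ → A
get d xs zero = d
get d xs (suc j) = get0 d xs j

put0 : ∀ {A : Set} {k} → Vec A k → ℕ → A → Vec A k
put0 [] _ a = []
put0 (x ∷ xs) zero a = a ∷ xs
put0 (x ∷ xs) (suc j) a = x ∷ put0 xs j a

put : ∀ {A : Set} {k} → Vec A k → ℕ → A → Vec A k
put xs zero a = xs
put xs (suc j) a = put0 xs j a

-- Permutations.  S_N is Permutation′ N (bijections Fin N ↔ Fin N).
-- We view them as acting on {1,…,N} (1-indexed) and extend by the
-- identity outside {1,…,N}.

Perm : ℕ → Set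
Perm = Permutation′

app : ∀ {N} → Perm N → ℕ → ℕ
app {N} π zero = zero
app {N} π (suc q) with q <? N
... | yes q<N = suc (toℕ (π ⟨$⟩ʳ fromℕ< q<N))
... | no _ = suc q

appInv : ∀ {N} → Perm N → ℕ → ℕ
appInv π = app (flip π)

-- composition as functions: (u · v)(p) = u (v p)
_·_ : ∀ {N} → Perm N → Perm N → Perm N
u · v = v ∘ₚ u

sᵢ : (n i : ℕ) → 1 ≤ i → i < n → Perm n
sᵢ n (suc i) _ i<n =
  Data.Fin.Permutation.transpose (fromℕ< (Data.Nat.Properties.<-trans (Data.Nat.Properties.n<1+n i) i<n)) (fromℕ< i<n)

swapℕ : ℕ → ℕ → ℕ → ℕ
swapℕ a b p = if p ℕ.≡ᵇ a then b else (if p ℕ.≡ᵇ b then a else p)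

inversions : ∀ {n} → Perm n → ℕ
inversions {n} x =
  length (filterᵇ (λ ab → (proj₁ ab <ᵇ proj₂ ab) ∧ (app x (proj₂ ab) <ᵇ app x (proj₁ ab)))
                  (concatMap (λ a → List.map (λ b → (a , b)) (List.map suc (upTo n)))
                             (List.map suc (upTo n))))

data Bruhat {n : ℕ} (u : Perm n) : Perm n → Set where
  b-refl : ∀ {w} → (∀ p → app u p ≡ app w p) → Bruhat u w
  b-step : ∀ {x y} → Bruhat u x → (a b : ℕ) → 1 ≤ a → a < b → b ≤ n →
           (∀ p → app y p ≡ app x (swapℕ a b p)) →
           inversions x < inversions y → Bruhat u y

-- Reduced pipe dreams: n × m arrays (rows top to bottom) of tiles

data Tile : Set where
  bump cross : Tile

RPD : ℕ → ℕ → Set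
RPD m n = Vec (Vec Tile m) n

-- action of one tile: left label a, bottom label b ↦ (top label, right label)
tileAct : Tile → ℕ → ℕ → ℕ × ℕ
tileAct bump a b = a , b
tileAct cross a b = a ⊔ b , a ⊓ b

-- a row: left label, bottom labels ↦ (top labels, right label)
processRow : ∀ {m} → ℕ → Vec ℕ m → Vec Tile m → Vec ℕ m × ℕ
processRow a [] [] = [] , a
processRow a (b ∷ bs) (t ∷ ts) =
  let tr = tileAct t a b
      rest = processRow (proj₂ tr) bs ts
  in (proj₁ tr ∷ proj₁ rest) , proj₂ rest

-- rows (with their labels), top to bottom; bottom labels entering the
-- lowest row ↦ (top-edge labels of top row, right-edge labels top to bottom)
traceRows : ∀ {m} → List (ℕ × Vec Tile m) → Vec ℕ m → Vec ℕ m × List ℕ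
traceRows [] bot = bot , []
traceRows ((r , row) ∷ rest) bot =
  let below = traceRows rest bot
      here = processRow r (proj₁ below) row
  in proj₁ here , (proj₂ here ∷ proj₂ below)

labelRows : ∀ {m k} → ℕ → Vec (Vec Tile m) k → List (ℕ × Vec Tile m)
labelRows r [] = []
labelRows r (row ∷ rows) = (r , row) ∷ labelRows (suc r) rows

-- one-line notation of σ_D (top labels left to right, then right labels top to bottom)
oneLine : ∀ {m n} → RPD m n → List ℕ
oneLine {m} {n} D =
  let res = traceRows (labelRows 1 D) (Vec.tabulate (λ (j : Fin m) → n + suc (toℕ j)))
  in Vec.toList (proj₁ res) ++ proj₂ res

getL0 : ℕ → List ℕ → ℕ → ℕ
getL0 d [] _ = d
getL0 d (x ∷ xs) zero = x
getL0 d (x ∷ xs) (suc j) = getL0 d xs j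

-- σ_D ∈ S_{m+n} as a function on ℕ (meaningful on {1,…,m+n})
σ : ∀ {m n} → RPD m n → ℕ → ℕ
σ D zero = zero
σ D (suc j) = getL0 (suc j) (oneLine D) j

1^_×_ : ∀ {n} → ℕ → Perm n → ℕ → ℕ
(1^ m × v) p = if p ≤ᵇ m then p else m + app v (p ∸ m)

-- S_n ⊆ S_{m+n}: u ∈ S_n acts on {1,…,n} and fixes the rest; this is `app u`.

IsBar : (m n : ℕ) → (ℕ → ℕ) → Perm (m + n) → Set
IsBar m n s τ =
  (∃[ u ] ∃[ v ] ((p : ℕ) → 1 ≤ p → p ≤ m + n →
      app τ p ≡ app {n} u (s ((1^ m × flip {n} v) p))))
  × (∀ a b → 1 ≤ a → a < b → b ≤ n → appInv τ b < appInv τ a)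
  × (∀ a b → 1 ≤ a → a < b → b ≤ n → app τ (m + b) < app τ (m + a))

Cw : ∀ {m n} → (RPD m n → Set) → Perm n → RPD m n → Set
Cw {m} {n} C w c =
  C c × ∃[ τ ] (IsBar m n (σ c) τ ×
    ∃[ u ] ∃[ v ] (Bruhat {n} v w ×
      ((p : ℕ) → 1 ≤ p → p ≤ m + n → σ c p ≡ app {n} u (app τ ((1^ m × v) p)))))

Subset : ℕ → Set
Subset n = Vec Bool n

mem : ∀ {n} → Subset n → ℕ → Bool
mem T i = get false T i

e₁ : ∀ {n} → ℕ → Subset n → Maybe (Subset n)
e₁ i T with mem T i | mem T (suc i)
... | false | true = just (put T i true)
... | true  | true = just (put T (suc i) false)
... | _     | _    = nothing

f₁ : ∀ {n} → ℕ → Subset n → Maybe (Subset n)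
f₁ i T with mem T i | mem T (suc i)
... | true | false = just (put T (suc i) true)
... | true | true  = just (put T i false)
... | _    | _     = nothing

record CrystalOps (B : Set) : Set where
  field
    e f  : ℕ → B → Maybe B
    size : ℕ   -- number of elements of B (a bound used as fuel)

-- number of successive applications of g before reaching 0 (fuel-bounded;
-- exact whenever the true number is ≤ fuel)
count : ∀ {B : Set} → (B → Maybe B) → ℕ → B → ℕ
count g zero b = zero
count g (suc k) b with g b
... | nothing = zero
... | just b′ = suc (count g k b′)

ε : ∀ {B} → CrystalOps B → ℕ → B → ℕ
ε K i = count (CrystalOps.e K i) (CrystalOps.size K)

φ : ∀ {B} → CrystalOps B → ℕ → B → ℕ
φ K i = count (CrystalOps.f K i) (CrystalOps.size K)

mapM : ∀ {A B : Set} → (A → B) → Maybe A → Maybe B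
mapM g nothing = nothing
mapM g (just a) = just (g a)

subsetOps : ∀ n → CrystalOps (Subset n)
subsetOps n = record { e = e₁ ; f = f₁ ; size = 2 ^ n }

unitOps : ∀ {A : Set} → CrystalOps (Vec A 0)
unitOps = record { e = λ _ _ → nothing ; f = λ _ _ → nothing ; size = 1 }

tensorOps : ∀ {A : Set} {k} → CrystalOps A → CrystalOps (Vec A k) → CrystalOps (Vec A (suc k))
tensorOps {A} {k} KA KC = record { e = e′ ; f = f′ ; size = CrystalOps.size KA * CrystalOps.size KC }
  where
  e′ : ℕ → Vec A (suc k) → Maybe (Vec A (suc k))
  e′ i (b ∷ c) = if ε KA i b ≤ᵇ φ KC i c
                 then mapM (b ∷_) (CrystalOps.e KC i c)
                 else mapM (_∷ c) (CrystalOps.e KA i b)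
  f′ : ℕ → Vec A (suc k) → Maybe (Vec A (suc k))
  f′ i (b ∷ c) = if ε KA i b <ᵇ φ KC i c
                 then mapM (b ∷_) (CrystalOps.f KC i c)
                 else mapM (_∷ c) (CrystalOps.f KA i b)

tupleOps : ∀ n m → CrystalOps (Vec (Subset n) m)
tupleOps n zero = unitOps
tupleOps n (suc m) = tensorOps (subsetOps n) (tupleOps n m)

-- bijection RPD ↔ tuples: tile (r,j) is a bump iff r ∈ S_j
isBump : Tile → Bool
isBump bump = true
isBump cross = false

toTile : Bool → Tile
toTile true = bump
toTile false = cross

toTuple : ∀ {m n} → RPD m n → Vec (Subset n) m
toTuple D = Vec.map (Vec.map isBump) (transpose D)

fromTuple : ∀ {m n} → Vec (Subset n) m → RPD m n
fromTuple S = transpose (Vec.map (Vec.map toTile) S)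

eR : ∀ {m n} → ℕ → RPD m n → Maybe (RPD m n)
eR {m} {n} i D = mapM fromTuple (CrystalOps.e (tupleOps n m) i (toTuple D))

fR : ∀ {m n} → ℕ → RPD m n → Maybe (RPD m n)
fR {m} {n} i D = mapM fromTuple (CrystalOps.f (tupleOps n m) i (toTuple D))

countBumps : ∀ {m} → Vec Tile m → ℕ
countBumps [] = 0
countBumps (t ∷ ts) = (if isBump t then 1 else 0) + countBumps ts

wt : ∀ {m n} → RPD m n → Vec ℕ n
wt D = Vec.map countBumps D

Edge : ∀ {m n} → RPD m n → RPD m n → Set
Edge {m} {n} D D′ = ∃[ i ] (1 ≤ i × i < n × fR i D ≡ just D′)

-- D and D′ lie in the same full subcrystal (weakly connected component)
SameComponent : ∀ {m n} → RPD m n → RPD m n → Set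
SameComponent = EqClosure Edge

UnionOfFullSubcrystals : ∀ {m n} → (RPD m n → Set) → Set
UnionOfFullSubcrystals C = ∀ D D′ → SameComponent D D′ → C D → C D′

-- e_i^k on RPDs (0 = nothing)
eRPow : ∀ {m n} → ℕ → ℕ → RPD m n → Maybe (RPD m n)
eRPow i zero D = just D
eRPow i (suc k) D with eRPow i k D
... | nothing = nothing
... | just D′ = eR i D′

𝔇 : ∀ {m n} → ℕ → (RPD m n → Set) → RPD m n → Set
𝔇 i X b = ∃[ k ] ∃[ b′ ] (eRPow i k b ≡ just b′ × X b′)

-- Polynomials in ℤ[x₁,…,xₙ]: finite lists of terms (coefficient, exponent
-- vector), compared coefficientwise.

Poly : ℕ → Set
Poly n = List (ℤ × Vec ℕ n)

coeff : ∀ {n} → Poly n → Vec ℕ n → ℤ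
coeff [] α = + 0
coeff ((c , β) ∷ p) α with ≡-dec Data.Nat._≟_ β α
... | yes _ = c ℤ.+ coeff p α
... | no _ = coeff p α

_≈ₚ_ : ∀ {n} → Poly n → Poly n → Set
p ≈ₚ q = ∀ α → coeff p α ≡ coeff q α

_+ₚ_ : ∀ {n} → Poly n → Poly n → Poly n
p +ₚ q = p ++ q

-ₚ_ : ∀ {n} → Poly n → Poly n
-ₚ p = List.map (λ t → ℤ.- proj₁ t , proj₂ t) p

_-ₚ_ : ∀ {n} → Poly n → Poly n → Poly n
p -ₚ q = p +ₚ (-ₚ q)

_*ₚ_ : ∀ {n} → Poly n → Poly n → Poly n
p *ₚ q = concatMap (λ s → List.map (λ t → (proj₁ s ℤ.* proj₁ t) , zipWith _+_ (proj₂ s) (proj₂ t)) q) p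

1ₚ : ∀ {n} → Poly n
1ₚ {n} = ((+ 1) , replicate n 0) ∷ []

x : ∀ {n} → ℕ → Poly n
x {n} i = ((+ 1) , put (replicate n 0) i 1) ∷ []

monomial : ∀ {n} → Vec ℕ n → Poly n
monomial α = ((+ 1) , α) ∷ []

swapExp : ∀ {n} → ℕ → Vec ℕ n → Vec ℕ n
swapExp i α = put (put α i (get 0 α (suc i))) (suc i) (get 0 α i)

sₚ : ∀ {n} → ℕ → Poly n → Poly n
sₚ i p = List.map (λ t → proj₁ t , swapExp i (proj₂ t)) p

-- h = ∂_i g, i.e. h = (g - s_i g)/(x_i - x_{i+1}) (exact division in ℤ[x])
Is∂ : ∀ {n} → ℕ → Poly n → Poly n → Set
Is∂ i g h = ((x i -ₚ x (suc i)) *ₚ h) ≈ₚ (g -ₚ sₚ i g)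

IsπK : ∀ {n} → ℕ → Poly n → Poly n → Set
IsπK i f h = Is∂ i ((1ₚ +ₚ x (suc i)) *ₚ (x i *ₚ f)) h

Enumerates : ∀ {m n} → (RPD m n → Set) → List (RPD m n) → Set
Enumerates X L = Unique L × (∀ D → (D ∈ L) ⇔ X D)

-- ch(X) = Σ_{c ∈ X} x^{wt(c)}, computed from an enumeration of X
ch : ∀ {m n} → List (RPD m n) → Poly n
ch L = concatMap (λ D → monomial (wt D)) L

{-# OPTIONS --safe #-}

-- Only rows i and i+1 of D matter. Read column by column they form a word in + and −, with {i} = ++,
-- {i, i+1} = +− and {i+1} = −−; pairing each − with a later +, f_i turns the rightmost unpaired + into −.
-- As u ∈ S_n is arbitrary, the labels 1,…,n may be identified. Then f_i preserves all top labels and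
-- the pair of right labels of the two rows up to order; the order can change only at the highest
-- element of an i-string, and there the upper label is at least the lower one. Hence the v with
-- σ_D = u σ̄_D (1^m × v) are multiplied by s_i when they change along an i-string at all, and the lifting
-- property of Bruhat order shows that C_{w s_i} meets each i-string in all or nothing, whereas C_w
-- meets it in everything, in nothing or in the highest element only. The character formula then
-- holds string by string: the weights (a,b), (a,b+1), (a−1,b+1), …, (b,a) of a string telescope
-- when multiplied by x_i − x_{i+1}, and they are symmetric in i and i+1.
module Submission where

open import Defs
open import Data.Bool using (Bool; true; false; if_then_else_; _∧_; _xor_)
open import Data.Bool.Properties using (T-∧; T-≡; xor-comm)
open import Data.Nat
  using (ℕ; zero; suc; _+_; _*_; _∸_; _^_; _≤_; _<_; _≤ᵇ_; _<ᵇ_; _≡ᵇ_; _⊔_; _⊓_; z≤n; s≤s; s≤s⁻¹; z<s; >-nonZero)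
open import Data.Nat.Properties
open import Data.Fin using (Fin; toℕ; fromℕ<)
open import Data.Fin.Properties using (toℕ-injective; toℕ-fromℕ<; fromℕ<-toℕ; toℕ<n; any?; punchOut-injective; injective⇒≤)
import Data.Fin as Fin
open import Data.Fin.Permutation using (_⟨$⟩ʳ_; _⟨$⟩ˡ_; flip; permutation; inverseˡ) renaming (id to idₚ)
open import Data.List using (List; []; _∷_; _++_; concatMap; upTo; length; filterᵇ)
import Data.List as List
open import Data.Vec using (Vec; []; _∷_)
import Data.Vec as Vec
import Data.Vec.Properties as Vec
open import Data.Maybe using (Maybe; just; nothing)
open import Data.Product using (∃; ∃-syntax; _×_; _,_; proj₁; proj₂)
open import Data.Sum using (_⊎_; inj₁; inj₂)
open import Function using (_∘_; case_of_)
open import Function.Bundles using (_⇔_; mk⇔; Equivalence)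
open import Relation.Nullary using (¬_; yes; no; contradiction; Dec)
open import Relation.Binary.PropositionalEquality using (_≡_; _≢_; refl; sym; trans; cong; cong₂; subst; subst₂; module ≡-Reasoning)
open import Relation.Binary.Definitions using (tri<; tri≈; tri>)
open import Data.List.Membership.Propositional using (_∈_; _∉_)
open import Data.List.Membership.Propositional.Properties
  using (∈-∃++; ∈-++⁺ˡ; ∈-++⁺ʳ; ∈-++⁻; ∈-cartesianProduct⁺; ∈-cartesianProduct⁻; ∈-filter⁺; ∈-filter⁻; ∈-upTo⁺; ∈-upTo⁻; ∈-map⁺; ∈-map⁻; ∈-tabulate⁻)
open import Data.List.Relation.Unary.Any using (here; there)
open import Data.List.Relation.Unary.AllPairs using ([]; _∷_)
open import Data.List.Relation.Unary.All as All using (All; []; _∷_)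
open import Data.List.Relation.Unary.Unique.Propositional using (Unique)
import Data.List.Relation.Unary.Unique.Propositional.Properties as Unique
import Data.List.Properties as List
open import Data.Nat.Solver using (module +-*-Solver)
open +-*-Solver using (solve; con; _:+_; _:*_; _:=_)
open import Data.List.Relation.Binary.Permutation.Propositional using (_↭_; ↭-refl; ↭-sym; ↭-trans; ↭-prep; ↭-swap; ↭⇒↭ₛ)
import Data.List.Relation.Binary.Permutation.Propositional.Properties as Perm
import Data.List.Relation.Binary.Permutation.Setoid.Properties as Permₛ
open import Relation.Binary.PropositionalEquality.Properties using (setoid)
open import Relation.Binary.Construct.Closure.Equivalence using (return; symmetric)
open import Data.Integer using (ℤ; 0ℤ; 1ℤ) renaming (_+_ to _+ℤ_; _*_ to _*ℤ_; -_ to -ℤ_)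
import Data.Integer.Properties as ℤ
import Data.Integer.Solver as ℤSolver
open import Data.List.Membership.Propositional.Properties.WithK using (unique∧set⇒bag)
open import Data.List.Relation.Binary.BagAndSetEquality using (∼bag⇒↭)
open import Data.List.Relation.Binary.Permutation.Propositional using (prep; swap) renaming (refl to ↭-base; trans to ↭-step)
import Data.List.Membership.DecPropositional as DecMembership
open import Relation.Binary.Definitions using (DecidableEquality)

-- Permutations as functions on ℕ

-- In general `v` is not determined by D, because `u` can permute the pipes with labels at most n
-- that leave on the right. Hence the proof computes neither v nor σ̄_D: a representation of one
-- array is carried to its neighbour in the string with the same σ̄ (`Twist`), acquiring at most a
-- factor s_i.
--
-- The ambiguity is what settles the highest element. Suppose it has a representative v ≤ w s_i with
-- v(i) > v(i+1). Since σ̄ decreases on m+1,...,m+n, the identified upper label is at most the lower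
-- one; the sweep through the two rows gives the opposite inequality. So the two labels are
-- identified with each other, v s_i represents the same array, and lifting puts v s_i below w.
--
-- Below the highest element no exchange of labels survives: once all symbols + further right are
-- paired, an unpaired - on the right means that the two pipes meet in a column {i+1}, which emits
-- their maximum and passes on their minimum, whatever their order.

InRange : ℕ → ℕ → Set
InRange N p = 1 ≤ p × p ≤ N

data Position (N : ℕ) : ℕ → Set where
  inside  : (j : Fin N) → Position N (suc (toℕ j))
  outside : ∀ {p} → ¬ InRange N p → Position N p

position : ∀ N p → Position N p
position N zero = outside λ { (() , _) }
position N (suc q) with q <? N
... | yes q<N = subst (Position N ∘ suc) (toℕ-fromℕ< q<N) (inside (fromℕ< q<N))
... | no  q≮N = outside (q≮N ∘ proj₂)

toℕ-inRange : ∀ {N} (j : Fin N) → InRange N (suc (toℕ j))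
toℕ-inRange j = s≤s z≤n , toℕ<n j

app-toℕ : ∀ {N} (π : Perm N) j → app π (suc (toℕ j)) ≡ suc (toℕ (π ⟨$⟩ʳ j))
app-toℕ {N} π j with toℕ j <? N
... | yes q<N = cong (λ k → suc (toℕ (π ⟨$⟩ʳ k))) (fromℕ<-toℕ j q<N)
... | no  q≮N = contradiction (toℕ<n j) q≮N

app-outside : ∀ {N} (π : Perm N) {p} → ¬ InRange N p → app π p ≡ p
app-outside π {zero} _ = refl
app-outside {N} π {suc q} out with q <? N
... | yes q<N = contradiction (s≤s z≤n , q<N) out
... | no  _   = refl

app-inRange : ∀ {N} (π : Perm N) {p} → InRange N p → InRange N (app π p)
app-inRange {N} π {p} r with position N p
... | inside j  = subst (InRange N) (sym (app-toℕ π j)) (toℕ-inRange (π ⟨$⟩ʳ j))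
... | outside o = contradiction r o

app-· : ∀ {N} (u v : Perm N) p → app (u · v) p ≡ app u (app v p)
app-· {N} u v p with position N p
... | inside j = begin
  app (u · v) (suc (toℕ j))        ≡⟨ app-toℕ (u · v) j ⟩
  suc (toℕ (u ⟨$⟩ʳ (v ⟨$⟩ʳ j)))    ≡⟨ app-toℕ u (v ⟨$⟩ʳ j) ⟨
  app u (suc (toℕ (v ⟨$⟩ʳ j)))     ≡⟨ cong (app u) (app-toℕ v j) ⟨
  app u (app v (suc (toℕ j)))      ∎
  where open ≡-Reasoning
... | outside o = trans (app-outside (u · v) o) (sym (trans (cong (app u) (app-outside v o)) (app-outside u o)))

app-flipˡ : ∀ {N} (π : Perm N) p → app (flip π) (app π p) ≡ p
app-flipˡ {N} π p with position N p
... | inside j = begin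
  app (flip π) (app π (suc (toℕ j)))        ≡⟨ cong (app (flip π)) (app-toℕ π j) ⟩
  app (flip π) (suc (toℕ (π ⟨$⟩ʳ j)))       ≡⟨ app-toℕ (flip π) (π ⟨$⟩ʳ j) ⟩
  suc (toℕ (π ⟨$⟩ˡ (π ⟨$⟩ʳ j)))             ≡⟨ cong (suc ∘ toℕ) (inverseˡ π) ⟩
  suc (toℕ j)                               ∎
  where open ≡-Reasoning
... | outside o = trans (cong (app (flip π)) (app-outside π o)) (app-outside (flip π) o)

app-flipʳ : ∀ {N} (π : Perm N) p → app π (app (flip π) p) ≡ p
app-flipʳ π = app-flipˡ (flip π)

app-injective : ∀ {N} (π : Perm N) {p q} → app π p ≡ app π q → p ≡ q
app-injective π {p} {q} eq = trans (sym (app-flipˡ π p)) (trans (cong (app (flip π)) eq) (app-flipˡ π q))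

-- Pigeonhole: punching out the avoided value would inject `Fin (suc N)` into `Fin N`.
injective⇒¬avoiding : ∀ {N} (g : Fin N → Fin N) → (∀ {j k} → g j ≡ g k → j ≡ k) → ∀ k → ¬ (∀ j → g j ≢ k)
injective⇒¬avoiding {suc N} g g-injective k avoids = contradiction
  (injective⇒≤ {f = λ j → Fin.punchOut (avoids j ∘ sym)}
    (λ {j} {j′} eq → g-injective (punchOut-injective (avoids j ∘ sym) (avoids j′ ∘ sym) eq)))
  1+n≰n

module _ {N : ℕ} (f : ℕ → ℕ) (f-in : ∀ {p} → InRange N p → InRange N (f p)) where

  restrict : Fin N → Fin N
  restrict j with f (suc (toℕ j)) | f-in (toℕ-inRange j)
  ... | suc q | _ , q<N = fromℕ< q<N

  toℕ-restrict : ∀ j → suc (toℕ (restrict j)) ≡ f (suc (toℕ j))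
  toℕ-restrict j with f (suc (toℕ j)) | f-in (toℕ-inRange j)
  ... | suc q | _ , q<N = cong suc (toℕ-fromℕ< q<N)

  module _ (f-injective : ∀ {p q} → InRange N p → InRange N q → f p ≡ f q → p ≡ q) where

    private
      restrict-injective : ∀ {j k} → restrict j ≡ restrict k → j ≡ k
      restrict-injective {j} {k} eq = toℕ-injective (suc-injective
        (f-injective (toℕ-inRange j) (toℕ-inRange k)
          (trans (sym (toℕ-restrict j)) (trans (cong (suc ∘ toℕ) eq) (toℕ-restrict k)))))

      preimage : ∀ k → ∃[ j ] restrict j ≡ k
      preimage k with any? (λ j → restrict j Fin.≟ k)
      ... | yes found = found
      ... | no missing = contradiction (λ j eq → missing (j , eq)) (injective⇒¬avoiding restrict restrict-injective k)

    -- Serves twice: to make σ_D a permutation, and to build the relabelling of the pipes 1,...,n.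
    fromInjection : Perm N
    fromInjection = permutation restrict (proj₁ ∘ preimage) (proj₂ ∘ preimage)
      (λ j → restrict-injective (proj₂ (preimage (restrict j))))

    app-fromInjection : ∀ {p} → InRange N p → app fromInjection p ≡ f p
    app-fromInjection {p} r with position N p
    ... | inside j  = trans (app-toℕ fromInjection j) (toℕ-restrict j)
    ... | outside o = contradiction r o

swapℕ-left : ∀ a b → swapℕ a b a ≡ b
swapℕ-left a b with a ≡ᵇ a | ≡⇒≡ᵇ a a refl
... | true | _ = refl

swapℕ-right : ∀ a b → swapℕ a b b ≡ a
swapℕ-right a b with b ≡ᵇ a | ≡ᵇ⇒≡ b a
... | true | h = h _
... | false | _ with b ≡ᵇ b | ≡⇒≡ᵇ b b refl
...   | true | _ = refl

swapℕ-other : ∀ {a b p} → p ≢ a → p ≢ b → swapℕ a b p ≡ p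
swapℕ-other {a} {b} {p} p≢a p≢b with p ≡ᵇ a | ≡ᵇ⇒≡ p a
... | true | h = contradiction (h _) p≢a
... | false | _ with p ≡ᵇ b | ≡ᵇ⇒≡ p b
...   | true | h = contradiction (h _) p≢b
...   | false | _ = refl

-- Indexed by the argument and by its image, so that one match evaluates `swapℕ` as well.
data SwapView (a b : ℕ) : ℕ → ℕ → Set where
  at-left  : SwapView a b a b
  at-right : SwapView a b b a
  at-other : ∀ {p} → p ≢ a → p ≢ b → SwapView a b p p

swapView : ∀ a b p → SwapView a b p (swapℕ a b p)
swapView a b p with p ≟ a
... | yes refl = subst (SwapView p b p) (sym (swapℕ-left p b)) at-left
... | no p≢a with p ≟ b
...   | yes refl = subst (SwapView a p p) (sym (swapℕ-right a p)) at-right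
...   | no p≢b = subst (SwapView a b p) (sym (swapℕ-other p≢a p≢b)) (at-other p≢a p≢b)

swapℕ-involutive : ∀ a b p → swapℕ a b (swapℕ a b p) ≡ p
swapℕ-involutive a b p with swapℕ a b p | swapView a b p
... | _ | at-left = swapℕ-right a b
... | _ | at-right = swapℕ-left a b
... | _ | at-other p≢a p≢b = swapℕ-other p≢a p≢b

swapℕ-inRange : ∀ {N a b p} → InRange N a → InRange N b → InRange N p → InRange N (swapℕ a b p)
swapℕ-inRange {a = a} {b} {p} ra rb rp with swapℕ a b p | swapView a b p
... | _ | at-left = rb
... | _ | at-right = ra
... | _ | at-other _ _ = rp

app-sᵢ : ∀ n i (hi₁ : 1 ≤ i) (hi₂ : i < n) p → app (sᵢ n i hi₁ hi₂) p ≡ swapℕ i (suc i) p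
app-sᵢ n (suc i) hi₁ hi₂ p with position n p
... | outside o = trans (app-outside (sᵢ n (suc i) hi₁ hi₂) o) (sym (swapℕ-other
        (λ { refl → o (hi₁ , <⇒≤ hi₂) }) λ { refl → o (s≤s z≤n , hi₂) }))
... | inside j = trans (app-toℕ (sᵢ n (suc i) hi₁ hi₂) j) (lem j)
  where
  a b : Fin n
  a = fromℕ< (<-trans (n<1+n i) hi₂)
  b = fromℕ< hi₂
  toℕ-a : toℕ a ≡ i
  toℕ-a = toℕ-fromℕ< _
  toℕ-b : toℕ b ≡ suc i
  toℕ-b = toℕ-fromℕ< hi₂
  lem : ∀ j → suc (toℕ (sᵢ n (suc i) hi₁ hi₂ ⟨$⟩ʳ j)) ≡ swapℕ (suc i) (suc (suc i)) (suc (toℕ j))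
  lem j with j Fin.≟ a
  ... | yes refl rewrite toℕ-a | toℕ-b = sym (swapℕ-left (suc i) (suc (suc i)))
  ... | no j≢a with j Fin.≟ b
  ...   | yes refl rewrite toℕ-a | toℕ-b = sym (swapℕ-right (suc i) (suc (suc i)))
  ...   | no j≢b = sym (swapℕ-other
            (λ eq → j≢a (toℕ-injective (trans (suc-injective eq) (sym toℕ-a))))
            (λ eq → j≢b (toℕ-injective (trans (suc-injective eq) (sym toℕ-b)))))

-- Inversions and the strong Bruhat order

length-mono-⊆ : ∀ {A : Set} {xs ys : List A} → Unique xs → (∀ {z} → z ∈ xs → z ∈ ys) → length xs ≤ length ys
length-mono-⊆ [] _ = z≤n
length-mono-⊆ {xs = z ∷ xs} (z∉ ∷ uxs) sub with as , bs , refl ← ∈-∃++ (sub (here refl)) = begin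
  suc (length xs)           ≤⟨ s≤s (length-mono-⊆ uxs sub′) ⟩
  suc (length (as ++ bs))   ≡⟨ cong suc (List.length-++ as) ⟩
  suc (length as + length bs) ≡⟨ +-suc (length as) (length bs) ⟨
  length as + suc (length bs) ≡⟨ List.length-++ as ⟨
  length (as ++ z ∷ bs)     ∎
  where
  open ≤-Reasoning
  sub′ : ∀ {t} → t ∈ xs → t ∈ as ++ bs
  sub′ t∈ with ∈-++⁻ as (sub (there t∈))
  ... | inj₁ t∈as = ∈-++⁺ˡ t∈as
  ... | inj₂ (here refl) = contradiction refl (All.lookup z∉ t∈)
  ... | inj₂ (there t∈bs) = ∈-++⁺ʳ as t∈bs

cartesianProduct≡concatMap : ∀ {A B : Set} (xs : List A) (ys : List B) →
  concatMap (λ a → List.map (a ,_) ys) xs ≡ List.cartesianProduct xs ys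
cartesianProduct≡concatMap [] ys = refl
cartesianProduct≡concatMap (z ∷ xs) ys = cong (List.map (z ,_) ys ++_) (cartesianProduct≡concatMap xs ys)

oneTo : ℕ → List ℕ
oneTo n = List.map suc (upTo n)

∈-oneTo⁺ : ∀ {n p} → InRange n p → p ∈ oneTo n
∈-oneTo⁺ {p = suc p} (_ , p<n) = ∈-map⁺ suc (∈-upTo⁺ p<n)

∈-oneTo⁻ : ∀ {n p} → p ∈ oneTo n → InRange n p
∈-oneTo⁻ p∈ with _ , q∈ , refl ← ∈-map⁻ suc p∈ = s≤s z≤n , ∈-upTo⁻ q∈

oneTo-unique : ∀ n → Unique (oneTo n)
oneTo-unique n = Unique.map⁺ suc-injective (Unique.upTo⁺ n)

-- For a transposition s with x < x s, this involution sends inversions of x to inversions of x s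
-- other than the exchanged pair.
module _ (s : ℕ → ℕ) where

  movePair : ℕ × ℕ → ℕ × ℕ
  movePair (c , d) = if (c <ᵇ d) xor (s c <ᵇ s d) then (c , d) else (s c , s d)

  movePair-< : ∀ {c d} → c < d →
    (s c < s d × movePair (c , d) ≡ (s c , s d)) ⊎ (¬ s c < s d × movePair (c , d) ≡ (c , d))
  movePair-< {c} {d} c<d rewrite Equivalence.to T-≡ (<⇒<ᵇ c<d) with s c <ᵇ s d | <ᵇ⇒< (s c) (s d) | <⇒<ᵇ {s c} {s d}
  ... | true  | lt | _   = inj₁ (lt _ , refl)
  ... | false | _  | nlt = inj₂ (nlt , refl)

  module _ (s-involutive : ∀ p → s (s p) ≡ p) where

    -- The test whether `s` reverses the order of a pair has the same answer for the pair and for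
    -- its image.
    movePair-involutive : ∀ cd → movePair (movePair cd) ≡ cd
    movePair-involutive (c , d) with (c <ᵇ d) xor (s c <ᵇ s d) in eq
    ... | true rewrite eq = refl
    ... | false = back (s-involutive c) (s-involutive d)
      where
      back : ∀ {c′ d′} → c′ ≡ c → d′ ≡ d →
             (if (s c <ᵇ s d) xor (c′ <ᵇ d′) then (s c , s d) else (c′ , d′)) ≡ (c , d)
      back refl refl rewrite xor-comm (s c <ᵇ s d) (c <ᵇ d) | eq = refl

    movePair-injective : ∀ {p q} → movePair p ≡ movePair q → p ≡ q
    movePair-injective {p} {q} eq =
      trans (sym (movePair-involutive p)) (trans (cong movePair eq) (movePair-involutive q))

module _ {n : ℕ} where

  invertedᵇ : Perm n → ℕ × ℕ → Bool
  invertedᵇ x ab = (proj₁ ab <ᵇ proj₂ ab) ∧ (app x (proj₂ ab) <ᵇ app x (proj₁ ab))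

  inversionList : Perm n → List (ℕ × ℕ)
  inversionList x = filterᵇ (invertedᵇ x) (List.cartesianProduct (oneTo n) (oneTo n))

  length-inversionList : ∀ x → inversions x ≡ length (inversionList x)
  length-inversionList x = cong (length ∘ filterᵇ (invertedᵇ x)) (cartesianProduct≡concatMap (oneTo n) (oneTo n))

  inversionList-unique : ∀ x → Unique (inversionList x)
  inversionList-unique x = Unique.filter⁺ _ (Unique.cartesianProduct⁺ (oneTo-unique n) (oneTo-unique n))

  Inversion : Perm n → ℕ → ℕ → Set
  Inversion x c d = InRange n c × InRange n d × c < d × app x d < app x c

  ∈-inversionList⁺ : ∀ x {c d} → Inversion x c d → (c , d) ∈ inversionList x
  ∈-inversionList⁺ x (rc , rd , c<d , xd<xc) =
    ∈-filter⁺ _ (∈-cartesianProduct⁺ (∈-oneTo⁺ rc) (∈-oneTo⁺ rd))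
      (Equivalence.from T-∧ (<⇒<ᵇ c<d , <⇒<ᵇ xd<xc))

  ∈-inversionList⁻ : ∀ x {c d} → (c , d) ∈ inversionList x → Inversion x c d
  ∈-inversionList⁻ x {c} {d} cd∈
    with p∈ , t ← ∈-filter⁻ _ {xs = List.cartesianProduct (oneTo n) (oneTo n)} cd∈
    with c∈ , d∈ ← ∈-cartesianProduct⁻ (oneTo n) (oneTo n) p∈
       | t₁ , t₂ ← Equivalence.to (T-∧ {c <ᵇ d}) t
    = ∈-oneTo⁻ c∈ , ∈-oneTo⁻ d∈ , <ᵇ⇒< c d t₁ , <ᵇ⇒< (app x d) (app x c) t₂

  module _ {x y : Perm n} {a b : ℕ} (1≤a : 1 ≤ a) (a<b : a < b) (b≤n : b ≤ n)
           (y≡ : ∀ p → app y p ≡ app x (swapℕ a b p)) where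

    private
      ra : InRange n a
      ra = 1≤a , ≤-trans (<⇒≤ a<b) b≤n
      rb : InRange n b
      rb = ≤-trans 1≤a (<⇒≤ a<b) , b≤n

    swapped-≡ : ∀ p → app x p ≡ app y (swapℕ a b p)
    swapped-≡ p = sym (trans (y≡ (swapℕ a b p)) (cong (app x) (swapℕ-involutive a b p)))

    move : ℕ × ℕ → ℕ × ℕ
    move = movePair (swapℕ a b)

    move-injective : ∀ {p q} → move p ≡ move q → p ≡ q
    move-injective = movePair-injective (swapℕ a b) (swapℕ-involutive a b)

    move-fixed : move (a , b) ≡ (a , b)
    move-fixed with movePair-< (swapℕ a b) a<b
    ... | inj₁ (lt , _) = contradiction (subst₂ _<_ (swapℕ-left a b) (swapℕ-right a b) lt) (<-asym a<b)
    ... | inj₂ (_ , eq) = eq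

    -- If the swap keeps the order of the pair, the moved pair carries the same two values.
    -- Otherwise c = a with d between a and b, or d = b with c between them; then `y` puts the
    -- larger x(b) at a, or the smaller x(a) at b, which only widens the descent.
    move-Inversion : app x a < app x b → ∀ c d → Inversion x c d →
                     Inversion y (proj₁ (move (c , d))) (proj₂ (move (c , d)))
    move-Inversion xa<xb c d (rc , rd , c<d , xd<xc) with movePair-< (swapℕ a b) c<d
    ... | inj₁ (tc<td , eq) = subst (λ p → Inversion y (proj₁ p) (proj₂ p)) (sym eq)
            (swapℕ-inRange ra rb rc , swapℕ-inRange ra rb rd , tc<td ,
             subst₂ _<_ (swapped-≡ d) (swapped-≡ c) xd<xc)
    ... | inj₂ (tc≮td , eq) = subst (λ p → Inversion y (proj₁ p) (proj₂ p)) (sym eq)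
            (rc , rd , c<d , inv (swapView a b c) (swapView a b d) tc≮td)
      where
      inv : ∀ {c′ d′} → SwapView a b c c′ → SwapView a b d d′ → ¬ c′ < d′ → app y d < app y c
      inv at-left at-left _ = contradiction c<d (<-irrefl refl)
      inv at-left at-right _ = contradiction (<-trans xa<xb xd<xc) (<-irrefl refl)
      inv at-left (at-other d≢a d≢b) _ = subst₂ _<_
        (trans (cong (app x) (sym (swapℕ-other d≢a d≢b))) (sym (y≡ d)))
        (trans (cong (app x) (sym (swapℕ-left a b))) (sym (y≡ a)))
        (<-trans xd<xc xa<xb)
      inv at-right at-left _ = contradiction (<-trans a<b c<d) (<-irrefl refl)
      inv at-right at-right _ = contradiction c<d (<-irrefl refl)
      inv at-right (at-other _ _) nlt = contradiction (<-trans a<b c<d) nlt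
      inv (at-other _ _) at-left nlt = contradiction (<-trans c<d a<b) nlt
      inv (at-other c≢a c≢b) at-right _ = subst₂ _<_
        (trans (cong (app x) (sym (swapℕ-right a b))) (sym (y≡ b)))
        (trans (cong (app x) (sym (swapℕ-other c≢a c≢b))) (sym (y≡ c)))
        (<-trans xa<xb xd<xc)
      inv (at-other _ _) (at-other _ _) nlt = contradiction c<d nlt

    -- The injection `move` misses the inversion (a , b) of `y`: it fixes this pair, which is no
    -- inversion of `x`.
    inversions-mono : app x a < app x b → inversions x < inversions y
    inversions-mono xa<xb = subst₂ _≤_
      (cong suc (trans (List.length-map (move) (inversionList x)) (sym (length-inversionList x))))
      (sym (length-inversionList y))
      (length-mono-⊆ (All.tabulate ab∉ ∷ Unique.map⁺ (move-injective) (inversionList-unique x)) sub)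
      where
      moved : List (ℕ × ℕ)
      moved = List.map (move) (inversionList x)
      ab∉ : ∀ {p} → p ∈ moved → (a , b) ≢ p
      ab∉ p∈ refl with (c , d) , cd∈ , eq ← ∈-map⁻ (move) p∈
        with refl ← move-injective (trans move-fixed eq)
        = <-asym xa<xb (proj₂ (proj₂ (proj₂ (∈-inversionList⁻ x cd∈))))
      sub : ∀ {p} → p ∈ (a , b) ∷ moved → p ∈ inversionList y
      sub (here refl) = ∈-inversionList⁺ y (ra , rb , a<b , subst₂ _<_
        (trans (cong (app x) (sym (swapℕ-right a b))) (sym (y≡ b)))
        (trans (cong (app x) (sym (swapℕ-left a b))) (sym (y≡ a))) xa<xb)
      sub (there p∈) with (c , d) , cd∈ , refl ← ∈-map⁻ (move) p∈
        = ∈-inversionList⁺ y (move-Inversion xa<xb c d (∈-inversionList⁻ x cd∈))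

  module _ {x y : Perm n} {a b : ℕ} (1≤a : 1 ≤ a) (a<b : a < b) (b≤n : b ≤ n)
           (y≡ : ∀ p → app y p ≡ app x (swapℕ a b p)) where

    -- Trades the length condition of `b-step` for a comparison of two values; the opposite order of
    -- the values would make `x` the longer permutation.
    inversions-mono⁻ : inversions x < inversions y → app x a < app x b
    inversions-mono⁻ lt with <-cmp (app x a) (app x b)
    ... | tri< xa<xb _ _ = xa<xb
    ... | tri≈ _ eq _ = contradiction (app-injective x eq) (<⇒≢ a<b)
    ... | tri> _ _ xb<xa = contradiction lt (<-asym (inversions-mono {y} {x} 1≤a a<b b≤n
            (swapped-≡ {x} {y} 1≤a a<b b≤n y≡)
            (subst₂ _<_ (trans (cong (app x) (sym (swapℕ-left a b))) (sym (y≡ a)))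
                        (trans (cong (app x) (sym (swapℕ-right a b))) (sym (y≡ b))) xb<xa)))

  -- Permutations are compared pointwise only, so the last step is rebuilt for `w`; its length
  -- condition is carried over as a comparison of two values of `x`.
  Bruhat-≗ : ∀ {u v w : Perm n} → Bruhat u v → (∀ p → app v p ≡ app w p) → Bruhat u w
  Bruhat-≗ (b-refl eq) v≗w = b-refl λ p → trans (eq p) (v≗w p)
  Bruhat-≗ {w = w} (b-step {x} {y} ux a b 1≤a a<b b≤n eq lt) v≗w =
    b-step ux a b 1≤a a<b b≤n eq′
      (inversions-mono {x} {w} 1≤a a<b b≤n eq′ (inversions-mono⁻ {x} {y} 1≤a a<b b≤n eq lt))
    where
    eq′ : ∀ p → app w p ≡ app x (swapℕ a b p)
    eq′ p = trans (sym (v≗w p)) (eq p)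

  Bruhat-trans : ∀ {u v w : Perm n} → Bruhat u v → Bruhat v w → Bruhat u w
  Bruhat-trans uv (b-refl eq) = Bruhat-≗ uv eq
  Bruhat-trans uv (b-step vw a b h₁ h₂ h₃ eq lt) = b-step (Bruhat-trans uv vw) a b h₁ h₂ h₃ eq lt

  Bruhat-step : ∀ {x y : Perm n} {a b} → 1 ≤ a → a < b → b ≤ n →
    (∀ p → app y p ≡ app x (swapℕ a b p)) → app x a < app x b → Bruhat x y
  Bruhat-step {x} {y} {a} {b} 1≤a a<b b≤n eq xa<xb = b-step (b-refl λ _ → refl) a b 1≤a a<b b≤n eq
    (inversions-mono {x} {y} 1≤a a<b b≤n eq xa<xb)

  module _ (i : ℕ) (hi₁ : 1 ≤ i) (hi₂ : i < n) where

    private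
      s = sᵢ n i hi₁ hi₂

      app-·s : ∀ (u : Perm n) p → app (u · s) p ≡ app u (swapℕ i (suc i) p)
      app-·s u p = trans (app-· u s p) (cong (app u) (app-sᵢ n i hi₁ hi₂ p))

      ·s·s : ∀ (u : Perm n) p → app ((u · s) · s) p ≡ app u p
      ·s·s u p = trans (app-·s (u · s) p)
        (trans (app-·s u (swapℕ i (suc i) p)) (cong (app u) (swapℕ-involutive i (suc i) p)))

    Bruhat-ascent : ∀ (u : Perm n) → app u i < app u (suc i) → Bruhat u (u · s)
    Bruhat-ascent u = Bruhat-step hi₁ (n<1+n i) hi₂ (app-·s u)

    swapℕ-adjacent-< : ∀ {a b} → a < b → (a ≡ i × b ≡ suc i) ⊎ (swapℕ i (suc i) a < swapℕ i (suc i) b)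
    swapℕ-adjacent-< {a} {b} a<b = go (swapView i (suc i) a) (swapView i (suc i) b)
      where
      go : ∀ {a′ b′} → SwapView i (suc i) a a′ → SwapView i (suc i) b b′ → (a ≡ i × b ≡ suc i) ⊎ a′ < b′
      go at-left at-left = contradiction a<b (<-irrefl refl)
      go at-left at-right = inj₁ (refl , refl)
      go at-left (at-other _ b≢) = inj₂ (≤∧≢⇒< a<b (b≢ ∘ sym))
      go at-right at-left = contradiction (<-trans a<b (n<1+n _)) (<-irrefl refl)
      go at-right at-right = contradiction a<b (<-irrefl refl)
      go at-right (at-other _ _) = inj₂ (<-trans (n<1+n i) a<b)
      go (at-other _ _) at-left = inj₂ (<-trans a<b (n<1+n i))
      go (at-other a≢ _) at-right = inj₂ (≤∧≢⇒< (s≤s⁻¹ a<b) a≢)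
      go (at-other _ _) (at-other _ _) = inj₂ a<b

    swapℕ-conjugate : ∀ a b p → let t = swapℕ i (suc i) in
                      swapℕ a b (t p) ≡ t (swapℕ (t a) (t b) p)
    swapℕ-conjugate a b p = go (swapView a b (t p)) (swapView (t a) (t b) p) refl
      where
      t = swapℕ i (suc i)
      tt = swapℕ-involutive i (suc i)
      go : ∀ {q l r} → SwapView a b q l → SwapView (t a) (t b) p r → q ≡ t p → l ≡ t r
      go at-left at-left _ = sym (tt b)
      go at-left at-right eq = trans (trans (sym (tt b)) (sym eq)) (sym (tt a))
      go at-left (at-other ≢a _) eq = contradiction (trans (sym (tt p)) (cong t (sym eq))) ≢a
      go at-right at-left eq = trans (trans (sym (tt a)) (sym eq)) (sym (tt b))
      go at-right at-right _ = sym (tt a)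
      go at-right (at-other _ ≢b) eq = contradiction (trans (sym (tt p)) (cong t (sym eq))) ≢b
      go (at-other ≢a _) at-left eq = contradiction (trans eq (tt a)) ≢a
      go (at-other _ ≢b) at-right eq = contradiction (trans eq (tt b)) ≢b
      go (at-other _ _) (at-other _ _) eq = eq

    -- A form of the lifting property without hypotheses on descents, so that induction along the
    -- chain goes through. If the last reflection is `s`, then `w · s` is `x` and the second
    -- alternative holds. Any other reflection, conjugated by `s`, still raises, so `x · s` lies
    -- below `w · s`.
    Bruhat-·s : ∀ {u w : Perm n} → Bruhat u w →
      Bruhat (u · s) (w · s) ⊎ (Bruhat (u · s) w × Bruhat u (w · s))
    Bruhat-·s {u} {w} (b-refl eq) = inj₁ (b-refl λ p →
      trans (app-·s u p) (trans (eq (swapℕ i (suc i) p)) (sym (app-·s w p))))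
    Bruhat-·s {u} {w} (b-step {x} ux a b 1≤a a<b b≤n eq lt) with swapℕ-adjacent-< a<b
    ... | inj₁ (refl , refl) = inj₂ ((case Bruhat-·s ux of λ
            { (inj₁ us≤xs) → Bruhat-≗ us≤xs (λ p → trans (app-·s x p) (sym (eq p)))
            ; (inj₂ (us≤x , _)) → Bruhat-trans us≤x x≤w }) ,
            Bruhat-≗ ux λ p → sym (trans (app-·s w p) (trans (eq (swapℕ i (suc i) p)) (cong (app x) (swapℕ-involutive i (suc i) p)))))
      where
      x≤w : Bruhat x w
      x≤w = b-step (b-refl λ _ → refl) a b 1≤a a<b b≤n eq lt
    ... | inj₂ ta<tb = case Bruhat-·s ux of λ
            { (inj₁ us≤xs) → inj₁ (Bruhat-trans us≤xs xs≤ws)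
            ; (inj₂ (us≤x , u≤xs)) → inj₂ (Bruhat-trans us≤x x≤w , Bruhat-trans u≤xs xs≤ws) }
      where
      t = swapℕ i (suc i)
      t-in : ∀ {p} → InRange n p → InRange n (t p)
      t-in = swapℕ-inRange (hi₁ , <⇒≤ hi₂) (s≤s z≤n , hi₂)
      x≤w : Bruhat x w
      x≤w = b-step (b-refl λ _ → refl) a b 1≤a a<b b≤n eq lt
      xs≤ws : Bruhat (x · s) (w · s)
      xs≤ws = Bruhat-step (proj₁ (t-in (1≤a , ≤-trans (<⇒≤ a<b) b≤n))) ta<tb
        (proj₂ (t-in (≤-trans 1≤a (<⇒≤ a<b) , b≤n)))
        (λ p → trans (app-·s w p) (trans (eq (t p)) (trans (cong (app x) (swapℕ-conjugate a b p)) (sym (app-·s x (swapℕ (t a) (t b) p))))))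
        (subst₂ _<_ (sym (trans (app-·s x (t a)) (cong (app x) (swapℕ-involutive i (suc i) a))))
                    (sym (trans (app-·s x (t b)) (cong (app x) (swapℕ-involutive i (suc i) b))))
                    (inversions-mono⁻ {x} {w} 1≤a a<b b≤n eq lt))

    module _ {w : Perm n} (w-ascent : app w i < app w (suc i)) where

      -- The lower interval of `w · s`, which has a descent at i, is closed under right
      -- multiplication by `s`. This makes the larger set a union of whole strings.
      Bruhat-lift-·s : ∀ {u} → Bruhat u (w · s) → Bruhat (u · s) (w · s)
      Bruhat-lift-·s u≤ws with Bruhat-·s u≤ws
      ... | inj₁ us≤wss = Bruhat-trans (Bruhat-≗ us≤wss (·s·s w)) (Bruhat-ascent w w-ascent)
      ... | inj₂ (us≤ws , _) = us≤ws

      Bruhat-drop-·s : ∀ {u} → app u i < app u (suc i) → Bruhat u (w · s) → Bruhat u w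
      Bruhat-drop-·s {u} u-ascent u≤ws with Bruhat-·s u≤ws
      ... | inj₁ us≤wss = Bruhat-trans (Bruhat-ascent u u-ascent) (Bruhat-≗ us≤wss (·s·s w))
      ... | inj₂ (_ , u≤wss) = Bruhat-≗ u≤wss (·s·s w)

-- Two adjacent rows as words

-- The restriction of a column S_j to the two rows i, i+1, as (i ∈ S_j , i+1 ∈ S_j). In the
-- signature rule it contributes φ₁ symbols + followed by ε₁ symbols −, where − pairs with a later +.
Column : Set
Column = Bool × Bool

Word : ℕ → Set
Word m = Vec Column m

pattern none  = false , false
pattern upper = true  , false
pattern both  = true  , true
pattern lower = false , true

ε₁ φ₁ : Column → ℕ
ε₁ none  = 0
ε₁ upper = 0
ε₁ both  = 1
ε₁ lower = 2
φ₁ none  = 0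
φ₁ upper = 2
φ₁ both  = 1
φ₁ lower = 0

-- The numbers of unpaired - and +, by the tensor product rule: the symbols - of `b` pair with
-- unpaired + of `c`, and what is left over on either side counts.
εʷ φʷ : ∀ {m} → Word m → ℕ
φʷ [] = 0
φʷ (b ∷ c) = φ₁ b + (φʷ c ∸ ε₁ b)
εʷ [] = 0
εʷ (b ∷ c) = εʷ c + (ε₁ b ∸ φʷ c)

-- w′ = f(w), equivalently w = e(w′): the rightmost unpaired + of w is turned into a −.
data FStep : ∀ {m} → Word m → Word m → Set where
  fill  : ∀ {m} {c : Word m} → φʷ c ≤ 0 → FStep (upper ∷ c) (both ∷ c)
  clear : ∀ {m} {c : Word m} → φʷ c ≤ 1 → FStep (both ∷ c) (lower ∷ c)
  skip  : ∀ {m} b {c c′ : Word m} → ε₁ b < φʷ c → FStep c c′ → FStep (b ∷ c) (b ∷ c′)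

FStep-φ : ∀ {m} {w w′ : Word m} → FStep w w′ → φʷ w ≡ suc (φʷ w′)
FStep-φ (fill {c = c} φc≤0) with φʷ c | φc≤0
... | zero | _ = refl
FStep-φ (clear {c = c} φc≤1) with φʷ c | φc≤1
... | zero | _ = refl
... | suc zero | _ = refl
... | suc (suc _) | s≤s ()
FStep-φ (skip b {c} {c′} lt st) rewrite FStep-φ st = begin
  φ₁ b + (suc (φʷ c′) ∸ ε₁ b) ≡⟨ cong (φ₁ b +_) (+-∸-assoc 1 (s≤s⁻¹ lt)) ⟩
  φ₁ b + suc (φʷ c′ ∸ ε₁ b)   ≡⟨ +-suc (φ₁ b) _ ⟩
  suc (φ₁ b + (φʷ c′ ∸ ε₁ b)) ∎
  where open ≡-Reasoning

FStep-ε : ∀ {m} {w w′ : Word m} → FStep w w′ → εʷ w′ ≡ suc (εʷ w)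
FStep-ε (fill {c = c} φc≤0) with φʷ c | φc≤0
... | zero | _ = trans (+-comm (εʷ c) 1) (cong suc (sym (+-identityʳ (εʷ c))))
FStep-ε (clear {c = c} φc≤1) with φʷ c | φc≤1
... | zero | _ = +-suc (εʷ c) 1
... | suc zero | _ = +-suc (εʷ c) 0
... | suc (suc _) | s≤s ()
FStep-ε (skip b {c} {c′} lt st) rewrite FStep-ε st | FStep-φ st
  | m≤n⇒m∸n≡0 (s≤s⁻¹ lt) | m≤n⇒m∸n≡0 (<⇒≤ lt) = refl

-- The bounds 0 and 1 in `fill` and `clear` are `ε₁ upper` and `ε₁ both`; together with `skip` they
-- cover both branches of the tensor product rule, as a column without a symbol + can only be
-- skipped.
FStep-exists : ∀ {m} (w : Word m) → 0 < φʷ w → ∃[ w′ ] FStep w w′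
FStep-exists (b ∷ c) pos with ε₁ b <? φʷ c
... | yes lt with c′ , st ← FStep-exists c (≤-<-trans z≤n lt) = b ∷ c′ , skip b lt st
FStep-exists (upper ∷ c) pos | no nlt = both ∷ c , fill (≮⇒≥ nlt)
FStep-exists (both ∷ c) pos | no nlt = lower ∷ c , clear (≮⇒≥ nlt)
FStep-exists (none ∷ c) pos | no nlt = contradiction pos nlt
FStep-exists (lower ∷ c) pos | no nlt rewrite m≤n⇒m∸n≡0 (≮⇒≥ nlt) = contradiction pos λ ()

FStep-exists⁻ : ∀ {m} (w′ : Word m) → 0 < εʷ w′ → ∃[ w ] FStep w w′
FStep-exists⁻ (b ∷ c′) pos with ε₁ b ≤? φʷ c′
... | yes le with c , st ← FStep-exists⁻ c′ (subst (0 <_)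
        (trans (cong (εʷ c′ +_) (m≤n⇒m∸n≡0 le)) (+-identityʳ _)) pos)
    = b ∷ c , skip b (≤-<-trans le (subst (φʷ c′ <_) (sym (FStep-φ st)) (n<1+n _))) st
FStep-exists⁻ (upper ∷ c) pos | no nle = contradiction z≤n nle
FStep-exists⁻ (both ∷ c) pos | no nle = upper ∷ c , fill (s≤s⁻¹ (≰⇒> nle))
FStep-exists⁻ (none ∷ c) pos | no nle = contradiction z≤n nle
FStep-exists⁻ (lower ∷ c) pos | no nle = both ∷ c , clear (s≤s⁻¹ (≰⇒> nle))

-- Propagation of the right labels (p , q) of the two rows through one column with
-- bottom label b; the first component is the emitted top label.
passColumn : Column → ℕ → ℕ → ℕ → ℕ × (ℕ × ℕ)
passColumn (u , l) p q b = proj₁ up , proj₂ up , proj₂ low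
  where
  low = tileAct (toTile l) q b
  up  = tileAct (toTile u) p (proj₁ low)

Outcome : ℕ → Set
Outcome m = Vec ℕ m × (ℕ × ℕ)

emit : ∀ {m} → ℕ → Outcome m → Outcome (suc m)
emit t (ts , r) = t ∷ ts , r

swapRight : ∀ {m} → Outcome m → Outcome m
swapRight (ts , p , q) = ts , q , p

passRows : ∀ {m} → ℕ × ℕ → Vec ℕ m → Word m → Outcome m
passRows r [] [] = [] , r
passRows (p , q) (b ∷ bs) (c ∷ w) = emit (proj₁ s) (passRows (proj₂ s) bs w)
  where s = passColumn c p q b

-- In an array the two rows are traced one after the other. Sweeping them column by column instead
-- lets an induction follow the pairing of symbols.
passRows-processRow : ∀ {m} p q (bs : Vec ℕ m) w →
  let low = processRow q bs (Vec.map (toTile ∘ proj₂) w)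
      up  = processRow p (proj₁ low) (Vec.map (toTile ∘ proj₁) w)
  in passRows (p , q) bs w ≡ (proj₁ up , proj₂ up , proj₂ low)
passRows-processRow p q [] [] = refl
passRows-processRow p q (b ∷ bs) (c ∷ w) =
  cong (emit (proj₁ s)) (passRows-processRow (proj₁ (proj₂ s)) (proj₂ (proj₂ s)) bs w)
  where s = passColumn c p q b

-- The largest of the three labels goes up in either order. If b is at most both p and q, the
-- outgoing labels agree; if b is at least the smaller of them, the outgoing labels are exchanged
-- too.
passNone-swap : ∀ p q b → let s = passColumn none p q b ; s′ = passColumn none q p b in
  proj₁ s′ ≡ proj₁ s × (proj₂ s′ ≡ proj₂ s ⊎ proj₂ s′ ≡ (proj₂ (proj₂ s) , proj₁ (proj₂ s)))
passNone-swap p q b = top , right (≤-total p q)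
  where
  top : q ⊔ (p ⊔ b) ≡ p ⊔ (q ⊔ b)
  top = trans (sym (⊔-assoc q p b)) (trans (cong (_⊔ b) (⊔-comm q p)) (⊔-assoc p q b))
  ordered : ∀ p q → p ≤ q → ((p ⊓ (q ⊔ b) , q ⊓ b) ≡ (q ⊓ (p ⊔ b) , p ⊓ b)) ⊎
                            ((p ⊓ (q ⊔ b) , q ⊓ b) ≡ (p ⊓ b , q ⊓ (p ⊔ b)))
  ordered p q p≤q with ≤-total b p
  ... | inj₁ b≤p = inj₁ (cong₂ _,_
          (trans (m≤n⇒m⊓n≡m (≤-trans p≤q (m≤m⊔n q b))) (sym (trans (cong (q ⊓_) (m≥n⇒m⊔n≡m b≤p)) (m≥n⇒m⊓n≡n p≤q))))
          (trans (m≥n⇒m⊓n≡n (≤-trans b≤p p≤q)) (sym (m≥n⇒m⊓n≡n b≤p))))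
  ... | inj₂ p≤b = inj₂ (cong₂ _,_
          (trans (m≤n⇒m⊓n≡m (≤-trans p≤q (m≤m⊔n q b))) (sym (m≤n⇒m⊓n≡m p≤b)))
          (cong (q ⊓_) (sym (m≤n⇒m⊔n≡n p≤b))))
  right : p ≤ q ⊎ q ≤ p → ((q ⊓ (p ⊔ b) , p ⊓ b) ≡ (p ⊓ (q ⊔ b) , q ⊓ b)) ⊎
                          ((q ⊓ (p ⊔ b) , p ⊓ b) ≡ (q ⊓ b , p ⊓ (q ⊔ b)))
  right (inj₂ q≤p) = ordered q p q≤p
  right (inj₁ p≤q) with ordered p q p≤q
  ... | inj₁ eq = inj₁ (sym eq)
  ... | inj₂ eq = inj₂ (sym (cong (λ { (r , s) → s , r }) eq))

-- If every + of w is paired, the first nonempty column of w is {i+1}, which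
-- forgets the order of the two incoming labels.
passRows-swap : ∀ {m} p q (bs : Vec ℕ m) w → φʷ w ≡ 0 →
  passRows (q , p) bs w ≡ passRows (p , q) bs w ⊎
  (εʷ w ≡ 0 × passRows (q , p) bs w ≡ swapRight (passRows (p , q) bs w))
passRows-swap p q [] [] _ = inj₂ (refl , refl)
passRows-swap p q (b ∷ bs) (none ∷ w) φ≡0
  with top , right ← passNone-swap p q b
  rewrite top with right
... | inj₁ eq = inj₁ (cong (λ r → emit (p ⊔ (q ⊔ b)) (passRows r bs w)) eq)
... | inj₂ eq rewrite eq
  with passRows-swap (p ⊓ (q ⊔ b)) (q ⊓ b) bs w φ≡0
...   | inj₁ eq′ = inj₁ (cong (emit _) eq′)
...   | inj₂ (ε≡0 , eq′) = inj₂ (trans (cong (εʷ w +_) (0∸n≡0 (φʷ w))) (trans (+-identityʳ _) ε≡0) , cong (emit _) eq′)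
passRows-swap p q (b ∷ bs) (lower ∷ w) _ =
  inj₁ (cong₂ (λ t r → emit t (passRows (r , b) bs w)) (⊔-comm q p) (⊓-comm q p))

-- `ε₁ c + (E ∸ φ₁ c)` counts the unpaired - once `c` is passed. It vanishes only for an empty
-- column, which keeps sorted labels sorted, or for {i}, whose lower crossing sorts q and b while
-- the bump above it turns their maximum to the right.
passColumn-sorted : ∀ c {E p q} b → (E ≡ 0 → q ≤ p) → ε₁ c + (E ∸ φ₁ c) ≡ 0 →
  let r = proj₂ (passColumn c p q b) in proj₂ r ≤ proj₁ r
passColumn-sorted none {p = p} {q} b h eq = ⊓-glb (≤-trans (m⊓n≤m q b) (h eq)) (≤-trans (m⊓n≤m q b) (m≤m⊔n q b))
passColumn-sorted upper {p = p} {q} b h eq = ≤-trans (m⊓n≤m q b) (m≤m⊔n q b)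

-- E counts the unpaired − to the left of the word under consideration.
passRows-sorted : ∀ {m} E p q (bs : Vec ℕ m) w → (E ≡ 0 → q ≤ p) → εʷ w ≡ 0 → E ≤ φʷ w →
  let r = proj₂ (passRows (p , q) bs w) in proj₂ r ≤ proj₁ r
passRows-sorted E p q [] [] h _ E≤0 = h (n≤0⇒n≡0 E≤0)
passRows-sorted E p q (b ∷ bs) (c ∷ w) h ε≡0 E≤ =
  passRows-sorted (ε₁ c + (E ∸ φ₁ c)) _ _ bs w (passColumn-sorted c b h)
    (m+n≡0⇒m≡0 (εʷ w) ε≡0) (begin
    ε₁ c + (E ∸ φ₁ c)                ≤⟨ +-monoʳ-≤ (ε₁ c) (m≤n+o⇒m∸n≤o E (φ₁ c) E≤) ⟩
    ε₁ c + (φʷ w ∸ ε₁ c)             ≡⟨ m+[n∸m]≡n (m∸n≡0⇒m≤n (m+n≡0⇒n≡0 (εʷ w) ε≡0)) ⟩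
    φʷ w                             ∎)
  where open ≤-Reasoning

unpaired-< : ∀ {E e f g} → e < g → E < f + (g ∸ e) → e + (E ∸ f) < g
unpaired-< {E} {e} {f} {g} e<g E< = begin-strict
  e + (E ∸ f)   <⟨ +-monoʳ-< e (m<n+o⇒m∸n<o E f {{>-nonZero (m<n⇒0<n∸m e<g)}} E<) ⟩
  e + (g ∸ e)   ≡⟨ m+[n∸m]≡n (<⇒≤ e<g) ⟩
  g             ∎
  where open ≤-Reasoning

-- A `clear` step crosses labels q ≤ p, granted by the sweep since there E = 0, and changes nothing.
-- A `fill` step changes nothing or exchanges the two outgoing labels; no + is unpaired further
-- right, so `passRows-swap` tells whether the exchange survives, and it can only do so when no - is
-- unpaired either.
passRows-FStep : ∀ {m} {w w′ : Word m} → FStep w w′ → ∀ E p q bs → (E ≡ 0 → q ≤ p) → E < φʷ w →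
  passRows (p , q) bs w′ ≡ passRows (p , q) bs w ⊎
  (εʷ w ≡ 0 × passRows (p , q) bs w′ ≡ swapRight (passRows (p , q) bs w))
passRows-FStep (fill {c = c} φc≤0) E p q (b ∷ bs) h E< with ≤-total b q
... | inj₁ b≤q rewrite m≥n⇒m⊔n≡m b≤q | m≥n⇒m⊓n≡n b≤q = inj₁ refl
... | inj₂ q≤b rewrite m≤n⇒m⊔n≡n q≤b | m≤n⇒m⊓n≡m q≤b with passRows-swap b q bs c (n≤0⇒n≡0 φc≤0)
...   | inj₁ eq = inj₁ (cong (emit p) eq)
...   | inj₂ (ε≡0 , eq) = inj₂ (trans (cong (εʷ c +_) (0∸n≡0 (φʷ c))) (trans (+-identityʳ _) ε≡0) , cong (emit p) eq)
passRows-FStep (clear {c = c} φc≤1) E p q (b ∷ bs) h E< rewrite m≤n⇒m∸n≡0 φc≤1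
  with q≤p ← h (n<1⇒n≡0 E<)
  rewrite m≥n⇒m⊔n≡m q≤p | m≥n⇒m⊓n≡n q≤p = inj₁ refl
passRows-FStep (skip k {c} {c′} lt st) E p q (b ∷ bs) h E<
  with passRows-FStep st (ε₁ k + (E ∸ φ₁ k)) _ _ bs (passColumn-sorted k b h) (unpaired-< lt E<)
... | inj₁ eq = inj₁ (cong (emit _) eq)
... | inj₂ (ε≡0 , eq) = inj₂ (trans (cong (εʷ c +_) (m≤n⇒m∸n≡0 (<⇒≤ lt))) (trans (+-identityʳ _) ε≡0) , cong (emit _) eq)

upperTiles lowerTiles : ∀ {m} → Word m → Vec Tile m
upperTiles = Vec.map (toTile ∘ proj₁)
lowerTiles = Vec.map (toTile ∘ proj₂)

upperBumps lowerBumps : ∀ {m} → Word m → ℕ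
upperBumps w = countBumps (upperTiles w)
lowerBumps w = countBumps (lowerTiles w)

∸-balance : ∀ a b → b + (a ∸ b) ≡ a + (b ∸ a)
∸-balance zero zero = refl
∸-balance zero (suc b) = cong suc (+-identityʳ b)
∸-balance (suc a) zero = cong suc (sym (+-identityʳ a))
∸-balance (suc a) (suc b) = cong suc (∸-balance a b)

-- The identity φ - ε = 2 (upper bumps - lower bumps) without subtraction. Each column satisfies it,
-- {i} carrying two symbols + and {i+1} two symbols -, and pairing cancels one of each.
εʷ-φʷ-balance : ∀ {m} (w : Word m) → φʷ w + 2 * lowerBumps w ≡ εʷ w + 2 * upperBumps w
εʷ-φʷ-balance [] = refl
εʷ-φʷ-balance (none ∷ w) with ih ← εʷ-φʷ-balance w rewrite 0∸n≡0 (φʷ w) | +-identityʳ (εʷ w) = ih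
εʷ-φʷ-balance (upper ∷ w) with ih ← εʷ-φʷ-balance w rewrite 0∸n≡0 (φʷ w) | +-identityʳ (εʷ w) = begin
  2 + (φʷ w + 2 * lowerBumps w)     ≡⟨ cong (2 +_) ih ⟩
  2 + (εʷ w + 2 * upperBumps w)     ≡⟨ solve 2 (λ a b → con 2 :+ (a :+ con 2 :* b) := a :+ con 2 :* (con 1 :+ b)) refl (εʷ w) (upperBumps w) ⟩
  εʷ w + 2 * (1 + upperBumps w)     ∎
  where open ≡-Reasoning
εʷ-φʷ-balance (both ∷ w) with ih ← εʷ-φʷ-balance w = begin
  1 + (φʷ w ∸ 1) + 2 * (1 + lowerBumps w)
    ≡⟨ solve 2 (λ a b → con 1 :+ a :+ con 2 :* (con 1 :+ b) := (con 1 :+ a) :+ con 2 :* b :+ con 2) refl (φʷ w ∸ 1) (lowerBumps w) ⟩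
  1 + (φʷ w ∸ 1) + 2 * lowerBumps w + 2
    ≡⟨ cong (λ k → k + 2 * lowerBumps w + 2) (∸-balance (φʷ w) 1) ⟩
  φʷ w + (1 ∸ φʷ w) + 2 * lowerBumps w + 2
    ≡⟨ solve 3 (λ a b c → a :+ b :+ con 2 :* c :+ con 2 := (a :+ con 2 :* c) :+ (b :+ con 2)) refl (φʷ w) (1 ∸ φʷ w) (lowerBumps w) ⟩
  φʷ w + 2 * lowerBumps w + (1 ∸ φʷ w + 2)
    ≡⟨ cong (_+ (1 ∸ φʷ w + 2)) ih ⟩
  εʷ w + 2 * upperBumps w + (1 ∸ φʷ w + 2)
    ≡⟨ solve 3 (λ a b c → a :+ con 2 :* b :+ (c :+ con 2) := a :+ c :+ con 2 :* (con 1 :+ b)) refl (εʷ w) (upperBumps w) (1 ∸ φʷ w) ⟩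
  εʷ w + (1 ∸ φʷ w) + 2 * (1 + upperBumps w) ∎
  where open ≡-Reasoning
εʷ-φʷ-balance (lower ∷ w) with ih ← εʷ-φʷ-balance w = begin
  φʷ w ∸ 2 + 2 * (1 + lowerBumps w)
    ≡⟨ solve 2 (λ a b → a :+ con 2 :* (con 1 :+ b) := (con 2 :+ a) :+ con 2 :* b) refl (φʷ w ∸ 2) (lowerBumps w) ⟩
  2 + (φʷ w ∸ 2) + 2 * lowerBumps w
    ≡⟨ cong (_+ 2 * lowerBumps w) (∸-balance (φʷ w) 2) ⟩
  φʷ w + (2 ∸ φʷ w) + 2 * lowerBumps w
    ≡⟨ solve 3 (λ a b c → a :+ b :+ con 2 :* c := (a :+ con 2 :* c) :+ b) refl (φʷ w) (2 ∸ φʷ w) (lowerBumps w) ⟩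
  φʷ w + 2 * lowerBumps w + (2 ∸ φʷ w)
    ≡⟨ cong (_+ (2 ∸ φʷ w)) ih ⟩
  εʷ w + 2 * upperBumps w + (2 ∸ φʷ w)
    ≡⟨ solve 3 (λ a b c → a :+ con 2 :* b :+ c := a :+ c :+ con 2 :* b) refl (εʷ w) (upperBumps w) (2 ∸ φʷ w) ⟩
  εʷ w + (2 ∸ φʷ w) + 2 * upperBumps w ∎
  where open ≡-Reasoning

-- The parity of `φʷ` separates the two kinds of step, so they alternate along a string.
data StepKind {m} (w w′ : Word m) : Set where
  filling  : lowerBumps w′ ≡ suc (lowerBumps w) → upperBumps w′ ≡ upperBumps w →
             ∃[ k ] φʷ w ≡ 2 + k * 2 → StepKind w w′
  clearing : lowerBumps w′ ≡ lowerBumps w → upperBumps w ≡ suc (upperBumps w′) →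
             ∃[ k ] φʷ w ≡ 1 + k * 2 → StepKind w w′

FStep-kind : ∀ {m} {w w′ : Word m} → FStep w w′ → StepKind w w′
FStep-kind (fill {c = c} φc≤0) = filling refl refl (0 , cong (2 +_) (n≤0⇒n≡0 φc≤0))
FStep-kind (clear {c = c} φc≤1) = clearing refl refl (0 , cong suc (m≤n⇒m∸n≡0 φc≤1))
FStep-kind (skip none lt st) with FStep-kind st
... | filling l u φ≡ = filling l u φ≡
... | clearing l u φ≡ = clearing l u φ≡
FStep-kind (skip upper {c} lt st) with FStep-kind st
... | filling l u (k , eq) = filling l (cong suc u) (suc k , cong (2 +_) eq)
... | clearing l u (k , eq) = clearing l (cong suc u) (suc k , cong (2 +_) eq)
FStep-kind (skip both {c} lt st) with FStep-kind st
... | filling l u (k , eq) = filling (cong suc l) (cong suc u) (k , trans (m+[n∸m]≡n (<⇒≤ lt)) eq)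
... | clearing l u (k , eq) = clearing (cong suc l) (cong suc u) (k , trans (m+[n∸m]≡n (<⇒≤ lt)) eq)
FStep-kind (skip lower {c} lt st) with FStep-kind st
... | filling l u (zero , eq) = contradiction (subst (2 <_) eq lt) (<-irrefl refl)
... | filling l u (suc k , eq) = filling (cong suc l) u (k , cong (_∸ 2) eq)
... | clearing l u (zero , eq) = contradiction (<⇒≤ (subst (2 <_) eq lt)) (λ { (s≤s ()) })
... | clearing l u (suc k , eq) = clearing (cong suc l) u (k , cong (_∸ 2) eq)

-- The crystal operators on words

module _ {A : Set} where

  get-put : ∀ {n} (d : A) (xs : Vec A n) i {a} → InRange n i → get d (put xs i a) i ≡ a
  get-put d xs (suc i) (_ , lt) = go xs i lt
    where
    go : ∀ {n} (xs : Vec A n) k {a} → k < n → get0 d (put0 xs k a) k ≡ a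
    go (y ∷ xs) zero _ = refl
    go (y ∷ xs) (suc k) (s≤s lt) = go xs k lt

  get-put-other : ∀ {n} (d : A) (xs : Vec A n) i j {a} → i ≢ j → get d (put xs i a) j ≡ get d xs j
  get-put-other d xs zero j _ = refl
  get-put-other d xs (suc i) zero _ = refl
  get-put-other d xs (suc i) (suc j) i≢j = go xs i j (i≢j ∘ cong suc)
    where
    go : ∀ {n} (xs : Vec A n) k l {a} → k ≢ l → get0 d (put0 xs k a) l ≡ get0 d xs l
    go [] k l _ = refl
    go (y ∷ xs) zero zero k≢l = contradiction refl k≢l
    go (y ∷ xs) zero (suc l) _ = refl
    go (y ∷ xs) (suc k) zero _ = refl
    go (y ∷ xs) (suc k) (suc l) k≢l = go xs k l (k≢l ∘ cong suc)

  put-get : ∀ {n} (d : A) (xs : Vec A n) i → put xs i (get d xs i) ≡ xs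
  put-get d xs zero = refl
  put-get d xs (suc i) = go xs i
    where
    go : ∀ {n} (xs : Vec A n) k → put0 xs k (get0 d xs k) ≡ xs
    go [] k = refl
    go (y ∷ xs) zero = refl
    go (y ∷ xs) (suc k) = cong (y ∷_) (go xs k)

  put-put : ∀ {n} (xs : Vec A n) i {a b} → put (put xs i a) i b ≡ put xs i b
  put-put xs zero = refl
  put-put xs (suc i) = go xs i
    where
    go : ∀ {n} (xs : Vec A n) k {a b} → put0 (put0 xs k a) k b ≡ put0 xs k b
    go [] k = refl
    go (y ∷ xs) zero = refl
    go (y ∷ xs) (suc k) = cong (y ∷_) (go xs k)

  put-comm : ∀ {n} (xs : Vec A n) i j {a b} → i ≢ j → put (put xs i a) j b ≡ put (put xs j b) i a
  put-comm xs zero j _ = refl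
  put-comm xs (suc i) zero _ = refl
  put-comm xs (suc i) (suc j) i≢j = go xs i j (i≢j ∘ cong suc)
    where
    go : ∀ {n} (xs : Vec A n) k l {a b} → k ≢ l → put0 (put0 xs k a) l b ≡ put0 (put0 xs l b) k a
    go [] k l _ = refl
    go (y ∷ xs) zero zero k≢l = contradiction refl k≢l
    go (y ∷ xs) zero (suc l) _ = refl
    go (y ∷ xs) (suc k) zero _ = refl
    go (y ∷ xs) (suc k) (suc l) k≢l = cong (y ∷_) (go xs k l (k≢l ∘ cong suc))

  get₂ : ∀ {n} → A → ℕ → Vec A n → A × A
  get₂ d i xs = get d xs i , get d xs (suc i)

  put₂ : ∀ {n} → ℕ → Vec A n → A × A → Vec A n
  put₂ i xs (a , b) = put (put xs i a) (suc i) b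

  put₂-get₂ : ∀ {n} (d : A) i (xs : Vec A n) → put₂ i xs (get₂ d i xs) ≡ xs
  put₂-get₂ d i xs = trans (cong (λ ys → put ys (suc i) (get d xs (suc i))) (put-get d xs i)) (put-get d xs (suc i))

  get₂-put₂ : ∀ {n} (d : A) i (xs : Vec A n) ab → 1 ≤ i → i < n → get₂ d i (put₂ i xs ab) ≡ ab
  get₂-put₂ d i xs (a , b) 1≤i i<n = cong₂ _,_
    (trans (get-put-other d (put xs i a) (suc i) i (1+n≢n)) (get-put d xs i (1≤i , <⇒≤ i<n)))
    (get-put d (put xs i a) (suc i) (s≤s z≤n , i<n))

  put₂-put₂ : ∀ {n} i (xs : Vec A n) ab ab′ → put₂ i (put₂ i xs ab) ab′ ≡ put₂ i xs ab′
  put₂-put₂ i xs (a , b) (a′ , b′) = begin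
    put (put (put (put xs i a) (suc i) b) i a′) (suc i) b′
      ≡⟨ cong (λ ys → put ys (suc i) b′) (put-comm (put xs i a) (suc i) i 1+n≢n) ⟩
    put (put (put (put xs i a) i a′) (suc i) b) (suc i) b′
      ≡⟨ put-put (put (put xs i a) i a′) (suc i) ⟩
    put (put (put xs i a) i a′) (suc i) b′
      ≡⟨ cong (λ ys → put ys (suc i) b′) (put-put xs i) ⟩
    put (put xs i a′) (suc i) b′ ∎
    where open ≡-Reasoning

module _ {A B : Set} (f : A → B) where

  map-put : ∀ {n} (xs : Vec A n) i {a} → Vec.map f (put xs i a) ≡ put (Vec.map f xs) i (f a)
  map-put xs zero = refl
  map-put xs (suc i) = go xs i
    where
    go : ∀ {n} (xs : Vec A n) k {a} → Vec.map f (put0 xs k a) ≡ put0 (Vec.map f xs) k (f a)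
    go [] k = refl
    go (y ∷ xs) zero = refl
    go (y ∷ xs) (suc k) = cong (f y ∷_) (go xs k)

  get-map : ∀ {n} d (xs : Vec A n) i → get (f d) (Vec.map f xs) i ≡ f (get d xs i)
  get-map d xs zero = refl
  get-map d xs (suc i) = go xs i
    where
    go : ∀ {n} (xs : Vec A n) k → get0 (f d) (Vec.map f xs) k ≡ f (get0 d xs k)
    go [] k = refl
    go (y ∷ xs) zero = refl
    go (y ∷ xs) (suc k) = go xs k

  transpose-map : ∀ {m n} (D : Vec (Vec A m) n) →
    Vec.transpose (Vec.map (Vec.map f) D) ≡ Vec.map (Vec.map f) (Vec.transpose D)
  transpose-map [] = sym (Vec.map-replicate (Vec.map f) [] _)
  transpose-map (r ∷ D) rewrite transpose-map D = go r (Vec.transpose D)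
    where
    go : ∀ {m n} (r : Vec A m) (X : Vec (Vec A n) m) →
         ((Vec.replicate _ _∷_ Vec.⊛ Vec.map f r) Vec.⊛ Vec.map (Vec.map f) X) ≡
         Vec.map (Vec.map f) ((Vec.replicate _ _∷_ Vec.⊛ r) Vec.⊛ X)
    go [] [] = refl
    go (y ∷ r) (z ∷ X) = cong (_ ∷_) (go r X)

module _ {A : Set} where

  transpose-involutive : ∀ {m n} (D : Vec (Vec A m) n) → Vec.transpose (Vec.transpose D) ≡ D
  transpose-involutive {m} [] = empty (Vec.transpose (Vec.replicate m []))
    where
    empty : (v : Vec (Vec A m) 0) → v ≡ []
    empty [] = refl
  transpose-involutive (r ∷ D) = trans (go r (Vec.transpose D)) (cong (r ∷_) (transpose-involutive D))
    where
    go : ∀ {m n} (r : Vec A m) (X : Vec (Vec A n) m) →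
         Vec.transpose ((Vec.replicate _ _∷_ Vec.⊛ r) Vec.⊛ X) ≡ r ∷ Vec.transpose X
    go [] [] = refl
    go (y ∷ r) (z ∷ X) rewrite go r X = refl

  row-transpose : ∀ {m n} (d : A) (D : Vec (Vec A m) n) i →
    Vec.map (λ c → get d c i) (Vec.transpose D) ≡ get (Vec.replicate m d) D i
  row-transpose d D zero = Vec.map-const (Vec.transpose D) d
  row-transpose d D (suc i) = go D i
    where
    go : ∀ {m n} (D : Vec (Vec A m) n) k →
         Vec.map (λ c → get0 d c k) (Vec.transpose D) ≡ get0 (Vec.replicate m d) D k
    go {m} [] k = Vec.map-replicate _ [] m
    go (r ∷ D) zero = first r (Vec.transpose D)
      where
      first : ∀ {m n} (r : Vec A m) (X : Vec (Vec A n) m) →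
              Vec.map (λ c → get0 d c zero) ((Vec.replicate _ _∷_ Vec.⊛ r) Vec.⊛ X) ≡ r
      first [] [] = refl
      first (y ∷ r) (z ∷ X) = cong (y ∷_) (first r X)
    go (r ∷ D) (suc k) = trans (later r (Vec.transpose D)) (go D k)
      where
      later : ∀ {m n} (r : Vec A m) (X : Vec (Vec A n) m) →
              Vec.map (λ c → get0 d c (suc k)) ((Vec.replicate _ _∷_ Vec.⊛ r) Vec.⊛ X) ≡ Vec.map (λ c → get0 d c k) X
      later [] [] = refl
      later (y ∷ r) (z ∷ X) = cong (_ ∷_) (later r X)

  put-transpose : ∀ {m n} (D : Vec (Vec A m) n) i (row : Vec A m) →
    Vec.zipWith (λ c a → put c i a) (Vec.transpose D) row ≡ Vec.transpose (put D i row)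
  put-transpose D zero row = keep (Vec.transpose D) row
    where
    keep : ∀ {m n} (X : Vec (Vec A n) m) (row : Vec A m) → Vec.zipWith (λ c a → c) X row ≡ X
    keep [] [] = refl
    keep (z ∷ X) (a ∷ row) = cong (z ∷_) (keep X row)
  put-transpose D (suc i) row = go D i row
    where
    go : ∀ {m n} (D : Vec (Vec A m) n) k (row : Vec A m) →
         Vec.zipWith (λ c a → put0 c k a) (Vec.transpose D) row ≡ Vec.transpose (put0 D k row)
    go [] k [] = refl
    go [] k (a ∷ row) = cong ([] ∷_) (go [] k row)
    go (r ∷ D) zero row = first r (Vec.transpose D) row
      where
      first : ∀ {m n} (r : Vec A m) (X : Vec (Vec A n) m) (row : Vec A m) →
              Vec.zipWith (λ c a → put0 c zero a) ((Vec.replicate _ _∷_ Vec.⊛ r) Vec.⊛ X) row ≡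
              ((Vec.replicate _ _∷_ Vec.⊛ row) Vec.⊛ X)
      first [] [] [] = refl
      first (y ∷ r) (z ∷ X) (a ∷ row) = cong (_ ∷_) (first r X row)
    go (r ∷ D) (suc k) row rewrite sym (go D k row) = later r (Vec.transpose D) row
      where
      later : ∀ {m n} (r : Vec A m) (X : Vec (Vec A n) m) (row : Vec A m) →
              Vec.zipWith (λ c a → put0 c (suc k) a) ((Vec.replicate _ _∷_ Vec.⊛ r) Vec.⊛ X) row ≡
              ((Vec.replicate _ _∷_ Vec.⊛ r) Vec.⊛ Vec.zipWith (λ c a → put0 c k a) X row)
      later [] [] [] = refl
      later (y ∷ r) (z ∷ X) (a ∷ row) = cong (_ ∷_) (later r X row)

-- `count` runs on fuel; a rank that is 0 only where `g` fails and drops by one at each application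
-- identifies it with the true number, given enough fuel.
count-exact : ∀ {B : Set} (g : B → Maybe B) (rank : B → ℕ) →
  (∀ b → rank b ≡ 0 → g b ≡ nothing) →
  (∀ b → 0 < rank b → ∃[ b′ ] (g b ≡ just b′ × rank b ≡ suc (rank b′))) →
  ∀ k b → rank b ≤ k → count g k b ≡ rank b
count-exact g rank g-zero g-suc zero b rb≤ = sym (n≤0⇒n≡0 rb≤)
count-exact g rank g-zero g-suc (suc k) b rb≤ with rank b ≟ 0
... | yes rb≡0 rewrite g-zero b rb≡0 = sym rb≡0
... | no rb≢0 with b′ , gb≡ , rb≡ ← g-suc b (n≢0⇒n>0 rb≢0) rewrite gb≡ =
  trans (cong suc (count-exact g rank g-zero g-suc k b′ (s≤s⁻¹ (subst (_≤ suc k) rb≡ rb≤)))) (sym rb≡)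

-- The operators of a crystal K act on B through the rows i, i+1, read as words of
-- length m by `read` and overwritten by `write`.
record ActsOnWords {B : Set} (K : CrystalOps B) (i m : ℕ) : Set where
  open CrystalOps K
  field
    read  : B → Word m
    write : B → Word m → B
    read-write : ∀ b w → read (write b w) ≡ w
    write-read : ∀ b → write b (read b) ≡ b
    f-just    : ∀ {b w} → FStep (read b) w → f i b ≡ just (write b w)
    f-nothing : ∀ {b} → φʷ (read b) ≡ 0 → f i b ≡ nothing
    e-just    : ∀ {b w} → FStep w (read b) → e i b ≡ just (write b w)
    e-nothing : ∀ {b} → εʷ (read b) ≡ 0 → e i b ≡ nothing
    size-bound : suc (2 * m) ≤ size

-- Shows that the fuel suffices. The additional 1 in `size-bound` lets the induction start at the
-- one-element crystal and pass through products: multiplying 2m+1 by the factor 2^n ≥ 3 yields at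
-- least 2(m+1)+1.
φʷ-bound : ∀ {m} (w : Word m) → φʷ w ≤ 2 * m
φʷ-bound [] = z≤n
φʷ-bound {suc m} (b ∷ c) = begin
  φ₁ b + (φʷ c ∸ ε₁ b) ≤⟨ +-mono-≤ (φ₁≤2 b) (≤-trans (m∸n≤m (φʷ c) (ε₁ b)) (φʷ-bound c)) ⟩
  2 + 2 * m            ≡⟨ *-suc 2 m ⟨
  2 * suc m            ∎
  where
  open ≤-Reasoning
  φ₁≤2 : ∀ b → φ₁ b ≤ 2
  φ₁≤2 none  = z≤n
  φ₁≤2 upper = ≤-refl
  φ₁≤2 both  = s≤s z≤n
  φ₁≤2 lower = z≤n

εʷ-bound : ∀ {m} (w : Word m) → εʷ w ≤ 2 * m
εʷ-bound [] = z≤n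
εʷ-bound {suc m} (b ∷ c) = begin
  εʷ c + (ε₁ b ∸ φʷ c) ≤⟨ +-mono-≤ (εʷ-bound c) (≤-trans (m∸n≤m (ε₁ b) (φʷ c)) (ε₁≤2 b)) ⟩
  2 * m + 2            ≡⟨ +-comm (2 * m) 2 ⟩
  2 + 2 * m            ≡⟨ *-suc 2 m ⟨
  2 * suc m            ∎
  where
  open ≤-Reasoning
  ε₁≤2 : ∀ b → ε₁ b ≤ 2
  ε₁≤2 none  = z≤n
  ε₁≤2 upper = z≤n
  ε₁≤2 both  = s≤s z≤n
  ε₁≤2 lower = ≤-refl

module _ {B : Set} {K : CrystalOps B} {i m : ℕ} (A : ActsOnWords K i m) where
  open CrystalOps K
  open ActsOnWords A

  φ-read : ∀ b → φ K i b ≡ φʷ (read b)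
  φ-read b = count-exact (f i) (φʷ ∘ read) (λ _ → f-nothing) step size b
    (≤-trans (φʷ-bound (read b)) (<⇒≤ size-bound))
    where
    step : ∀ b → 0 < φʷ (read b) → ∃[ b′ ] (f i b ≡ just b′ × φʷ (read b) ≡ suc (φʷ (read b′)))
    step b pos with w , st ← FStep-exists (read b) pos =
      write b w , f-just st , trans (FStep-φ st) (cong (suc ∘ φʷ) (sym (read-write b w)))

  ε-read : ∀ b → ε K i b ≡ εʷ (read b)
  ε-read b = count-exact (e i) (εʷ ∘ read) (λ _ → e-nothing) step size b
    (≤-trans (εʷ-bound (read b)) (<⇒≤ size-bound))
    where
    step : ∀ b → 0 < εʷ (read b) → ∃[ b′ ] (e i b ≡ just b′ × εʷ (read b) ≡ suc (εʷ (read b′)))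
    step b pos with w , st ← FStep-exists⁻ (read b) pos =
      write b w , e-just st , trans (FStep-ε st) (cong (suc ∘ εʷ) (sym (read-write b w)))

if-< : ∀ {A : Set} {a b} {t f : A} → a < b → (if a <ᵇ b then t else f) ≡ t
if-< a<b rewrite Equivalence.to T-≡ (<⇒<ᵇ a<b) = refl

if-≮ : ∀ {A : Set} {a b} {t f : A} → b ≤ a → (if a <ᵇ b then t else f) ≡ f
if-≮ {a = a} {b} b≤a with a <ᵇ b | <ᵇ⇒< a b
... | true  | a<b = contradiction b≤a (<⇒≱ (a<b _))
... | false | _ = refl

if-≤ : ∀ {A : Set} {a b} {t f : A} → a ≤ b → (if a ≤ᵇ b then t else f) ≡ t
if-≤ a≤b rewrite Equivalence.to T-≡ (≤⇒≤ᵇ a≤b) = refl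

if-≰ : ∀ {A : Set} {a b} {t f : A} → b < a → (if a ≤ᵇ b then t else f) ≡ f
if-≰ {a = a} {b} b<a with a ≤ᵇ b | ≤ᵇ⇒≤ a b
... | true  | a≤b = contradiction b<a (≤⇒≯ (a≤b _))
... | false | _ = refl

module _ {n i : ℕ} (1≤i : 1 ≤ i) (i<n : i < n) where

  private
    2≤n : 2 ≤ n
    2≤n = ≤-trans (s≤s 1≤i) i<n

    3≤2^n : 3 ≤ 2 ^ n
    3≤2^n = ≤-trans (n≤1+n 3) (^-monoʳ-≤ 2 2≤n)

    column : Subset n → Column
    column = get₂ false i

    same : ∀ T {c} → column T ≡ c → put₂ i T c ≡ T
    same T refl = put₂-get₂ false i T

    upper→both : ∀ T → column T ≡ upper → put T (suc i) true ≡ put₂ i T both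
    upper→both T eq = cong (λ X → put X (suc i) true)
      (trans (sym (put-get false T i)) (cong (put T i) (cong proj₁ eq)))

    both→lower : ∀ T → column T ≡ both → put T i false ≡ put₂ i T lower
    both→lower T eq = trans (sym (put-get false (put T i false) (suc i))) (cong (put (put T i false) (suc i))
      (trans (get-put-other false T i (suc i) (1+n≢n ∘ sym)) (cong proj₂ eq)))

    lower→both : ∀ T → column T ≡ lower → put T i true ≡ put₂ i T both
    lower→both T eq = trans (sym (put-get false (put T i true) (suc i))) (cong (put (put T i true) (suc i))
      (trans (get-put-other false T i (suc i) (1+n≢n ∘ sym)) (cong proj₂ eq)))

    both→upper : ∀ T → column T ≡ both → put T (suc i) false ≡ put₂ i T upper
    both→upper T eq = cong (λ X → put X (suc i) false)
      (trans (sym (put-get false T i)) (cong (put T i) (cong proj₁ eq)))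

  subsetActs : ActsOnWords (subsetOps n) i 1
  subsetActs = record
    { read = λ T → column T ∷ []
    ; write = λ T w → put₂ i T (Vec.head w)
    ; read-write = λ { T (c ∷ []) → cong (_∷ []) (get₂-put₂ false i T c 1≤i i<n) }
    ; write-read = λ T → same T refl
    ; f-just = λ {T} st → f-just T refl st
    ; f-nothing = λ {T} → f-nothing T
    ; e-just = λ {T} st → e-just T refl st
    ; e-nothing = λ {T} → e-nothing T
    ; size-bound = 3≤2^n }
    where
    f-just : ∀ T {c w} → column T ≡ c → FStep (c ∷ []) w → f₁ i T ≡ just (put₂ i T (Vec.head w))
    f-just T eq (fill _) rewrite cong proj₁ eq | cong proj₂ eq = cong just (upper→both T eq)
    f-just T eq (clear _) rewrite cong proj₁ eq | cong proj₂ eq = cong just (both→lower T eq)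
    f-nothing : ∀ T → φʷ (column T ∷ []) ≡ 0 → f₁ i T ≡ nothing
    f-nothing T eq with mem T i | mem T (suc i)
    f-nothing T () | true | false
    f-nothing T () | true | true
    ... | false | false = refl
    ... | false | true = refl
    e-just : ∀ T {c w} → column T ≡ c → FStep w (c ∷ []) → e₁ i T ≡ just (put₂ i T (Vec.head w))
    e-just T eq (fill _) rewrite cong proj₁ eq | cong proj₂ eq = cong just (both→upper T eq)
    e-just T eq (clear _) rewrite cong proj₁ eq | cong proj₂ eq = cong just (lower→both T eq)
    e-nothing : ∀ T → εʷ (column T ∷ []) ≡ 0 → e₁ i T ≡ nothing
    e-nothing T eq with mem T i | mem T (suc i)
    e-nothing T () | true | true
    e-nothing T () | false | true
    ... | false | false = refl
    ... | true | false = refl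

  tupleActs : ∀ m → ActsOnWords (tupleOps n m) i m
  tupleActs zero = record
    { read = λ _ → []
    ; write = λ S _ → S
    ; read-write = λ { _ [] → refl }
    ; write-read = λ _ → refl
    ; f-just = λ ()
    ; f-nothing = λ _ → refl
    ; e-just = λ ()
    ; e-nothing = λ _ → refl
    ; size-bound = ≤-refl }
  tupleActs (suc m) = record
    { read = readS
    ; write = writeS
    ; read-write = λ { (T ∷ S) (c ∷ w) → cong₂ _∷_ (get₂-put₂ false i T c 1≤i i<n) (C.read-write S w) }
    ; write-read = λ { (T ∷ S) → cong₂ _∷_ (same T refl) (C.write-read S) }
    ; f-just = λ { {T ∷ S} st → f-just T S refl refl st }
    ; f-nothing = λ { {T ∷ S} → f-nothing T S }
    ; e-just = λ { {T ∷ S} st → e-just T S refl refl st }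
    ; e-nothing = λ { {T ∷ S} → e-nothing T S }
    ; size-bound = begin
        suc (2 * suc m)              ≡⟨ solve 1 (λ a → con 1 :+ con 2 :* (con 1 :+ a) := con 2 :+ (con 1 :+ con 2 :* a)) refl m ⟩
        2 + suc (2 * m)              ≤⟨ +-monoˡ-≤ (suc (2 * m)) (m≤m+n 2 (4 * m)) ⟩
        2 + 4 * m + suc (2 * m)      ≡⟨ solve 1 (λ a → con 2 :+ con 4 :* a :+ (con 1 :+ con 2 :* a) := con 3 :* (con 1 :+ con 2 :* a)) refl m ⟩
        3 * suc (2 * m)              ≤⟨ *-mono-≤ 3≤2^n C.size-bound ⟩
        2 ^ n * CrystalOps.size (tupleOps n m) ∎ }
    where
    open ≤-Reasoning
    module C = ActsOnWords (tupleActs m)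
    readS : Vec (Subset n) (suc m) → Word (suc m)
    readS (T ∷ S) = column T ∷ C.read S
    writeS : Vec (Subset n) (suc m) → Word (suc m) → Vec (Subset n) (suc m)
    writeS (T ∷ S) (c ∷ w) = put₂ i T c ∷ C.write S w

    ε≡ : ∀ T {c} → column T ≡ c → ε (subsetOps n) i T ≡ ε₁ c
    ε≡ T refl = ε-read subsetActs T
    φ≡ : ∀ S {w} → C.read S ≡ w → φ (tupleOps n m) i S ≡ φʷ w
    φ≡ S refl = φ-read (tupleActs m) S

    module K = CrystalOps (tupleOps n (suc m))
    module A = ActsOnWords subsetActs

    f-tail : ∀ T S → ε₁ (column T) < φʷ (C.read S) → K.f i (T ∷ S) ≡ mapM (T ∷_) (CrystalOps.f (tupleOps n m) i S)
    f-tail T S lt = if-< (subst₂ _<_ (sym (ε≡ T refl)) (sym (φ≡ S refl)) lt)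
    f-head : ∀ T S → φʷ (C.read S) ≤ ε₁ (column T) → K.f i (T ∷ S) ≡ mapM (_∷ S) (f₁ i T)
    f-head T S le = if-≮ (subst₂ _≤_ (sym (φ≡ S refl)) (sym (ε≡ T refl)) le)
    e-tail : ∀ T S → ε₁ (column T) ≤ φʷ (C.read S) → K.e i (T ∷ S) ≡ mapM (T ∷_) (CrystalOps.e (tupleOps n m) i S)
    e-tail T S le = if-≤ (subst₂ _≤_ (sym (ε≡ T refl)) (sym (φ≡ S refl)) le)
    e-head : ∀ T S → φʷ (C.read S) < ε₁ (column T) → K.e i (T ∷ S) ≡ mapM (_∷ S) (e₁ i T)
    e-head T S lt = if-≰ (subst₂ _<_ (sym (φ≡ S refl)) (sym (ε≡ T refl)) lt)

    f-change : ∀ T S {c c′} → column T ≡ c → FStep (c ∷ []) (c′ ∷ []) → φʷ (C.read S) ≤ ε₁ c →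
               K.f i (T ∷ S) ≡ just (writeS (T ∷ S) (c′ ∷ C.read S))
    f-change T S refl st le = trans (f-head T S le)
      (trans (cong (mapM (_∷ S)) (A.f-just st)) (cong (λ X → just (_ ∷ X)) (sym (C.write-read S))))
    e-change : ∀ T S {c c′} → column T ≡ c → FStep (c′ ∷ []) (c ∷ []) → φʷ (C.read S) < ε₁ c →
               K.e i (T ∷ S) ≡ just (writeS (T ∷ S) (c′ ∷ C.read S))
    e-change T S refl st lt = trans (e-head T S lt)
      (trans (cong (mapM (_∷ S)) (A.e-just st)) (cong (λ X → just (_ ∷ X)) (sym (C.write-read S))))

    f-just : ∀ T S {c w w′} → column T ≡ c → C.read S ≡ w → FStep (c ∷ w) w′ →
             K.f i (T ∷ S) ≡ just (writeS (T ∷ S) w′)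
    f-just T S eq refl (fill le) = f-change T S eq (fill z≤n) le
    f-just T S eq refl (clear le) = f-change T S eq (clear z≤n) le
    f-just T S refl refl (skip _ lt st) = trans (f-tail T S lt)
      (trans (cong (mapM (T ∷_)) (C.f-just st)) (cong (λ X → just (X ∷ _)) (sym (same T refl))))

    f-nothing : ∀ T S → φʷ (readS (T ∷ S)) ≡ 0 → K.f i (T ∷ S) ≡ nothing
    f-nothing T S eq = trans (f-head T S (m∸n≡0⇒m≤n (m+n≡0⇒n≡0 (φ₁ (column T)) eq)))
      (cong (mapM (_∷ S)) (A.f-nothing (trans (cong (φ₁ (column T) +_) (0∸n≡0 (ε₁ (column T))))
        (trans (+-identityʳ _) (m+n≡0⇒m≡0 (φ₁ (column T)) eq)))))

    e-just : ∀ T S {c w w′} → column T ≡ c → C.read S ≡ w → FStep w′ (c ∷ w) →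
             K.e i (T ∷ S) ≡ just (writeS (T ∷ S) w′)
    e-just T S eq refl (fill le) = e-change T S eq (fill z≤n) (s≤s le)
    e-just T S eq refl (clear le) = e-change T S eq (clear z≤n) (s≤s le)
    e-just T S refl refl (skip _ lt st) = trans (e-tail T S (s≤s⁻¹ (subst (ε₁ (column T) <_) (FStep-φ st) lt)))
      (trans (cong (mapM (T ∷_)) (C.e-just st)) (cong (λ X → just (X ∷ _)) (sym (same T refl))))

    e-nothing : ∀ T S → εʷ (readS (T ∷ S)) ≡ 0 → K.e i (T ∷ S) ≡ nothing
    e-nothing T S eq = trans (e-tail T S (m∸n≡0⇒m≤n (m+n≡0⇒n≡0 (εʷ (C.read S)) eq)))
      (cong (mapM (T ∷_)) (C.e-nothing (m+n≡0⇒m≡0 (εʷ (C.read S)) eq)))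

-- From tuples of subsets to arrays of tiles

toTile-isBump : ∀ t → toTile (isBump t) ≡ t
toTile-isBump bump = refl
toTile-isBump cross = refl

isBump-toTile : ∀ b → isBump (toTile b) ≡ b
isBump-toTile true = refl
isBump-toTile false = refl

map-map-id : ∀ {A B : Set} {m n} {f : A → B} {g : B → A} → (∀ a → g (f a) ≡ a) →
             ∀ (D : Vec (Vec A m) n) → Vec.map (Vec.map g) (Vec.map (Vec.map f) D) ≡ D
map-map-id {f = f} {g} gf D = trans (sym (Vec.map-∘ (Vec.map g) (Vec.map f) D))
  (trans (Vec.map-cong (λ r → trans (sym (Vec.map-∘ g f r)) (trans (Vec.map-cong gf r) (Vec.map-id r))) D) (Vec.map-id D))

toTuple-fromTuple : ∀ {m n} (S : Vec (Subset n) m) → toTuple {m} {n} (fromTuple S) ≡ S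
toTuple-fromTuple S = trans (cong (Vec.map (Vec.map isBump)) (transpose-involutive (Vec.map (Vec.map toTile) S)))
  (map-map-id isBump-toTile S)

-- The default outside the array is a row of crossings, matching the default `false` of `mem`.
row : ∀ {m n} → RPD m n → ℕ → Vec Tile m
row D i = get (Vec.replicate _ cross) D i

wordR : ∀ {m n} → ℕ → RPD m n → Word m
wordR i D = Vec.map (get₂ false i) (toTuple D)

setRows : ∀ {m n} → ℕ → RPD m n → Word m → RPD m n
setRows i D w = put₂ i D (upperTiles w , lowerTiles w)

row-wordR : ∀ {m n} (D : RPD m n) (h : Column → Bool) i i₀ → (∀ T → h (get₂ false i T) ≡ get false T i₀) →
            Vec.map (toTile ∘ h) (wordR i D) ≡ row D i₀
row-wordR {m} {n} D h i i₀ eq = begin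
  Vec.map (toTile ∘ h) (Vec.map (get₂ false i) (Vec.map (Vec.map isBump) (Vec.transpose D)))
    ≡⟨ Vec.map-∘ (toTile ∘ h) (get₂ false i) _ ⟨
  Vec.map (toTile ∘ h ∘ get₂ false i) (Vec.map (Vec.map isBump) (Vec.transpose D))
    ≡⟨ Vec.map-∘ (toTile ∘ h ∘ get₂ false i) (Vec.map isBump) (Vec.transpose D) ⟨
  Vec.map (toTile ∘ h ∘ get₂ false i ∘ Vec.map isBump) (Vec.transpose D)
    ≡⟨ Vec.map-cong (λ c → trans (cong toTile (trans (eq (Vec.map isBump c)) (get-map isBump cross c i₀)))
                                 (toTile-isBump (get cross c i₀))) (Vec.transpose D) ⟩
  Vec.map (λ c → get cross c i₀) (Vec.transpose D)
    ≡⟨ row-transpose cross D i₀ ⟩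
  row D i₀ ∎
  where open ≡-Reasoning

upperTiles-wordR : ∀ {m n} i (D : RPD m n) → upperTiles (wordR i D) ≡ row D i
upperTiles-wordR i D = row-wordR D proj₁ i i (λ _ → refl)

lowerTiles-wordR : ∀ {m n} i (D : RPD m n) → lowerTiles (wordR i D) ≡ row D (suc i)
lowerTiles-wordR i D = row-wordR D proj₂ i (suc i) (λ _ → refl)

setRows-wordR : ∀ {m n} i (D : RPD m n) → setRows i D (wordR i D) ≡ D
setRows-wordR i D = trans (cong₂ (λ r r′ → put₂ i D (r , r′)) (upperTiles-wordR i D) (lowerTiles-wordR i D))
  (put₂-get₂ _ i D)

setRows-setRows : ∀ {m n} i (D : RPD m n) w w′ → setRows i (setRows i D w) w′ ≡ setRows i D w′
setRows-setRows i D w w′ = put₂-put₂ i D _ _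

zipWith-put₂ : ∀ {A : Set} {m n} i (D : Vec (Vec A m) n) (w : Vec (A × A) m) →
  Vec.zipWith (put₂ i) (Vec.transpose D) w ≡ Vec.transpose (put₂ i D (Vec.map proj₁ w , Vec.map proj₂ w))
zipWith-put₂ i D w = trans (split (Vec.transpose D) w)
  (trans (cong (λ X → Vec.zipWith (λ c a → put c (suc i) a) X (Vec.map proj₂ w)) (put-transpose D i (Vec.map proj₁ w)))
         (put-transpose (put D i (Vec.map proj₁ w)) (suc i) (Vec.map proj₂ w)))
  where
  split : ∀ {A : Set} {m n} (X : Vec (Vec A n) m) (w : Vec (A × A) m) → Vec.zipWith (put₂ i) X w ≡
          Vec.zipWith (λ c a → put c (suc i) a) (Vec.zipWith (λ c a → put c i a) X (Vec.map proj₁ w)) (Vec.map proj₂ w)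
  split [] [] = refl
  split (z ∷ X) (a ∷ w) = cong (_ ∷_) (split X w)

-- Writing a word across the columns of the tuple is writing its two components as rows of the
-- array; the two transpositions cancel.
fromTuple-write : ∀ {m n} i (D : RPD m n) w → fromTuple (Vec.zipWith (put₂ i) (toTuple D) w) ≡ setRows i D w
fromTuple-write i D w = begin
  Vec.transpose (Vec.map (Vec.map toTile) (Vec.zipWith (put₂ i) (toTuple D) w))
    ≡⟨ cong (λ X → Vec.transpose (Vec.map (Vec.map toTile) (Vec.zipWith (put₂ i) X w))) (sym (transpose-map isBump D)) ⟩
  Vec.transpose (Vec.map (Vec.map toTile) (Vec.zipWith (put₂ i) (Vec.transpose B) w))
    ≡⟨ cong (Vec.transpose ∘ Vec.map (Vec.map toTile)) (zipWith-put₂ i B w) ⟩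
  Vec.transpose (Vec.map (Vec.map toTile) (Vec.transpose (put₂ i B (Vec.map proj₁ w , Vec.map proj₂ w))))
    ≡⟨ cong Vec.transpose (sym (transpose-map toTile (put₂ i B (Vec.map proj₁ w , Vec.map proj₂ w)))) ⟩
  Vec.transpose (Vec.transpose (Vec.map (Vec.map toTile) (put₂ i B (Vec.map proj₁ w , Vec.map proj₂ w))))
    ≡⟨ transpose-involutive _ ⟩
  Vec.map (Vec.map toTile) (put₂ i B (Vec.map proj₁ w , Vec.map proj₂ w))
    ≡⟨ trans (map-put (Vec.map toTile) (put B i (Vec.map proj₁ w)) (suc i))
             (cong (λ X → put X (suc i) (Vec.map toTile (Vec.map proj₂ w))) (map-put (Vec.map toTile) B i)) ⟩
  put₂ i (Vec.map (Vec.map toTile) B) (Vec.map toTile (Vec.map proj₁ w) , Vec.map toTile (Vec.map proj₂ w))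
    ≡⟨ cong₂ (put₂ i) (map-map-id toTile-isBump D) (cong₂ _,_ (sym (Vec.map-∘ toTile proj₁ w)) (sym (Vec.map-∘ toTile proj₂ w))) ⟩
  setRows i D w ∎
  where
  open ≡-Reasoning
  B = Vec.map (Vec.map isBump) D

module _ {n i : ℕ} (1≤i : 1 ≤ i) (i<n : i < n) where

  read-tupleActs : ∀ m S → ActsOnWords.read (tupleActs 1≤i i<n m) S ≡ Vec.map (get₂ false i) S
  read-tupleActs zero [] = refl
  read-tupleActs (suc m) (T ∷ S) = cong (_ ∷_) (read-tupleActs m S)

  write-tupleActs : ∀ m S w → ActsOnWords.write (tupleActs 1≤i i<n m) S w ≡ Vec.zipWith (put₂ i) S w
  write-tupleActs zero [] [] = refl
  write-tupleActs (suc m) (T ∷ S) (c ∷ w) = cong (_ ∷_) (write-tupleActs m S w)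

  module _ {m : ℕ} where

    private
      module A = ActsOnWords (tupleActs {n} 1≤i i<n m)

      wordR≡ : ∀ D → wordR i D ≡ A.read (toTuple D)
      wordR≡ D = sym (read-tupleActs m (toTuple D))

      setRows≡ : ∀ D w → fromTuple (A.write (toTuple D) w) ≡ setRows i D w
      setRows≡ D w = trans (cong fromTuple (write-tupleActs m (toTuple D) w)) (fromTuple-write i D w)

    wordR-setRows : ∀ (D : RPD m n) w → wordR i (setRows i D w) ≡ w
    wordR-setRows D w = begin
      wordR i (setRows i D w)                        ≡⟨ cong (wordR i) (setRows≡ D w) ⟨
      wordR i (fromTuple (A.write (toTuple D) w))    ≡⟨ cong (Vec.map (get₂ false i)) (toTuple-fromTuple _) ⟩
      Vec.map (get₂ false i) (A.write (toTuple D) w) ≡⟨ read-tupleActs m _ ⟨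
      A.read (A.write (toTuple D) w)                 ≡⟨ A.read-write _ w ⟩
      w                                              ∎
      where open ≡-Reasoning

    fR-just : ∀ (D : RPD m n) {w} → FStep (wordR i D) w → fR i D ≡ just (setRows i D w)
    fR-just D st = trans (cong (mapM fromTuple) (A.f-just (subst (λ v → FStep v _) (wordR≡ D) st)))
      (cong just (setRows≡ D _))

    eR-just : ∀ (D : RPD m n) {w} → FStep w (wordR i D) → eR i D ≡ just (setRows i D w)
    eR-just D st = trans (cong (mapM fromTuple) (A.e-just (subst (FStep _) (wordR≡ D) st)))
      (cong just (setRows≡ D _))

    eR-nothing : ∀ (D : RPD m n) → εʷ (wordR i D) ≡ 0 → eR i D ≡ nothing
    eR-nothing D eq = cong (mapM fromTuple) (A.e-nothing (trans (cong εʷ (sym (wordR≡ D))) eq))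

-- D′ = f_i(D), equivalently D = e_i(D′).
record RStep {m n} (i : ℕ) (D D′ : RPD m n) : Set where
  constructor rstep
  field
    step     : FStep (wordR i D) (wordR i D′)
    new-rows : D′ ≡ setRows i D (wordR i D′)

module _ {m n i : ℕ} (1≤i : 1 ≤ i) (i<n : i < n) where

  setRows-RStep : ∀ (D : RPD m n) {w} → FStep (wordR i D) w → RStep i D (setRows i D w)
  setRows-RStep D {w} st = rstep (subst (FStep _) (sym eq) st) (cong (setRows i D) (sym eq))
    where eq = wordR-setRows 1≤i i<n D w

  setRows-RStep⁻ : ∀ (D : RPD m n) {w} → FStep w (wordR i D) → RStep i (setRows i D w) D
  setRows-RStep⁻ D {w} st = rstep (subst (λ v → FStep v _) (sym eq) st)
    (sym (trans (setRows-setRows i D w _) (setRows-wordR i D)))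
    where eq = wordR-setRows 1≤i i<n D w

  RStep⇒fR : ∀ {D D′ : RPD m n} → RStep i D D′ → fR i D ≡ just D′
  RStep⇒fR {D} (rstep st eq) = trans (fR-just 1≤i i<n D st) (cong just (sym eq))

  RStep⇒eR : ∀ {D D′ : RPD m n} → RStep i D D′ → eR i D′ ≡ just D
  RStep⇒eR {D} {D′} (rstep st eq) = trans (eR-just 1≤i i<n D′ st) (cong just (begin
    setRows i D′ (wordR i D)                           ≡⟨ cong (λ E → setRows i E (wordR i D)) eq ⟩
    setRows i (setRows i D (wordR i D′)) (wordR i D)   ≡⟨ setRows-setRows i D _ _ ⟩
    setRows i D (wordR i D)                            ≡⟨ setRows-wordR i D ⟩
    D                                                  ∎))
    where open ≡-Reasoning

  RStep-exists : ∀ (D : RPD m n) → 0 < φʷ (wordR i D) → ∃[ D′ ] RStep i D D′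
  RStep-exists D pos with w , st ← FStep-exists (wordR i D) pos = setRows i D w , setRows-RStep D st

  RStep-exists⁻ : ∀ (D′ : RPD m n) → 0 < εʷ (wordR i D′) → ∃[ D ] RStep i D D′
  RStep-exists⁻ D′ pos with w , st ← FStep-exists⁻ (wordR i D′) pos = setRows i D′ w , setRows-RStep⁻ D′ st

  eR⇒RStep : ∀ {D D′ : RPD m n} → eR i D′ ≡ just D → RStep i D D′
  eR⇒RStep {D} {D′} eq with εʷ (wordR i D′) ≟ 0
  ... | yes ε≡0 = contradiction (trans (sym (eR-nothing 1≤i i<n D′ ε≡0)) eq) λ ()
  ... | no ε≢0 with E , st ← RStep-exists⁻ D′ (n≢0⇒n>0 ε≢0)
      with refl ← trans (sym (RStep⇒eR st)) eq = st

  RStep-injective : ∀ {D₁ D₂ D : RPD m n} → RStep i D₁ D → RStep i D₂ D → D₁ ≡ D₂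
  RStep-injective st₁ st₂ with refl ← trans (sym (RStep⇒eR st₁)) (RStep⇒eR st₂) = refl

  RStep-functional : ∀ {D D₁ D₂ : RPD m n} → RStep i D D₁ → RStep i D D₂ → D₁ ≡ D₂
  RStep-functional st₁ st₂ with refl ← trans (sym (RStep⇒fR st₁)) (RStep⇒fR st₂) = refl

-- The permutation of an array

collapsedTrace : ∀ {m k} → Vec (Vec Tile m) k → Vec ℕ m → Vec ℕ m × Vec ℕ k
collapsedTrace [] bot = bot , []
collapsedTrace (r ∷ rs) bot =
  let below = collapsedTrace rs bot
      here = processRow 0 (proj₁ below) r
  in proj₁ here , (proj₂ here ∷ proj₂ below)

-- Since u ranges over all of S_n, only the collapsed labels l ∸ n matter: the labels
-- 1,…,n all become 0, and the tiles commute with this monotone map.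
module _ (n : ℕ) where

  tileAct-collapse : ∀ t a b →
    tileAct t (a ∸ n) (b ∸ n) ≡ (proj₁ (tileAct t a b) ∸ n , proj₂ (tileAct t a b) ∸ n)
  tileAct-collapse bump a b = refl
  tileAct-collapse cross a b = cong₂ _,_ (sym (∸-distribʳ-⊔ n a b)) (sym (∸-distribʳ-⊓ n a b))

  collapse : ∀ {m} → Vec ℕ m → Vec ℕ m
  collapse = Vec.map (_∸ n)

  processRow-collapse : ∀ {m} a (bs : Vec ℕ m) ts → let r = processRow a bs ts in
    processRow (a ∸ n) (collapse bs) ts ≡ (collapse (proj₁ r) , proj₂ r ∸ n)
  processRow-collapse a [] [] = refl
  processRow-collapse a (b ∷ bs) (t ∷ ts)
    rewrite tileAct-collapse t a b | processRow-collapse (proj₂ (tileAct t a b)) bs ts = refl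

  traceRows-collapse : ∀ {m k} l (rs : Vec (Vec Tile m) k) bot → l + k ≤ suc n →
    let t = traceRows (labelRows l rs) bot ; t′ = collapsedTrace rs (collapse bot) in
    collapse (proj₁ t) ≡ proj₁ t′ × List.map (_∸ n) (proj₂ t) ≡ Vec.toList (proj₂ t′)
  traceRows-collapse l [] bot _ = refl , refl
  traceRows-collapse {k = suc k} l (r ∷ rs) bot le
    with tops , rights ← traceRows-collapse (suc l) rs bot (subst (_≤ suc n) (+-suc l k) le)
    rewrite sym tops
    with eq ← processRow-collapse l (proj₁ (traceRows (labelRows (suc l) rs) bot)) r
    -- The range bound gives `l ≤ n`, so the left label of this row collapses to the 0 fed in by
    -- `collapsedTrace`.
    rewrite m≤n⇒m∸n≡0 (s≤s⁻¹ (≤-trans (m<m+n l z<s) le)) | eq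
    = refl , cong₂ _∷_ refl rights

getL0-map : ∀ (h : ℕ → ℕ) (l : List ℕ) {d d′} j → j < length l → getL0 d′ (List.map h l) j ≡ h (getL0 d l j)
getL0-map h (y ∷ l) zero _ = refl
getL0-map h (y ∷ l) (suc j) (s≤s lt) = getL0-map h l j lt

getL0-toList-++ˡ : ∀ {m} (xs : Vec ℕ m) l {d d′} j → j < m → getL0 d (Vec.toList xs ++ l) j ≡ get0 d′ xs j
getL0-toList-++ˡ (y ∷ xs) l zero _ = refl
getL0-toList-++ˡ (y ∷ xs) l (suc j) (s≤s lt) = getL0-toList-++ˡ xs l j lt

getL0-toList-++ʳ : ∀ {m} (xs : Vec ℕ m) l {d} j → getL0 d (Vec.toList xs ++ l) (m + j) ≡ getL0 d l j
getL0-toList-++ʳ [] l j = refl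
getL0-toList-++ʳ (y ∷ xs) l j = getL0-toList-++ʳ xs l j

getL0-toList : ∀ {k} (xs : Vec ℕ k) {d d′} j → j < k → getL0 d (Vec.toList xs) j ≡ get0 d′ xs j
getL0-toList (y ∷ xs) zero _ = refl
getL0-toList (y ∷ xs) (suc j) (s≤s lt) = getL0-toList xs j lt

get0-map : ∀ (h : ℕ → ℕ) {k} (xs : Vec ℕ k) {d d′} j → j < k → get0 d′ (Vec.map h xs) j ≡ h (get0 d xs j)
get0-map h (y ∷ xs) zero _ = refl
get0-map h (y ∷ xs) (suc j) (s≤s lt) = get0-map h xs j lt

bottomLabels : ∀ m → ℕ → Vec ℕ m
bottomLabels m n = Vec.tabulate (λ (j : Fin m) → n + suc (toℕ j))

collapsed : ∀ {m n} → RPD m n → Vec ℕ m × Vec ℕ n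
collapsed {m} {n} D = collapsedTrace D (collapse n (bottomLabels m n))

length-traceRows : ∀ {m k} l (rs : Vec (Vec Tile m) k) bot → length (proj₂ (traceRows (labelRows l rs) bot)) ≡ k
length-traceRows l [] bot = refl
length-traceRows l (r ∷ rs) bot = cong suc (length-traceRows (suc l) rs bot)

module _ {m n : ℕ} (D : RPD m n) where

  private
    trace = traceRows (labelRows 1 D) (bottomLabels m n)
    collapse-trace = traceRows-collapse n 1 D (bottomLabels m n) ≤-refl

  σ-top : ∀ {p} → InRange m p → σ D p ∸ n ≡ get 0 (proj₁ (collapsed D)) p
  σ-top {suc j} (_ , j<m) = begin
    getL0 (suc j) (oneLine D) j ∸ n             ≡⟨ cong (_∸ n) (getL0-toList-++ˡ (proj₁ trace) (proj₂ trace) {d′ = 0} j j<m) ⟩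
    get0 0 (proj₁ trace) j ∸ n                  ≡⟨ get0-map (_∸ n) (proj₁ trace) j j<m ⟨
    get0 0 (collapse n (proj₁ trace)) j         ≡⟨ cong (λ v → get0 0 v j) (proj₁ collapse-trace) ⟩
    get0 0 (proj₁ (collapsed D)) j              ∎
    where open ≡-Reasoning

  σ-right : ∀ {r} → InRange n r → σ D (m + r) ∸ n ≡ get 0 (proj₂ (collapsed D)) r
  σ-right {suc j} (_ , j<n) rewrite +-suc m j = begin
    getL0 (suc (m + j)) (oneLine D) (m + j) ∸ n  ≡⟨ cong (_∸ n) (getL0-toList-++ʳ (proj₁ trace) (proj₂ trace) j) ⟩
    getL0 (suc (m + j)) (proj₂ trace) j ∸ n      ≡⟨ getL0-map (_∸ n) (proj₂ trace) j (subst (j <_) (sym (length-traceRows 1 D _)) j<n) ⟨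
    getL0 0 (List.map (_∸ n) (proj₂ trace)) j    ≡⟨ cong (λ l → getL0 0 l j) (proj₂ collapse-trace) ⟩
    getL0 0 (Vec.toList (proj₂ (collapsed D))) j ≡⟨ getL0-toList (proj₂ (collapsed D)) j j<n ⟩
    get0 0 (proj₂ (collapsed D)) j               ∎
    where open ≡-Reasoning

tileAct-↭ : ∀ t a b → proj₁ (tileAct t a b) ∷ proj₂ (tileAct t a b) ∷ [] ↭ b ∷ a ∷ []
tileAct-↭ bump a b = ↭-swap a b ↭-refl
tileAct-↭ cross a b with ≤-total a b
... | inj₁ a≤b rewrite m≤n⇒m⊔n≡n a≤b | m≤n⇒m⊓n≡m a≤b = ↭-refl
... | inj₂ b≤a rewrite m≥n⇒m⊔n≡m b≤a | m≥n⇒m⊓n≡n b≤a = ↭-swap a b ↭-refl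

processRow-↭ : ∀ {m} a (bs : Vec ℕ m) ts → let r = processRow a bs ts in
  Vec.toList (proj₁ r) ++ proj₂ r ∷ [] ↭ a ∷ Vec.toList bs
processRow-↭ a [] [] = ↭-refl
processRow-↭ a (b ∷ bs) (t ∷ ts) =
  ↭-trans (↭-prep _ (processRow-↭ (proj₂ (tileAct t a b)) bs ts))
  (↭-trans (Perm.++⁺ʳ (Vec.toList bs) (tileAct-↭ t a b)) (↭-swap b a ↭-refl))

labelsFrom : ℕ → ℕ → List ℕ
labelsFrom l zero = []
labelsFrom l (suc k) = l ∷ labelsFrom (suc l) k

-- Every tile permutes its two labels, so no label is lost or duplicated; for the full array this
-- makes the one-line word a rearrangement of 1,...,m+n.
traceRows-↭ : ∀ {m k} l (rs : Vec (Vec Tile m) k) bot → let t = traceRows (labelRows l rs) bot in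
  Vec.toList (proj₁ t) ++ proj₂ t ↭ labelsFrom l k ++ Vec.toList bot
traceRows-↭ l [] bot rewrite List.++-identityʳ (Vec.toList bot) = ↭-refl
traceRows-↭ {k = suc k} l (r ∷ rs) bot = ↭-trans
  (subst (_↭ l ∷ Vec.toList (proj₁ below) ++ proj₂ below)
    (List.++-assoc (Vec.toList (proj₁ this)) (proj₂ this ∷ []) (proj₂ below))
    (Perm.++⁺ʳ (proj₂ below) (processRow-↭ l (proj₁ below) r)))
  (↭-prep l (traceRows-↭ (suc l) rs bot))
  where
  below = traceRows (labelRows (suc l) rs) bot
  this = processRow l (proj₁ below) r

∈-labelsFrom : ∀ l k {z} → z ∈ labelsFrom l k → l ≤ z × z < l + k
∈-labelsFrom l (suc k) (here refl) = ≤-refl , m<m+n l z<s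
∈-labelsFrom l (suc k) {z} (there z∈) with l<z , z< ← ∈-labelsFrom (suc l) k z∈ =
  <⇒≤ l<z , subst (z <_) (sym (+-suc l k)) z<

labelsFrom-unique : ∀ l k → Unique (labelsFrom l k)
labelsFrom-unique l zero = []
labelsFrom-unique l (suc k) = All.tabulate (λ z∈ → <⇒≢ (proj₁ (∈-labelsFrom (suc l) k z∈))) ∷ labelsFrom-unique (suc l) k

toList-tabulate : ∀ {A : Set} {m} (h : Fin m → A) → Vec.toList (Vec.tabulate h) ≡ List.tabulate h
toList-tabulate {m = zero} h = refl
toList-tabulate {m = suc m} h = cong (h Fin.zero ∷_) (toList-tabulate (h ∘ Fin.suc))

getL0-∈ : ∀ {d} l j → j < length l → getL0 d l j ∈ l
getL0-∈ (y ∷ l) zero _ = here refl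
getL0-∈ (y ∷ l) (suc j) (s≤s lt) = there (getL0-∈ l j lt)

getL0-injective : ∀ {d d′ l} j k → Unique l → j < length l → k < length l → getL0 d l j ≡ getL0 d′ l k → j ≡ k
getL0-injective zero zero _ _ _ _ = refl
getL0-injective {l = y ∷ l} zero (suc k) (y∉ ∷ _) _ (s≤s k<) eq = contradiction eq (All.lookup y∉ (getL0-∈ l k k<))
getL0-injective {l = y ∷ l} (suc j) zero (y∉ ∷ _) (s≤s j<) _ eq = contradiction (sym eq) (All.lookup y∉ (getL0-∈ l j j<))
getL0-injective {l = y ∷ l} (suc j) (suc k) (_ ∷ u) (s≤s j<) (s≤s k<) eq = cong suc (getL0-injective j k u j< k< eq)

module _ {m n : ℕ} (D : RPD m n) where

  private
    labels = labelsFrom 1 n ++ List.tabulate (λ (j : Fin m) → n + suc (toℕ j))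

    oneLine-↭ : oneLine D ↭ labels
    oneLine-↭ = subst (λ l → oneLine D ↭ labelsFrom 1 n ++ l) (toList-tabulate _) (traceRows-↭ 1 D (bottomLabels m n))

    labels-unique : Unique labels
    labels-unique = Unique.++⁺ (labelsFrom-unique 1 n)
      (Unique.tabulate⁺ (λ eq → toℕ-injective (suc-injective (+-cancelˡ-≡ n _ _ eq))))
      λ { (z∈ , z∈′) → disjoint z∈ z∈′ }
      where
      disjoint : ∀ {z} → z ∈ labelsFrom 1 n → ¬ z ∈ List.tabulate (λ (j : Fin m) → n + suc (toℕ j))
      disjoint z∈ z∈′ with j , refl ← ∈-tabulate⁻ z∈′ =
        contradiction (s≤s⁻¹ (proj₂ (∈-labelsFrom 1 n z∈))) (<⇒≱ (m<m+n n z<s))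

    labels-inRange : ∀ {z} → z ∈ labels → InRange (m + n) z
    labels-inRange z∈ with ∈-++⁻ (labelsFrom 1 n) z∈
    ... | inj₁ z∈ˡ with 1≤z , z<1+n ← ∈-labelsFrom 1 n z∈ˡ = 1≤z , ≤-trans (s≤s⁻¹ z<1+n) (m≤n+m n m)
    ... | inj₂ z∈ʳ with j , refl ← ∈-tabulate⁻ z∈ʳ =
      ≤-trans (s≤s z≤n) (m≤n+m _ n) , subst (_≤ m + n) (+-comm (suc (toℕ j)) n) (+-monoˡ-≤ n (toℕ<n j))

    length-oneLine : length (oneLine D) ≡ m + n
    length-oneLine = trans (List.length-++ (Vec.toList (proj₁ trace)))
      (cong₂ _+_ (Vec.length-toList (proj₁ trace)) (length-traceRows 1 D _))
      where trace = traceRows (labelRows 1 D) (bottomLabels m n)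

    oneLine-unique : Unique (oneLine D)
    oneLine-unique = Permₛ.Unique-resp-↭ (setoid ℕ) (↭⇒↭ₛ (↭-sym oneLine-↭)) labels-unique

  σ-inRange : ∀ {p} → InRange (m + n) p → InRange (m + n) (σ D p)
  σ-inRange {suc j} (_ , j<) =
    labels-inRange (Perm.∈-resp-↭ oneLine-↭ (getL0-∈ (oneLine D) j (subst (j <_) (sym length-oneLine) j<)))

  σ-injective : ∀ {p q} → InRange (m + n) p → InRange (m + n) q → σ D p ≡ σ D q → p ≡ q
  σ-injective {suc j} {suc k} (_ , j<) (_ , k<) eq = cong suc (getL0-injective j k oneLine-unique
    (subst (j <_) (sym length-oneLine) j<) (subst (k <_) (sym length-oneLine) k<) eq)

  -- `σ` is a mere function on ℕ; in this form it can be inverted, which the construction of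
  -- relabellings uses.
  σᴾ : Perm (m + n)
  σᴾ = fromInjection (σ D) σ-inRange σ-injective

  app-σᴾ : ∀ {p} → InRange (m + n) p → app σᴾ p ≡ σ D p
  app-σᴾ = app-fromInjection (σ D) σ-inRange σ-injective

-- Relabelling and the Bruhat condition

app-idₚ : ∀ {n} p → app (idₚ {n}) p ≡ p
app-idₚ {n} p with position n p
... | inside j = app-toℕ idₚ j
... | outside o = app-outside idₚ o

app-flip-· : ∀ {n} (u v : Perm n) p → app (flip (u · v)) p ≡ app (flip v) (app (flip u) p)
app-flip-· u v p = app-injective (u · v) (trans (app-flipʳ (u · v) p) (sym (begin
  app (u · v) (app (flip v) (app (flip u) p))    ≡⟨ app-· u v (app (flip v) (app (flip u) p)) ⟩
  app u (app v (app (flip v) (app (flip u) p)))  ≡⟨ cong (app u) (app-flipʳ v (app (flip u) p)) ⟩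
  app u (app (flip u) p)                         ≡⟨ app-flipʳ u p ⟩
  p                                              ∎)))
  where open ≡-Reasoning

-- Left multiplication by S_n becomes invisible after collapsing.
app-∸ : ∀ {n} (u : Perm n) l → app u l ∸ n ≡ l ∸ n
app-∸ {n} u l with position n l
... | inside j = trans (m≤n⇒m∸n≡0 (proj₂ (app-inRange u (toℕ-inRange j)))) (sym (m≤n⇒m∸n≡0 (toℕ<n j)))
... | outside o = cong (_∸ n) (app-outside u o)

data Side (m n : ℕ) : ℕ → Set where
  top   : ∀ {p} → InRange m p → Side m n p
  right : ∀ {r} → InRange n r → Side m n (m + r)

side : ∀ m {n p} → InRange (m + n) p → Side m n p
side m {n} {p} (1≤p , p≤) with p ≤? m
... | yes p≤m = top (1≤p , p≤m)
... | no p≰m = subst (Side m n) (m+[n∸m]≡n (<⇒≤ m<p)) (right (m<n⇒0<n∸m m<p , m≤n+o⇒m∸n≤o p m p≤))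
  where m<p = ≰⇒> p≰m

right-inRange : ∀ m {n r} → InRange n r → InRange (m + n) (m + r)
right-inRange m (1≤r , r≤n) = ≤-trans 1≤r (m≤n+m _ m) , +-monoʳ-≤ m r≤n

module _ {m n : ℕ} where

  1×-top : ∀ (v : Perm n) {p} → InRange m p → (1^ m × v) p ≡ p
  1×-top v {p} (_ , p≤m) with p ≤ᵇ m | ≤⇒≤ᵇ p≤m
  ... | true | _ = refl

  1×-right : ∀ (v : Perm n) {r} → InRange n r → (1^ m × v) (m + r) ≡ m + app v r
  1×-right v {r} (1≤r , _) with m + r ≤ᵇ m | ≤ᵇ⇒≤ (m + r) m
  ... | true | le = contradiction (le _) (<⇒≱ (m<m+n m 1≤r))
  ... | false | _ = cong (λ k → m + app v k) (m+n∸m≡n m r)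

  1×-inRange : ∀ (v : Perm n) {p} → InRange (m + n) p → InRange (m + n) ((1^ m × v) p)
  1×-inRange v {p} rp with side m rp
  ... | top r = subst (InRange (m + n)) (sym (1×-top v r)) rp
  ... | right r = subst (InRange (m + n)) (sym (1×-right v r)) (right-inRange m (app-inRange v r))

  1×-∘ : ∀ (u v w : Perm n) → (∀ p → app w p ≡ app u (app v p)) → ∀ {p} → InRange (m + n) p →
         (1^ m × u) ((1^ m × v) p) ≡ (1^ m × w) p
  1×-∘ u v w eq rp with side m rp
  ... | top r = trans (cong (1^ m × u) (1×-top v r)) (trans (1×-top u r) (sym (1×-top w r)))
  ... | right {r} rr = begin
    (1^ m × u) ((1^ m × v) (m + r))   ≡⟨ cong (1^ m × u) (1×-right v rr) ⟩
    (1^ m × u) (m + app v r)          ≡⟨ 1×-right u (app-inRange v rr) ⟩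
    m + app u (app v r)               ≡⟨ cong (m +_) (eq r) ⟨
    m + app w r                       ≡⟨ 1×-right w rr ⟨
    (1^ m × w) (m + r)                ∎
    where open ≡-Reasoning

  1×-idₚ : ∀ {p} → InRange (m + n) p → (1^ m × idₚ {n}) p ≡ p
  1×-idₚ rp with side m rp
  ... | top r = 1×-top idₚ r
  ... | right r = trans (1×-right idₚ r) (cong (m +_) (app-idₚ _))

  1×-inverse : ∀ (u v : Perm n) → (∀ p → app u (app v p) ≡ p) → ∀ {p} → InRange (m + n) p →
               (1^ m × u) ((1^ m × v) p) ≡ p
  1×-inverse u v eq rp = trans (1×-∘ u v idₚ (λ p → trans (app-idₚ p) (sym (eq p))) rp) (1×-idₚ rp)

-- σ_D′ agrees with σ_D (1^m × s) up to relabelling the pipes 1,…,n.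
Twist : ∀ {m n} → Perm n → RPD m n → RPD m n → Set
Twist {m} {n} s D D′ = ∀ {p} → InRange (m + n) p → σ D′ p ∸ n ≡ σ D ((1^ m × s) p) ∸ n

module _ {m n : ℕ} {s : Perm n} {D D′ : RPD m n} (twist : Twist s D D′) where

  private
    J J⁻¹ : ℕ → ℕ
    J = 1^ m × s
    J⁻¹ = 1^ m × flip s

    J-in = 1×-inRange {m} s
    J⁻¹-in = 1×-inRange {m} (flip s)

    σ⁻¹ : ℕ → ℕ
    σ⁻¹ = app (flip (σᴾ D))

    σ⁻¹-in : ∀ {l} → InRange (m + n) l → InRange (m + n) (σ⁻¹ l)
    σ⁻¹-in = app-inRange (flip (σᴾ D))

    σ-σ⁻¹ : ∀ {l} → InRange (m + n) l → σ D (σ⁻¹ l) ≡ l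
    σ-σ⁻¹ {l} rl = trans (sym (app-σᴾ D (σ⁻¹-in rl))) (app-flipʳ (σᴾ D) l)

    σ⁻¹-σ : ∀ {p} → InRange (m + n) p → σ⁻¹ (σ D p) ≡ p
    σ⁻¹-σ {p} rp = trans (cong σ⁻¹ (sym (app-σᴾ D rp))) (app-flipˡ (σᴾ D) p)

    π : ℕ → ℕ
    π l = σ D′ (J⁻¹ (σ⁻¹ l))

    π-∸ : ∀ {l} → InRange (m + n) l → π l ∸ n ≡ l ∸ n
    π-∸ {l} rl = begin
      σ D′ (J⁻¹ (σ⁻¹ l)) ∸ n      ≡⟨ twist (J⁻¹-in (σ⁻¹-in rl)) ⟩
      σ D (J (J⁻¹ (σ⁻¹ l))) ∸ n   ≡⟨ cong (λ q → σ D q ∸ n) (1×-inverse s (flip s) (app-flipʳ s) (σ⁻¹-in rl)) ⟩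
      σ D (σ⁻¹ l) ∸ n             ≡⟨ cong (_∸ n) (σ-σ⁻¹ rl) ⟩
      l ∸ n                       ∎
      where open ≡-Reasoning

    wide : ∀ {l} → InRange n l → InRange (m + n) l
    wide (1≤l , l≤n) = 1≤l , ≤-trans l≤n (m≤n+m n m)

    π-in : ∀ {l} → InRange n l → InRange n (π l)
    π-in rl = proj₁ (σ-inRange D′ (J⁻¹-in (σ⁻¹-in (wide rl)))) ,
              m∸n≡0⇒m≤n (trans (π-∸ (wide rl)) (m≤n⇒m∸n≡0 (proj₂ rl)))

    π-injective : ∀ {l k} → InRange n l → InRange n k → π l ≡ π k → l ≡ k
    π-injective {l} {k} rl rk eq = trans (sym (σ-σ⁻¹ (wide rl))) (trans (cong (σ D) σ⁻¹≡) (σ-σ⁻¹ (wide rk)))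
      where
      J⁻¹≡ = σ-injective D′ (J⁻¹-in (σ⁻¹-in (wide rl))) (J⁻¹-in (σ⁻¹-in (wide rk))) eq
      σ⁻¹≡ : σ⁻¹ l ≡ σ⁻¹ k
      σ⁻¹≡ = trans (sym (1×-inverse s (flip s) (app-flipʳ s) (σ⁻¹-in (wide rl))))
        (trans (cong J J⁻¹≡) (1×-inverse s (flip s) (app-flipʳ s) (σ⁻¹-in (wide rk))))

  -- This is σ_D′ (1^m × s)⁻¹ σ_D⁻¹ restricted to 1,...,n. By the twist it preserves collapsed
  -- labels, so it fixes every label above n and maps 1,...,n to itself.
  relabelling : Perm n
  relabelling = fromInjection π π-in π-injective

  σ-relabelling : ∀ {p} → InRange (m + n) p → σ D′ p ≡ app relabelling (σ D ((1^ m × s) p))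
  σ-relabelling {p} rp = trans (sym π-l) (π≡ (l ≤? n))
    where
    l = σ D (J p)
    rl : InRange (m + n) l
    rl = σ-inRange D (J-in rp)
    π-l : π l ≡ σ D′ p
    π-l = cong (σ D′) (trans (cong J⁻¹ (σ⁻¹-σ (J-in rp))) (1×-inverse (flip s) s (app-flipˡ s) rp))
    π≡ : Dec (l ≤ n) → π l ≡ app relabelling l
    π≡ (yes l≤n) = sym (app-fromInjection π π-in π-injective (proj₁ rl , l≤n))
    π≡ (no l≰n) = trans (∸-cancelʳ-≡ (<⇒≤ (m∸n≢0⇒n<m λ eq → m>n⇒m∸n≢0 (≰⇒> l≰n) (trans (sym (π-∸ rl)) eq)))
                          (<⇒≤ (≰⇒> l≰n)) (π-∸ rl))
                        (sym (app-outside relabelling (l≰n ∘ proj₂)))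

  -- The same `τ` serves both arrays: they lie in one double coset, and the two monotonicity
  -- conditions speak of `τ` alone.
  IsBar-Twist : ∀ {τ} → IsBar m n (σ D) τ → IsBar m n (σ D′) τ
  IsBar-Twist {τ} ((u , v , eq) , dec₁ , dec₂) = (u · flip relabelling , v · s , eq′) , dec₁ , dec₂
    where
    open ≡-Reasoning
    eq′ : ∀ p → 1 ≤ p → p ≤ m + n → app τ p ≡ app (u · flip relabelling) (σ D′ ((1^ m × flip (v · s)) p))
    eq′ p 1≤p p≤ = begin
      app τ p
        ≡⟨ eq p 1≤p p≤ ⟩
      app u (σ D ((1^ m × flip v) p))
        ≡⟨ cong (app u ∘ σ D) (sym (1×-∘ s (flip (v · s)) (flip v)
             (λ q → sym (trans (cong (app s) (app-flip-· v s q)) (app-flipʳ s (app (flip v) q)))) (1≤p , p≤))) ⟩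
      app u (σ D (J q))
        ≡⟨ cong (app u) (app-flipˡ relabelling (σ D (J q))) ⟨
      app u (app (flip relabelling) (app relabelling (σ D (J q))))
        ≡⟨ cong (app u ∘ app (flip relabelling)) (σ-relabelling (1×-inRange (flip (v · s)) (1≤p , p≤))) ⟨
      app u (app (flip relabelling) (σ D′ q))
        ≡⟨ app-· u (flip relabelling) (σ D′ q) ⟨
      app (u · flip relabelling) (σ D′ q) ∎
      where q = (1^ m × flip (v · s)) p

  σ-Twist : ∀ {τ : Perm (m + n)} {u v : Perm n} →
    (∀ p → 1 ≤ p → p ≤ m + n → σ D p ≡ app u (app τ ((1^ m × v) p))) →
    ∀ p → 1 ≤ p → p ≤ m + n → σ D′ p ≡ app (relabelling · u) (app τ ((1^ m × (v · s)) p))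
  σ-Twist {τ} {u} {v} eq p 1≤p p≤ = begin
    σ D′ p                                               ≡⟨ σ-relabelling (1≤p , p≤) ⟩
    app relabelling (σ D (J p))                          ≡⟨ cong (app relabelling) (eq (J p) (proj₁ r) (proj₂ r)) ⟩
    app relabelling (app u (app τ ((1^ m × v) (J p))))   ≡⟨ app-· relabelling u (app τ ((1^ m × v) (J p))) ⟨
    app (relabelling · u) (app τ ((1^ m × v) (J p)))     ≡⟨ cong (app (relabelling · u) ∘ app τ) (1×-∘ v s (v · s) (app-· v s) (1≤p , p≤)) ⟩
    app (relabelling · u) (app τ ((1^ m × (v · s)) p))   ∎
    where
    open ≡-Reasoning
    r = J-in (1≤p , p≤)

-- The condition in `Cw` apart from membership in C, so that Bruhat arguments and crystal arguments
-- separate.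
Below : ∀ {m n} → RPD m n → Perm n → Set
Below {m} {n} D w = ∃[ τ ] (IsBar m n (σ D) τ ×
  ∃[ u ] ∃[ v ] (Bruhat {n} v w ×
    ((p : ℕ) → 1 ≤ p → p ≤ m + n → σ D p ≡ app {n} u (app τ ((1^ m × v) p)))))

Below-Twist : ∀ {m n} {s w w′ : Perm n} {D D′ : RPD m n} → Twist s D D′ →
  (∀ {v} → Bruhat v w → Bruhat (v · s) w′) → Below D w → Below D′ w′
Below-Twist {s = s} twist lift (τ , bar , u , v , v≤w , eq) =
  τ , IsBar-Twist {s = s} twist bar , relabelling {s = s} twist · u , v · s , lift v≤w ,
  σ-Twist {s = s} twist {τ} {u} {v} eq

Below-Twist-idₚ : ∀ {m n} {w : Perm n} {D D′ : RPD m n} → Twist idₚ D D′ → Below D w → Below D′ w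
Below-Twist-idₚ twist = Below-Twist {s = idₚ} twist
  (λ {v} → Bruhat-trans (b-refl λ p → trans (app-· v idₚ p) (cong (app v) (app-idₚ p))))

Twist-collapsed : ∀ {m n} (s : Perm n) {D D′ : RPD m n} → proj₁ (collapsed D′) ≡ proj₁ (collapsed D) →
  (∀ r → get 0 (proj₂ (collapsed D′)) r ≡ get 0 (proj₂ (collapsed D)) (app s r)) → Twist s D D′
Twist-collapsed {m} {n} s {D} {D′} tops rights rp with side m rp
... | top {p} r = trans (σ-top D′ r) (trans (cong (λ v → get 0 v p) tops)
        (trans (sym (σ-top D r)) (cong (λ q → σ D q ∸ n) (sym (1×-top s r)))))
... | right {r} rr = trans (σ-right D′ rr) (trans (rights r)
        (trans (sym (σ-right D (app-inRange s rr))) (cong (λ q → σ D q ∸ n) (sym (1×-right {m} s rr)))))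

Twist-idₚ : ∀ {m n} {D D′ : RPD m n} → collapsed D′ ≡ collapsed D → Twist idₚ D D′
Twist-idₚ {D = D} {D′} eq = Twist-collapsed idₚ {D} {D′} (cong proj₁ eq)
  λ r → cong₂ (λ c → get 0 (proj₂ c)) eq (sym (app-idₚ r))

-- Isolates rows i and i+1. The labels `bs` come from the rows underneath; `above` traces everything
-- else from the labels that the two rows emit upwards, with zeros in place of their right labels,
-- to be overwritten. Both left labels have collapsed to 0.
collapsedTrace-put₂ : ∀ {m k} i (rs : Vec (Vec Tile m) k) bot → 1 ≤ i → i < k →
  ∃[ bs ] ∃ {A = Vec ℕ m → Vec ℕ m × Vec ℕ k} λ above → ∀ w → let o = passRows (0 , 0) bs w ; tr = above (proj₁ o) in
    collapsedTrace (put₂ i rs (upperTiles w , lowerTiles w)) bot ≡ (proj₁ tr , put₂ i (proj₂ tr) (proj₂ o))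
collapsedTrace-put₂ (suc zero) (r ∷ []) bot _ (s≤s ())
collapsedTrace-put₂ (suc zero) (r ∷ r′ ∷ rs) bot _ _ =
  bs , (λ ts → ts , 0 ∷ 0 ∷ proj₂ (collapsedTrace rs bot)) ,
  λ w → cong (λ o → proj₁ o , proj₁ (proj₂ o) ∷ proj₂ (proj₂ o) ∷ proj₂ (collapsedTrace rs bot))
             (sym (passRows-processRow 0 0 bs w))
  where bs = proj₁ (collapsedTrace rs bot)
collapsedTrace-put₂ (suc (suc i)) (r ∷ rs) bot _ (s≤s i<k)
  with bs , above , eq ← collapsedTrace-put₂ (suc i) rs bot (s≤s z≤n) i<k =
  bs , (λ ts → let h = processRow 0 (proj₁ (above ts)) r in proj₁ h , proj₂ h ∷ proj₂ (above ts)) ,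
  λ w → cong (λ tr → let h = processRow 0 (proj₁ tr) r in proj₁ h , proj₂ h ∷ proj₂ tr) (eq w)

module _ {m n i : ℕ} (1≤i : 1 ≤ i) (i<n : i < n) where

  private
    s = sᵢ n i 1≤i i<n

    get-swapped : ∀ (X : Vec ℕ n) p q r → get 0 (put₂ i X (q , p)) r ≡ get 0 (put₂ i X (p , q)) (app s r)
    get-swapped X p q r = trans (go (swapView i (suc i) r)) (cong (get 0 (put₂ i X (p , q))) (sym (app-sᵢ n i 1≤i i<n r)))
      where
      go : ∀ {r r′} → SwapView i (suc i) r r′ → get 0 (put₂ i X (q , p)) r ≡ get 0 (put₂ i X (p , q)) r′
      go at-left = trans (cong proj₁ (get₂-put₂ 0 i X (q , p) 1≤i i<n)) (sym (cong proj₂ (get₂-put₂ 0 i X (p , q) 1≤i i<n)))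
      go at-right = trans (cong proj₂ (get₂-put₂ 0 i X (q , p) 1≤i i<n)) (sym (cong proj₁ (get₂-put₂ 0 i X (p , q) 1≤i i<n)))
      go (at-other {r} r≢i r≢1+i) = trans (untouched (q , p)) (sym (untouched (p , q)))
        where
        untouched : ∀ ab → get 0 (put₂ i X ab) r ≡ get 0 X r
        untouched (a , b) = trans (get-put-other 0 (put X i a) (suc i) r (r≢1+i ∘ sym)) (get-put-other 0 X i r (r≢i ∘ sym))

  Twist-RStep : ∀ {D D′ : RPD m n} → RStep i D D′ →
    (Twist idₚ D D′ × Twist idₚ D′ D) ⊎ (εʷ (wordR i D) ≡ 0 × Twist s D D′ × Twist s D′ D)
  Twist-RStep {D} {D′} (rstep st new)
    with bs , above , trace ← collapsedTrace-put₂ i D (collapse n (bottomLabels m n)) 1≤i i<n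
    with before ← trans (cong collapsed (sym (setRows-wordR i D))) (trace (wordR i D))
       | after ← trans (cong collapsed new) (trace (wordR i D′))
    -- At the left border there is no symbol - yet and both collapsed labels are 0, so the sweep
    -- starts sorted.
    with passRows-FStep st 0 0 0 bs (λ _ → z≤n) (subst (0 <_) (sym (FStep-φ st)) z<s)
  ... | inj₁ eq = inj₁ (Twist-idₚ same , Twist-idₚ (sym same))
    where
    same : collapsed D′ ≡ collapsed D
    same = trans after (trans (cong (λ o → proj₁ (above (proj₁ o)) , put₂ i (proj₂ (above (proj₁ o))) (proj₂ o)) eq) (sym before))
  ... | inj₂ (ε≡0 , eq) = inj₂ (ε≡0
          , Twist-collapsed s {D} {D′} (trans (cong proj₁ after′) (sym (cong proj₁ before)))
              (λ r → trans (cong (λ c → get 0 (proj₂ c) r) after′)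
                (trans (get-swapped X p q r) (cong (λ c → get 0 (proj₂ c) (app s r)) (sym before))))
          , Twist-collapsed s {D′} {D} (trans (cong proj₁ before) (sym (cong proj₁ after′)))
              (λ r → trans (cong (λ c → get 0 (proj₂ c) r) before)
                (trans (get-swapped X q p r) (cong (λ c → get 0 (proj₂ c) (app s r)) (sym after′)))))
    where
    o = passRows (0 , 0) bs (wordR i D)
    X = proj₂ (above (proj₁ o))
    p = proj₁ (proj₂ o)
    q = proj₂ (proj₂ o)
    after′ : collapsed D′ ≡ (proj₁ (above (proj₁ o)) , put₂ i X (q , p))
    after′ = trans after (cong (λ o → proj₁ (above (proj₁ o)) , put₂ i (proj₂ (above (proj₁ o))) (proj₂ o)) eq)

  highest-sorted : ∀ (D : RPD m n) → εʷ (wordR i D) ≡ 0 →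
    get 0 (proj₂ (collapsed D)) (suc i) ≤ get 0 (proj₂ (collapsed D)) i
  highest-sorted D ε≡0
    with bs , above , trace ← collapsedTrace-put₂ i D (collapse n (bottomLabels m n)) 1≤i i<n
    with before ← trans (cong collapsed (sym (setRows-wordR i D))) (trace (wordR i D)) =
    subst (λ ab → proj₂ ab ≤ proj₁ ab)
      (sym (trans (cong (get₂ 0 i ∘ proj₂) before) (get₂-put₂ 0 i _ _ 1≤i i<n)))
      (passRows-sorted 0 0 0 bs (wordR i D) (λ _ → z≤n) ε≡0 z≤n)

  module _ {w : Perm n} (w-ascent : app w i < app w (suc i)) where

    Below-raise : ∀ {D : RPD m n} → Below D w → Below D (w · s)
    Below-raise (τ , bar , u , v , v≤w , eq) =
      τ , bar , u , v , Bruhat-trans v≤w (Bruhat-ascent i 1≤i i<n w w-ascent) , eq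

    Below-RStep : ∀ {D D′ : RPD m n} → RStep i D D′ → Below D (w · s) ⇔ Below D′ (w · s)
    Below-RStep {D} {D′} st with Twist-RStep st
    ... | inj₁ (t , t′) = mk⇔ (Below-Twist-idₚ t) (Below-Twist-idₚ t′)
    ... | inj₂ (_ , t , t′) = mk⇔
            (Below-Twist {s = s} t (Bruhat-lift-·s i 1≤i i<n w-ascent))
            (Below-Twist {s = s} t′ (Bruhat-lift-·s i 1≤i i<n w-ascent))

    -- If v has an ascent at i, lifting gives v ≤ w at once. If it has a descent, then τ(m + v(i)) <
    -- τ(m + v(i+1)), so the collapsed upper label is at most the lower one; with `highest-sorted`
    -- the two tie. Then D is its own twist by `s`, and `v · s` is a representative with an ascent.
    Below-highest : ∀ {D : RPD m n} → εʷ (wordR i D) ≡ 0 → Below D (w · s) → Below D w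
    Below-highest {D} ε≡0 b@(τ , bar , u , v , v≤ws , eq) with <-cmp (app v i) (app v (suc i))
    ... | tri< v-ascent _ _ = τ , bar , u , v , Bruhat-drop-·s i 1≤i i<n w-ascent v-ascent v≤ws , eq
    ... | tri≈ _ vi≡ _ = contradiction (sym (app-injective v vi≡)) 1+n≢n
    ... | tri> _ _ v-descent =
            τ , IsBar-Twist {s = s} twist bar , relabelling {s = s} twist · u , v · s ,
            Bruhat-drop-·s i 1≤i i<n w-ascent vs-ascent (Bruhat-lift-·s i 1≤i i<n w-ascent v≤ws) ,
            σ-Twist {s = s} twist {τ} {u} {v} eq
      where
      R = proj₂ (collapsed D)
      ri : InRange n i
      ri = 1≤i , <⇒≤ i<n
      ri′ : InRange n (suc i)
      ri′ = s≤s z≤n , i<n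
      R≡ : ∀ {r} → InRange n r → get 0 R r ≡ app τ (m + app v r) ∸ n
      R≡ {r} rr = trans (sym (σ-right D rr)) (trans
        (cong (_∸ n) (trans
          (let 1≤ , ≤m+n = right-inRange m rr in eq (m + r) 1≤ ≤m+n)
          (cong (app u ∘ app τ) (1×-right {m} v rr))))
        (app-∸ u (app τ (m + app v r))))
      tie : get 0 R i ≡ get 0 R (suc i)
      tie = ≤-antisym
        (subst₂ _≤_ (sym (R≡ ri)) (sym (R≡ ri′)) (∸-monoˡ-≤ n (<⇒≤
          (proj₂ (proj₂ bar) (app v (suc i)) (app v i) (proj₁ (app-inRange v ri′)) v-descent (proj₂ (app-inRange v ri))))))
        (highest-sorted D ε≡0)
      twist : Twist s D D
      twist = Twist-collapsed s {D} {D} refl λ r → trans (go (swapView i (suc i) r)) (cong (get 0 R) (sym (app-sᵢ n i 1≤i i<n r)))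
        where
        go : ∀ {r r′} → SwapView i (suc i) r r′ → get 0 R r ≡ get 0 R r′
        go at-left = tie
        go at-right = sym tie
        go (at-other _ _) = refl
      vs : ∀ r → app (v · s) r ≡ app v (swapℕ i (suc i) r)
      vs r = trans (app-· v s r) (cong (app v) (app-sᵢ n i 1≤i i<n r))
      vs-ascent : app (v · s) i < app (v · s) (suc i)
      vs-ascent = subst₂ _<_
        (sym (trans (vs i) (cong (app v) (swapℕ-left i (suc i)))))
        (sym (trans (vs (suc i)) (cong (app v) (swapℕ-right i (suc i))))) v-descent

  Below-RStep-nonhighest : ∀ {w : Perm n} {D D′ : RPD m n} → RStep i D D′ → 0 < εʷ (wordR i D) →
    Below D w ⇔ Below D′ w
  Below-RStep-nonhighest st 0<ε with Twist-RStep st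
  ... | inj₁ (t , t′) = mk⇔ (Below-Twist-idₚ t) (Below-Twist-idₚ t′)
  ... | inj₂ (ε≡0 , _) = contradiction (sym ε≡0) (<⇒≢ 0<ε)

-- Characters

sumOf : ∀ {A : Set} → (A → ℤ) → List A → ℤ
sumOf g [] = 0ℤ
sumOf g (a ∷ l) = g a +ℤ sumOf g l

module _ {A : Set} where

  sumOf-++ : ∀ (g : A → ℤ) l l′ → sumOf g (l ++ l′) ≡ sumOf g l +ℤ sumOf g l′
  sumOf-++ g [] l′ = sym (ℤ.+-identityˡ _)
  sumOf-++ g (a ∷ l) l′ = trans (cong (g a +ℤ_) (sumOf-++ g l l′)) (sym (ℤ.+-assoc (g a) _ _))

  sumOf-map : ∀ {B : Set} (g : B → ℤ) (h : A → B) l → sumOf g (List.map h l) ≡ sumOf (g ∘ h) l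
  sumOf-map g h [] = refl
  sumOf-map g h (a ∷ l) = cong (g (h a) +ℤ_) (sumOf-map g h l)

  sumOf-cong : ∀ {g h : A → ℤ} l → (∀ {a} → a ∈ l → g a ≡ h a) → sumOf g l ≡ sumOf h l
  sumOf-cong [] _ = refl
  sumOf-cong (a ∷ l) eq = cong₂ _+ℤ_ (eq (here refl)) (sumOf-cong l (eq ∘ there))

  sumOf-+ : ∀ (g h : A → ℤ) l → sumOf (λ a → g a +ℤ h a) l ≡ sumOf g l +ℤ sumOf h l
  sumOf-+ g h [] = refl
  sumOf-+ g h (a ∷ l) = trans (cong (g a +ℤ h a +ℤ_) (sumOf-+ g h l))
    (solve′ 4 (λ a b c d → (a :+′ b) :+′ (c :+′ d) :=′ (a :+′ c) :+′ (b :+′ d)) refl (g a) (h a) _ _)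
    where open ℤSolver.+-*-Solver renaming (solve to solve′; _:+_ to _:+′_; _:=_ to _:=′_)

  sumOf-neg : ∀ (g : A → ℤ) l → sumOf (λ a → -ℤ g a) l ≡ -ℤ sumOf g l
  sumOf-neg g [] = refl
  sumOf-neg g (a ∷ l) = trans (cong (-ℤ g a +ℤ_) (sumOf-neg g l)) (sym (ℤ.neg-distrib-+ (g a) _))

  sumOf-*ˡ : ∀ c (g : A → ℤ) l → sumOf (λ a → c *ℤ g a) l ≡ c *ℤ sumOf g l
  sumOf-*ˡ c g [] = sym (ℤ.*-zeroʳ c)
  sumOf-*ˡ c g (a ∷ l) = trans (cong (c *ℤ g a +ℤ_) (sumOf-*ˡ c g l)) (sym (ℤ.*-distribˡ-+ c (g a) _))

  sumOf-↭ : ∀ (g : A → ℤ) {l l′} → l ↭ l′ → sumOf g l ≡ sumOf g l′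
  sumOf-↭ g ↭-base = refl
  sumOf-↭ g (prep a p) = cong (g a +ℤ_) (sumOf-↭ g p)
  sumOf-↭ g (swap a b p) = trans (sym (ℤ.+-assoc (g a) (g b) _))
    (trans (cong₂ _+ℤ_ (ℤ.+-comm (g a) (g b)) (sumOf-↭ g p)) (ℤ.+-assoc (g b) (g a) _))
  sumOf-↭ g (↭-step p q) = trans (sumOf-↭ g p) (sumOf-↭ g q)

  sumOf-unique : ∀ (g : A → ℤ) {l l′ : List A} → Unique l → Unique l′ →
    (∀ {a} → a ∈ l → a ∈ l′) → (∀ {a} → a ∈ l′ → a ∈ l) → sumOf g l ≡ sumOf g l′
  sumOf-unique g u u′ to from = sumOf-↭ g (∼bag⇒↭ (unique∧set⇒bag u u′ (mk⇔ to from)))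

sumOf-concatMap : ∀ {A B : Set} (g : B → ℤ) (h : A → List B) l →
  sumOf g (concatMap h l) ≡ sumOf (sumOf g ∘ h) l
sumOf-concatMap g h [] = refl
sumOf-concatMap g h (a ∷ l) = trans (sumOf-++ g (h a) (concatMap h l)) (cong (sumOf g (h a) +ℤ_) (sumOf-concatMap g h l))

module _ {A B : Set} (h : A → List B) where

  ∈-concatMap-intro : ∀ {l a b} → a ∈ l → b ∈ h a → b ∈ concatMap h l
  ∈-concatMap-intro (here refl) b∈ = ∈-++⁺ˡ b∈
  ∈-concatMap-intro {a′ ∷ _} (there a∈) b∈ = ∈-++⁺ʳ (h a′) (∈-concatMap-intro a∈ b∈)

  ∈-concatMap-elim : ∀ l {b} → b ∈ concatMap h l → ∃[ a ] (a ∈ l × b ∈ h a)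
  ∈-concatMap-elim (a ∷ l) b∈ with ∈-++⁻ (h a) b∈
  ... | inj₁ b∈ha = a , here refl , b∈ha
  ... | inj₂ b∈l with a′ , a′∈ , b∈ha′ ← ∈-concatMap-elim l b∈l = a′ , there a′∈ , b∈ha′

  concatMap-unique : ∀ {l} → Unique l → (∀ {a} → a ∈ l → Unique (h a)) →
    (∀ {a a′ b} → a ∈ l → a′ ∈ l → b ∈ h a → b ∈ h a′ → a ≡ a′) → Unique (concatMap h l)
  concatMap-unique [] _ _ = []
  concatMap-unique {a ∷ l} (a∉ ∷ u) uh disjoint = Unique.++⁺ (uh (here refl))
    (concatMap-unique u (uh ∘ there) (λ a∈ a′∈ → disjoint (there a∈) (there a′∈)))
    λ { (b∈ha , b∈l) → case ∈-concatMap-elim l b∈l of λ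
        { (a′ , a′∈ , b∈ha′) → All.lookup a∉ a′∈ (disjoint (here refl) (there a′∈) b∈ha b∈ha′) } }

-- Polynomials as linear functionals on functions of exponents; coefficients are the values at
-- indicator functions.
module _ {n : ℕ} where

  evaluate : Poly n → (Vec ℕ n → ℤ) → ℤ
  evaluate p Φ = sumOf (λ t → proj₁ t *ℤ Φ (proj₂ t)) p

  indicator : Vec ℕ n → Vec ℕ n → ℤ
  indicator α β with Vec.≡-dec _≟_ β α
  ... | yes _ = 1ℤ
  ... | no _ = 0ℤ

  coeff-evaluate : ∀ (p : Poly n) α → coeff p α ≡ evaluate p (indicator α)
  coeff-evaluate [] α = refl
  coeff-evaluate ((c , β) ∷ p) α with Vec.≡-dec _≟_ β α
  ... | yes _ = cong₂ _+ℤ_ (sym (ℤ.*-identityʳ c)) (coeff-evaluate p α)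
  ... | no _ = trans (coeff-evaluate p α) (sym (trans (cong (_+ℤ evaluate p (indicator α)) (ℤ.*-zeroʳ c)) (ℤ.+-identityˡ _)))

  evaluate-+ₚ : ∀ (p q : Poly n) Φ → evaluate (p +ₚ q) Φ ≡ evaluate p Φ +ℤ evaluate q Φ
  evaluate-+ₚ p q Φ = sumOf-++ _ p q

  evaluate-neg : ∀ (p : Poly n) Φ → evaluate (-ₚ p) Φ ≡ -ℤ evaluate p Φ
  evaluate-neg p Φ = trans (sumOf-map _ _ p) (trans
    (sumOf-cong p (λ {t} _ → sym (ℤ.neg-distribˡ-* (proj₁ t) (Φ (proj₂ t))))) (sumOf-neg _ p))

  evaluate--ₚ : ∀ (p q : Poly n) Φ → evaluate (p -ₚ q) Φ ≡ evaluate p Φ +ℤ -ℤ evaluate q Φ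
  evaluate--ₚ p q Φ = trans (evaluate-+ₚ p (-ₚ q) Φ) (cong (evaluate p Φ +ℤ_) (evaluate-neg q Φ))

  evaluate-*ₚ : ∀ (p q : Poly n) Φ → evaluate (p *ₚ q) Φ ≡ evaluate p (λ β → evaluate q (λ γ → Φ (Vec.zipWith _+_ β γ)))
  evaluate-*ₚ p q Φ = trans (sumOf-concatMap _ _ p) (sumOf-cong p λ {s} _ →
    trans (sumOf-map _ _ q) (trans (sumOf-cong q (λ {t} _ → ℤ.*-assoc (proj₁ s) (proj₁ t) _)) (sumOf-*ˡ (proj₁ s) _ q)))

  evaluate-sₚ : ∀ i (p : Poly n) Φ → evaluate (sₚ i p) Φ ≡ evaluate p (Φ ∘ swapExp i)
  evaluate-sₚ i p Φ = sumOf-map _ _ p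

  evaluate-monomial : ∀ α (Φ : Vec ℕ n → ℤ) → evaluate (monomial α) Φ ≡ Φ α
  evaluate-monomial α Φ = trans (ℤ.+-identityʳ _) (ℤ.*-identityˡ _)

  evaluate-ch : ∀ {m} (L : List (RPD m n)) Φ → evaluate (ch L) Φ ≡ sumOf (Φ ∘ wt) L
  evaluate-ch L Φ = trans (sumOf-concatMap _ _ L) (sumOf-cong L λ {D} _ → evaluate-monomial (wt D) Φ)

  unit : ℕ → Vec ℕ n
  unit i = put (Vec.replicate n 0) i 1

  0⁺ : Vec ℕ n
  0⁺ = Vec.replicate n 0

  -- Transposes, acting on functionals, of the operations in `IsπK`: `divided` of multiplication by
  -- x_i - x_{i+1}, `raised` of multiplication by (1 + x_{i+1}) x_i, and `antisymmetrized` of the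
  -- latter followed by g ↦ g - s_i g.
  divided raised : ℕ → (Vec ℕ n → ℤ) → Vec ℕ n → ℤ
  divided i Φ γ = Φ (Vec.zipWith _+_ (unit i) γ) +ℤ -ℤ Φ (Vec.zipWith _+_ (unit (suc i)) γ)
  raised i Φ γ = Φ (Vec.zipWith _+_ 0⁺ (Vec.zipWith _+_ (unit i) γ)) +ℤ
                 Φ (Vec.zipWith _+_ (unit (suc i)) (Vec.zipWith _+_ (unit i) γ))

  antisymmetrized : ℕ → (Vec ℕ n → ℤ) → Vec ℕ n → ℤ
  antisymmetrized i Φ γ = raised i Φ γ +ℤ -ℤ raised i (Φ ∘ swapExp i) γ

  module _ {m : ℕ} (i : ℕ) (L L′ : List (RPD m n)) where

    evaluate-∂-side : ∀ Φ → evaluate ((x i -ₚ x (suc i)) *ₚ ch L′) Φ ≡ sumOf (divided i Φ ∘ wt) L′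
    evaluate-∂-side Φ = begin
      evaluate ((x i -ₚ x (suc i)) *ₚ ch L′) Φ
        ≡⟨ evaluate-*ₚ (x i -ₚ x (suc i)) (ch L′) Φ ⟩
      evaluate (x i -ₚ x (suc i)) Ψ
        ≡⟨ evaluate--ₚ (x i) (x (suc i)) Ψ ⟩
      evaluate (x i) Ψ +ℤ -ℤ evaluate (x (suc i)) Ψ
        ≡⟨ cong₂ (λ a b → a +ℤ -ℤ b) (term i) (term (suc i)) ⟩
      sumOf (Φ ∘ Vec.zipWith _+_ (unit i) ∘ wt) L′ +ℤ -ℤ sumOf (Φ ∘ Vec.zipWith _+_ (unit (suc i)) ∘ wt) L′
        ≡⟨ cong (sumOf (Φ ∘ Vec.zipWith _+_ (unit i) ∘ wt) L′ +ℤ_) (sym (sumOf-neg _ L′)) ⟩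
      sumOf (Φ ∘ Vec.zipWith _+_ (unit i) ∘ wt) L′ +ℤ sumOf (λ D → -ℤ Φ (Vec.zipWith _+_ (unit (suc i)) (wt D))) L′
        ≡⟨ sumOf-+ _ _ L′ ⟨
      sumOf (divided i Φ ∘ wt) L′ ∎
      where
      open ≡-Reasoning
      Ψ : Vec ℕ n → ℤ
      Ψ β = evaluate (ch L′) (λ γ → Φ (Vec.zipWith _+_ β γ))
      term : ∀ k → evaluate (x k) Ψ ≡ sumOf (Φ ∘ Vec.zipWith _+_ (unit k) ∘ wt) L′
      term k = trans (evaluate-monomial (unit k) Ψ) (evaluate-ch L′ _)

    evaluate-raised : ∀ Φ → evaluate ((1ₚ +ₚ x (suc i)) *ₚ (x i *ₚ ch L)) Φ ≡ sumOf (raised i Φ ∘ wt) L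
    evaluate-raised Φ = begin
      evaluate ((1ₚ +ₚ x (suc i)) *ₚ (x i *ₚ ch L)) Φ
        ≡⟨ evaluate-*ₚ (1ₚ +ₚ x (suc i)) (x i *ₚ ch L) Φ ⟩
      evaluate (1ₚ +ₚ x (suc i)) Ψ
        ≡⟨ evaluate-+ₚ 1ₚ (x (suc i)) Ψ ⟩
      evaluate 1ₚ Ψ +ℤ evaluate (x (suc i)) Ψ
        ≡⟨ cong₂ _+ℤ_ (trans (evaluate-monomial 0⁺ Ψ) (term 0⁺)) (trans (evaluate-monomial (unit (suc i)) Ψ) (term (unit (suc i)))) ⟩
      sumOf (λ D → Φ (Vec.zipWith _+_ 0⁺ (Vec.zipWith _+_ (unit i) (wt D)))) L +ℤ
      sumOf (λ D → Φ (Vec.zipWith _+_ (unit (suc i)) (Vec.zipWith _+_ (unit i) (wt D)))) L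
        ≡⟨ sumOf-+ _ _ L ⟨
      sumOf (raised i Φ ∘ wt) L ∎
      where
      open ≡-Reasoning
      Ψ : Vec ℕ n → ℤ
      Ψ β = evaluate (x i *ₚ ch L) (λ γ → Φ (Vec.zipWith _+_ β γ))
      term : ∀ β → Ψ β ≡ sumOf (λ D → Φ (Vec.zipWith _+_ β (Vec.zipWith _+_ (unit i) (wt D)))) L
      term β = trans (evaluate-*ₚ (x i) (ch L) (Φ ∘ Vec.zipWith _+_ β))
        (trans (evaluate-monomial (unit i) (λ γ → evaluate (ch L) (Φ ∘ Vec.zipWith _+_ β ∘ Vec.zipWith _+_ γ)))
               (evaluate-ch L (Φ ∘ Vec.zipWith _+_ β ∘ Vec.zipWith _+_ (unit i))))

    -- Against a functional both sides become plain sums over arrays, which can be regrouped string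
    -- by string.
    IsπK-intro : (∀ Φ → sumOf (divided i Φ ∘ wt) L′ ≡ sumOf (antisymmetrized i Φ ∘ wt) L) → IsπK i (ch L) (ch L′)
    IsπK-intro eq α = begin
      coeff ((x i -ₚ x (suc i)) *ₚ ch L′) α            ≡⟨ coeff-evaluate ((x i -ₚ x (suc i)) *ₚ ch L′) α ⟩
      evaluate ((x i -ₚ x (suc i)) *ₚ ch L′) Φ         ≡⟨ evaluate-∂-side Φ ⟩
      sumOf (divided i Φ ∘ wt) L′                      ≡⟨ eq Φ ⟩
      sumOf (antisymmetrized i Φ ∘ wt) L
        ≡⟨ sumOf-+ _ _ L ⟩
      sumOf (raised i Φ ∘ wt) L +ℤ sumOf (λ D → -ℤ raised i (Φ ∘ swapExp i) (wt D)) L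
        ≡⟨ cong₂ _+ℤ_ (sym (evaluate-raised Φ))
             (trans (sumOf-neg _ L) (cong -ℤ_ (trans (sym (evaluate-raised (Φ ∘ swapExp i))) (sym (evaluate-sₚ i g Φ))))) ⟩
      evaluate g Φ +ℤ -ℤ evaluate (sₚ i g) Φ         ≡⟨ evaluate--ₚ g (sₚ i g) Φ ⟨
      evaluate (g -ₚ sₚ i g) Φ                         ≡⟨ coeff-evaluate (g -ₚ sₚ i g) α ⟨
      coeff (g -ₚ sₚ i g) α                            ∎
      where
      open ≡-Reasoning
      Φ = indicator α
      g = (1ₚ +ₚ x (suc i)) *ₚ (x i *ₚ ch L)

module _ {n : ℕ} where

  0⁺-+ : ∀ {k} (γ : Vec ℕ k) → Vec.zipWith _+_ (Vec.replicate k 0) γ ≡ γ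
  0⁺-+ = Vec.zipWith-identityˡ +-identityˡ

  unit-+ : ∀ i (γ : Vec ℕ n) → Vec.zipWith _+_ (unit i) γ ≡ put γ i (suc (get 0 γ i))
  unit-+ zero γ = 0⁺-+ γ
  unit-+ (suc i) γ = go i γ
    where
    go : ∀ {k} i (γ : Vec ℕ k) → Vec.zipWith _+_ (put0 (Vec.replicate k 0) i 1) γ ≡ put0 γ i (suc (get0 0 γ i))
    go i [] = refl
    go zero (y ∷ γ) = cong (suc y ∷_) (0⁺-+ γ)
    go (suc i) (y ∷ γ) = cong (y ∷_) (go i γ)

  module _ {i : ℕ} (1≤i : 1 ≤ i) (i<n : i < n) where

    unit-put₂ : ∀ (α : Vec ℕ n) p q → Vec.zipWith _+_ (unit i) (put₂ i α (p , q)) ≡ put₂ i α (suc p , q)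
    unit-put₂ α p q = begin
      Vec.zipWith _+_ (unit i) (put₂ i α (p , q))  ≡⟨ unit-+ i (put₂ i α (p , q)) ⟩
      put (put₂ i α (p , q)) i (suc (get 0 (put₂ i α (p , q)) i))
        ≡⟨ cong (λ k → put (put₂ i α (p , q)) i (suc k)) (cong proj₁ (get₂-put₂ 0 i α (p , q) 1≤i i<n)) ⟩
      put (put (put α i p) (suc i) q) i (suc p)    ≡⟨ put-comm (put α i p) (suc i) i 1+n≢n ⟩
      put (put (put α i p) i (suc p)) (suc i) q    ≡⟨ cong (λ β → put β (suc i) q) (put-put α i) ⟩
      put₂ i α (suc p , q)                         ∎
      where open ≡-Reasoning

    unit-suc-put₂ : ∀ (α : Vec ℕ n) p q → Vec.zipWith _+_ (unit (suc i)) (put₂ i α (p , q)) ≡ put₂ i α (p , suc q)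
    unit-suc-put₂ α p q = begin
      Vec.zipWith _+_ (unit (suc i)) (put₂ i α (p , q))  ≡⟨ unit-+ (suc i) (put₂ i α (p , q)) ⟩
      put (put₂ i α (p , q)) (suc i) (suc (get 0 (put₂ i α (p , q)) (suc i)))
        ≡⟨ cong (λ k → put (put₂ i α (p , q)) (suc i) (suc k)) (cong proj₂ (get₂-put₂ 0 i α (p , q) 1≤i i<n)) ⟩
      put (put₂ i α (p , q)) (suc i) (suc q)             ≡⟨ put-put (put α i p) (suc i) ⟩
      put₂ i α (p , suc q)                               ∎
      where open ≡-Reasoning

    swapExp-put₂ : ∀ (α : Vec ℕ n) p q → swapExp i (put₂ i α (p , q)) ≡ put₂ i α (q , p)
    swapExp-put₂ α p q = trans (cong (λ ab → put₂ i (put₂ i α (p , q)) (proj₂ ab , proj₁ ab)) (get₂-put₂ 0 i α (p , q) 1≤i i<n))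
      (put₂-put₂ i α (p , q) (q , p))

    module _ (Φ : Vec ℕ n → ℤ) (α : Vec ℕ n) where

      private
        ψ : ℕ → ℕ → ℤ
        ψ p q = Φ (put₂ i α (p , q))

      divided-put₂ : ∀ p q → divided i Φ (put₂ i α (p , q)) ≡ ψ (suc p) q +ℤ -ℤ ψ p (suc q)
      divided-put₂ p q = cong₂ (λ β γ → Φ β +ℤ -ℤ Φ γ) (unit-put₂ α p q) (unit-suc-put₂ α p q)

      raised-put₂ : ∀ p q → raised i Φ (put₂ i α (p , q)) ≡ ψ (suc p) q +ℤ ψ (suc p) (suc q)
      raised-put₂ p q = cong₂ (λ β γ → Φ β +ℤ Φ γ)
        (trans (0⁺-+ _) (unit-put₂ α p q))
        (trans (cong (Vec.zipWith _+_ (unit (suc i))) (unit-put₂ α p q)) (unit-suc-put₂ α (suc p) q))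

    raised-swap-put₂ : ∀ (Φ : Vec ℕ n → ℤ) α p q → let ψ = λ p q → Φ (put₂ i α (p , q)) in
      raised i (Φ ∘ swapExp i) (put₂ i α (p , q)) ≡ ψ q (suc p) +ℤ ψ (suc q) (suc p)
    raised-swap-put₂ Φ α p q = trans (raised-put₂ (Φ ∘ swapExp i) α p q)
      (cong₂ (λ β γ → Φ β +ℤ Φ γ) (swapExp-put₂ α (suc p) q) (swapExp-put₂ α (suc p) (suc q)))

-- The sum of G over the weights (k+p,q), (k+p,q+1), (k+p−1,q+1), …, (p,k+q) of an i-string.
walk : (ℕ → ℕ → ℤ) → ℕ → ℕ → ℕ → ℤ
walk G zero p q = G p q
walk G (suc k) p q = G (suc k + p) q +ℤ (G (suc k + p) (suc q) +ℤ walk G k p (suc q))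

walk-cong : ∀ {G H} → (∀ a b → G a b ≡ H a b) → ∀ k p q → walk G k p q ≡ walk H k p q
walk-cong eq zero p q = eq p q
walk-cong eq (suc k) p q = cong₂ _+ℤ_ (eq _ _) (cong₂ _+ℤ_ (eq _ _) (walk-cong eq k p (suc q)))

module _ where
  open ℤSolver.+-*-Solver using () renaming (solve to solveℤ; _:+_ to _⊕_; :-_ to ⊝_; _:=_ to _≗ₛ_)

  walk-minus : ∀ G H k p q → walk (λ a b → G a b +ℤ -ℤ H a b) k p q ≡ walk G k p q +ℤ -ℤ walk H k p q
  walk-minus G H zero p q = refl
  walk-minus G H (suc k) p q rewrite walk-minus G H k p (suc q) =
    solveℤ 6 (λ a b c d e f → (a ⊕ ⊝ b) ⊕ ((c ⊕ ⊝ d) ⊕ (e ⊕ ⊝ f)) ≗ₛ (a ⊕ (c ⊕ e)) ⊕ ⊝ (b ⊕ (d ⊕ f))) refl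
      (G (suc k + p) q) (H (suc k + p) q) (G (suc k + p) (suc q)) (H (suc k + p) (suc q)) (walk G k p (suc q)) (walk H k p (suc q))

  -- `walk` recurses from its first weight; reversing it in `walk-swap` requires splitting off the
  -- last two.
  walk-snoc : ∀ G k p q → walk G (suc k) p q ≡ walk G k (suc p) q +ℤ (G (suc p) (suc (k + q)) +ℤ G p (suc (k + q)))
  walk-snoc G zero p q = refl
  walk-snoc G (suc k) p q = begin
    G (suc (suc k) + p) q +ℤ (G (suc (suc k) + p) (suc q) +ℤ walk G (suc k) p (suc q))
      ≡⟨ cong (λ t → G (suc (suc k) + p) q +ℤ (G (suc (suc k) + p) (suc q) +ℤ t)) (walk-snoc G k p (suc q)) ⟩
    G (suc (suc k) + p) q +ℤ (G (suc (suc k) + p) (suc q) +ℤ (walk G k (suc p) (suc q) +ℤ (G (suc p) (suc (k + suc q)) +ℤ G p (suc (k + suc q)))))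
      ≡⟨ cong₂ (λ a b → G (suc a) q +ℤ (G (suc a) (suc q) +ℤ (walk G k (suc p) (suc q) +ℤ (G (suc p) (suc b) +ℤ G p (suc b)))))
               (sym (+-suc k p)) (+-suc k q) ⟩
    G (suc k + suc p) q +ℤ (G (suc k + suc p) (suc q) +ℤ (walk G k (suc p) (suc q) +ℤ (G (suc p) (suc (suc k + q)) +ℤ G p (suc (suc k + q)))))
      ≡⟨ solveℤ 5 (λ a b c d e → a ⊕ (b ⊕ (c ⊕ (d ⊕ e))) ≗ₛ (a ⊕ (b ⊕ c)) ⊕ (d ⊕ e)) refl
           (G (suc k + suc p) q) (G (suc k + suc p) (suc q)) (walk G k (suc p) (suc q)) (G (suc p) (suc (suc k + q))) (G p (suc (suc k + q))) ⟩
    walk G (suc k) (suc p) q +ℤ (G (suc p) (suc (suc k + q)) +ℤ G p (suc (suc k + q))) ∎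
    where open ≡-Reasoning

  walk-swap : ∀ G k p q → walk (λ a b → G b a) k p q ≡ walk G k q p
  walk-swap G zero p q = refl
  walk-swap G (suc k) p q = begin
    G q (suc k + p) +ℤ (G (suc q) (suc k + p) +ℤ walk (λ a b → G b a) k p (suc q))
      ≡⟨ cong (λ t → G q (suc k + p) +ℤ (G (suc q) (suc k + p) +ℤ t)) (walk-swap G k p (suc q)) ⟩
    G q (suc k + p) +ℤ (G (suc q) (suc k + p) +ℤ walk G k (suc q) p)
      ≡⟨ solveℤ 3 (λ a b c → a ⊕ (b ⊕ c) ≗ₛ c ⊕ (b ⊕ a)) refl (G q (suc k + p)) (G (suc q) (suc k + p)) (walk G k (suc q) p) ⟩
    walk G k (suc q) p +ℤ (G (suc q) (suc k + p) +ℤ G q (suc k + p))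
      ≡⟨ walk-snoc G k q p ⟨
    walk G (suc k) q p ∎
    where open ≡-Reasoning

  module _ (ψ : ℕ → ℕ → ℤ) where

    private
      -- At exponents (a , b) of x_i and x_{i+1}, `A` is `divided`, `Z` is `raised`, `Y b a` is
      -- `raised` of the swapped functional, and `B` is `antisymmetrized`.
      A B Y Z : ℕ → ℕ → ℤ
      A a b = ψ (suc a) b +ℤ -ℤ ψ a (suc b)
      Z a b = ψ (suc a) b +ℤ ψ (suc a) (suc b)
      Y a b = ψ a (suc b) +ℤ ψ (suc a) (suc b)
      B a b = Z a b +ℤ -ℤ Y b a

      A≡Z-Y : ∀ a b → A a b ≡ Z a b +ℤ -ℤ Y a b
      A≡Z-Y a b = solveℤ 3 (λ u v w → u ⊕ ⊝ v ≗ₛ (u ⊕ w) ⊕ ⊝ (v ⊕ w)) refl (ψ (suc a) b) (ψ a (suc b)) (ψ (suc a) (suc b))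

    -- The two terms at (a , q) and (a , q+1) add up to Z(a , q) - Z(a-1 , q+1), so only the first Z
    -- and the last Y remain.
    walk-telescope : ∀ k p q → walk A k p q ≡ Z (k + p) q +ℤ -ℤ Y p (k + q)
    walk-telescope zero p q = A≡Z-Y p q
    walk-telescope (suc k) p q rewrite walk-telescope k p (suc q) | +-suc k q =
      solveℤ 6 (λ a b c d e f → (a ⊕ ⊝ b) ⊕ ((c ⊕ ⊝ d) ⊕ ((b ⊕ d) ⊕ ⊝ (e ⊕ f))) ≗ₛ (a ⊕ c) ⊕ ⊝ (e ⊕ f)) refl
        (ψ (suc (suc k + p)) q) (ψ (suc k + p) (suc q)) (ψ (suc (suc k + p)) (suc q)) (ψ (suc k + p) (suc (suc q)))
        (ψ p (suc (suc (k + q)))) (ψ (suc p) (suc (suc (k + q))))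

    -- The case of a string met in its highest element only: that single element accounts for the
    -- whole string.
    walk-top : ∀ k p → walk A k p p ≡ B (k + p) p
    walk-top k p = walk-telescope k p p

    -- The case of a string met in full: its weights are symmetric, so reversing the walk turns the
    -- sum of Y(a , b) into that of Y(b , a).
    walk-symmetric : ∀ k p → walk A k p p ≡ walk B k p p
    walk-symmetric k p = begin
      walk A k p p                                     ≡⟨ walk-cong A≡Z-Y k p p ⟩
      walk (λ a b → Z a b +ℤ -ℤ Y a b) k p p           ≡⟨ walk-minus Z Y k p p ⟩
      walk Z k p p +ℤ -ℤ walk Y k p p                  ≡⟨ cong (λ t → walk Z k p p +ℤ -ℤ t) (walk-swap Y k p p) ⟨
      walk Z k p p +ℤ -ℤ walk (λ a b → Y b a) k p p    ≡⟨ walk-minus Z (λ a b → Y b a) k p p ⟨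
      walk B k p p                                     ∎
      where open ≡-Reasoning

-- The i-strings of arrays and their weights

odd≢even : ∀ k l → 1 + k * 2 ≢ l * 2
odd≢even k zero ()
odd≢even zero (suc l) ()
odd≢even (suc k) (suc l) eq = odd≢even k l (suc-injective (suc-injective eq))

data Chain {m n} (i : ℕ) : RPD m n → List (RPD m n) → Set where
  end  : ∀ {D} → φʷ (wordR i D) ≡ 0 → Chain i D (D ∷ [])
  next : ∀ {D D′ l} → RStep i D D′ → Chain i D′ l → Chain i D (D ∷ l)

-- Built at the far end, so that matching on two paths to one array exposes its predecessors.
data Reach {m n} (i : ℕ) (D : RPD m n) : RPD m n → Set where
  start : Reach i D D
  step  : ∀ {E E′} → Reach i D E → RStep i E E′ → Reach i D E′

module _ {m n i : ℕ} where

  RStep-φ : ∀ {D D′ : RPD m n} → RStep i D D′ → φʷ (wordR i D) ≡ suc (φʷ (wordR i D′))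
  RStep-φ st = FStep-φ (RStep.step st)

  RStep-ε : ∀ {D D′ : RPD m n} → RStep i D D′ → εʷ (wordR i D′) ≡ suc (εʷ (wordR i D))
  RStep-ε st = FStep-ε (RStep.step st)

  Reach-prepend : ∀ {D D′ E : RPD m n} → RStep i D D′ → Reach i D′ E → Reach i D E
  Reach-prepend st start = step start st
  Reach-prepend st (step r st′) = step (Reach-prepend st r) st′

  Chain-Reach : ∀ {D E : RPD m n} {l} → Chain i D l → E ∈ l → Reach i D E
  Chain-Reach (end _) (here refl) = start
  Chain-Reach (next _ _) (here refl) = start
  Chain-Reach (next st c) (there E∈) = Reach-prepend st (Chain-Reach c E∈)

  Chain-head : ∀ {D : RPD m n} {l} → Chain i D l → D ∈ l
  Chain-head (end _) = here refl
  Chain-head (next _ _) = here refl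

  Chain-ε : ∀ {D E : RPD m n} {l} → Chain i D l → E ∈ l → εʷ (wordR i D) ≤ εʷ (wordR i E)
  Chain-ε (end _) (here refl) = ≤-refl
  Chain-ε (next _ _) (here refl) = ≤-refl
  Chain-ε (next st c) (there E∈) = ≤-trans (≤-trans (n≤1+n _) (≤-reflexive (sym (RStep-ε st)))) (Chain-ε c E∈)

  Chain-unique : ∀ {D : RPD m n} {l} → Chain i D l → Unique l
  Chain-unique (end _) = [] ∷ []
  Chain-unique (next st c) =
    All.tabulate (λ { E∈ refl → <-irrefl refl (subst (_≤ _) (RStep-ε st) (Chain-ε c E∈)) }) ∷ Chain-unique c

module _ {m n i : ℕ} (1≤i : 1 ≤ i) (i<n : i < n) where

  Chain-exists : ∀ k (D : RPD m n) → φʷ (wordR i D) ≡ k → ∃[ l ] Chain i D l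
  Chain-exists zero D eq = D ∷ [] , end eq
  Chain-exists (suc k) D eq with D′ , st ← RStep-exists 1≤i i<n D (subst (0 <_) (sym eq) z<s)
    with l , c ← Chain-exists k D′ (suc-injective (trans (sym (RStep-φ st)) eq)) = D ∷ l , next st c

  iString : RPD m n → List (RPD m n)
  iString D = proj₁ (Chain-exists _ D refl)

  iString-Chain : ∀ D → Chain i D (iString D)
  iString-Chain D = proj₂ (Chain-exists _ D refl)

  Chain-closed : ∀ {D E E′ : RPD m n} {l} → Chain i D l → E ∈ l → RStep i E E′ → E′ ∈ l
  Chain-closed (end φ≡0) (here refl) st = contradiction (trans (sym φ≡0) (RStep-φ st)) λ ()
  Chain-closed (next st′ c) (here refl) st with refl ← RStep-functional 1≤i i<n st st′ = there (Chain-head c)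
  Chain-closed (next st′ c) (there E∈) st = there (Chain-closed c E∈ st)

  -- As f_i is injective, both paths can be retraced together from `E`; an array with ε = 0 has no
  -- predecessor, so they stop at the same one.
  Reach-source-unique : ∀ {D D′ E : RPD m n} → εʷ (wordR i D) ≡ 0 → εʷ (wordR i D′) ≡ 0 →
                        Reach i D E → Reach i D′ E → D ≡ D′
  Reach-source-unique ε≡0 ε′≡0 start start = refl
  Reach-source-unique ε≡0 ε′≡0 start (step _ st) = contradiction (trans (sym ε≡0) (RStep-ε st)) λ ()
  Reach-source-unique ε≡0 ε′≡0 (step _ st) start = contradiction (trans (sym ε′≡0) (RStep-ε st)) λ ()
  Reach-source-unique ε≡0 ε′≡0 (step r st) (step r′ st′) with refl ← RStep-injective 1≤i i<n st st′ =
    Reach-source-unique ε≡0 ε′≡0 r r′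

  bumps-wt : ∀ (D : RPD m n) → get₂ 0 i (wt D) ≡ (upperBumps (wordR i D) , lowerBumps (wordR i D))
  bumps-wt D = trans (cong (get₂ 0 i) (trans (cong wt (sym (setRows-wordR i D))) (wt-setRows D (wordR i D))))
    (get₂-put₂ 0 i (wt D) _ 1≤i i<n)
    where
    wt-setRows : ∀ (D : RPD m n) w → wt (setRows i D w) ≡ put₂ i (wt D) (upperBumps w , lowerBumps w)
    wt-setRows D w = trans (map-put countBumps (put D i (upperTiles w)) (suc i))
      (cong (λ β → put β (suc i) (lowerBumps w)) (map-put countBumps D i))

  wt-RStep : ∀ {D D′ : RPD m n} → RStep i D D′ → ∀ {α ab} → wt D ≡ put₂ i α ab →
    wt D′ ≡ put₂ i α (upperBumps (wordR i D′) , lowerBumps (wordR i D′))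
  wt-RStep {D} {D′} (rstep _ new) {α} {ab} eq = begin
    wt D′                              ≡⟨ cong wt new ⟩
    wt (setRows i D (wordR i D′))      ≡⟨ map-put countBumps (put D i (upperTiles (wordR i D′))) (suc i) ⟩
    put (Vec.map countBumps (put D i (upperTiles (wordR i D′)))) (suc i) (lowerBumps (wordR i D′))
      ≡⟨ cong (λ β → put β (suc i) (lowerBumps (wordR i D′))) (map-put countBumps D i) ⟩
    put₂ i (wt D) new-bumps            ≡⟨ cong (λ β → put₂ i β new-bumps) eq ⟩
    put₂ i (put₂ i α ab) new-bumps     ≡⟨ put₂-put₂ i α ab new-bumps ⟩
    put₂ i α new-bumps                 ∎
    where
    open ≡-Reasoning
    new-bumps = upperBumps (wordR i D′) , lowerBumps (wordR i D′)

  bumps-put₂ : ∀ {D : RPD m n} {α ab} → wt D ≡ put₂ i α ab → (upperBumps (wordR i D) , lowerBumps (wordR i D)) ≡ ab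
  bumps-put₂ {D} {α} {ab} eq = trans (sym (bumps-wt D)) (trans (cong (get₂ 0 i) eq) (get₂-put₂ 0 i α ab 1≤i i<n))

  -- On a string of even length f_i alternately adds a bump in row i+1 and removes one in row i.
  Chain-sum : ∀ (g : Vec ℕ n → ℤ) α k {D : RPD m n} {l p q} → Chain i D l → φʷ (wordR i D) ≡ k * 2 →
    wt D ≡ put₂ i α (k + p , q) → sumOf (g ∘ wt) l ≡ walk (λ a b → g (put₂ i α (a , b))) k p q
  Chain-sum g α zero (end _) _ eq = trans (ℤ.+-identityʳ _) (cong g eq)
  Chain-sum g α zero (next st _) φ≡ _ = contradiction (trans (sym φ≡) (RStep-φ st)) λ ()
  Chain-sum g α (suc k) (end φ≡0) φ≡ _ = contradiction (trans (sym φ≡0) φ≡) λ ()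
  Chain-sum g α (suc k) {p = p} {q} (next {D′ = D′} st c) φ≡ eq
    with FStep-kind (RStep.step st)
  ... | clearing _ _ (j , φ≡′) = contradiction (trans (sym φ≡′) φ≡) (odd≢even j (suc k))
  ... | filling low up _ with c
  ...   | end φ≡0 = contradiction (trans (sym φ≡0) (suc-injective (trans (sym (RStep-φ st)) φ≡))) λ ()
  ...   | next {D′ = D″} st′ c′ with FStep-kind (RStep.step st′)
  ...     | filling _ _ (j , φ≡′) = contradiction (trans (suc-injective (trans (sym φ≡) (RStep-φ st))) φ≡′) (odd≢even k (suc j))
  ...     | clearing low′ up′ _ = cong₂ _+ℤ_ (cong g eq) (cong₂ _+ℤ_ (cong g eq′)
              (Chain-sum g α k c′ (suc-injective (suc-injective (trans (sym (trans (RStep-φ st) (cong suc (RStep-φ st′)))) φ≡))) eq″))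
    where
    bumps = bumps-put₂ eq
    eq′ : wt D′ ≡ put₂ i α (suc k + p , suc q)
    eq′ = trans (wt-RStep st eq) (cong (put₂ i α) (cong₂ _,_
      (trans up (cong proj₁ bumps)) (trans low (cong (suc ∘ proj₂) bumps))))
    bumps′ = bumps-put₂ eq′
    eq″ : wt D″ ≡ put₂ i α (k + p , suc q)
    eq″ = trans (wt-RStep st′ eq′) (cong (put₂ i α) (cong₂ _,_
      (suc-injective (trans (sym up′) (cong proj₁ bumps′))) (trans low′ (cong proj₂ bumps′))))

  -- Supplies the shape of a string: it starts at bump numbers (k + p , p) and has 2k steps, so its
  -- `walk` ends at (p , k + p).
  highest-balance : ∀ (w : Word m) → εʷ w ≡ 0 → ∃[ k ] (φʷ w ≡ k * 2 × upperBumps w ≡ k + lowerBumps w)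
  highest-balance w ε≡0 = u ∸ l , (begin
    φʷ w                  ≡⟨ m+n∸n≡m (φʷ w) (2 * l) ⟨
    φʷ w + 2 * l ∸ 2 * l  ≡⟨ cong (_∸ 2 * l) bal ⟩
    2 * u ∸ 2 * l         ≡⟨ *-distribˡ-∸ 2 u l ⟨
    2 * (u ∸ l)           ≡⟨ *-comm 2 (u ∸ l) ⟩
    (u ∸ l) * 2           ∎) ,
    sym (m∸n+n≡m {u} {l} (*-cancelˡ-≤ {l} {u} 2 (subst (2 * l ≤_) bal (m≤n+m (2 * l) (φʷ w)))))
    where
    open ≡-Reasoning
    u = upperBumps w
    l = lowerBumps w
    bal : φʷ w + 2 * l ≡ 2 * u
    bal = trans (εʷ-φʷ-balance w) (cong (_+ 2 * u) ε≡0)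

  module _ (Φ : Vec ℕ n → ℤ) where

    module _ {D : RPD m n} {l} (c : Chain i D l) (ε≡0 : εʷ (wordR i D) ≡ 0) where

      private
        α = wt D
        ψ : ℕ → ℕ → ℤ
        ψ p q = Φ (put₂ i α (p , q))
        A B : ℕ → ℕ → ℤ
        A a b = ψ (suc a) b +ℤ -ℤ ψ a (suc b)
        B a b = (ψ (suc a) b +ℤ ψ (suc a) (suc b)) +ℤ -ℤ (ψ b (suc a) +ℤ ψ (suc b) (suc a))
        p = lowerBumps (wordR i D)
        bal = highest-balance (wordR i D) ε≡0
        k = proj₁ bal
        wt-D : wt D ≡ put₂ i α (k + p , p)
        wt-D = trans (sym (put₂-get₂ 0 i α)) (cong (put₂ i α) (trans (bumps-wt D) (cong (_, p) (proj₂ (proj₂ bal)))))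

        B-put₂ : ∀ a b → antisymmetrized i Φ (put₂ i α (a , b)) ≡ B a b
        B-put₂ a b = cong₂ (λ s t → s +ℤ -ℤ t) (raised-put₂ 1≤i i<n Φ α a b) (raised-swap-put₂ 1≤i i<n Φ α a b)

        divided-sum : sumOf (divided i Φ ∘ wt) l ≡ walk A k p p
        divided-sum = trans (Chain-sum (divided i Φ) α k c (proj₁ (proj₂ bal)) wt-D)
          (walk-cong (divided-put₂ 1≤i i<n Φ α) k p p)

      Chain-sum-full : sumOf (divided i Φ ∘ wt) l ≡ sumOf (antisymmetrized i Φ ∘ wt) l
      Chain-sum-full = trans divided-sum (trans (walk-symmetric ψ k p)
        (sym (trans (Chain-sum (antisymmetrized i Φ) α k c (proj₁ (proj₂ bal)) wt-D) (walk-cong B-put₂ k p p))))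

      Chain-sum-head : sumOf (divided i Φ ∘ wt) l ≡ sumOf (antisymmetrized i Φ ∘ wt) (D ∷ [])
      Chain-sum-head = trans divided-sum (trans (walk-top ψ k p)
        (sym (trans (ℤ.+-identityʳ _) (trans (cong (antisymmetrized i Φ) wt-D) (B-put₂ (k + p) p)))))

_≟ᵀ_ : DecidableEquality Tile
bump ≟ᵀ bump = yes refl
bump ≟ᵀ cross = no λ ()
cross ≟ᵀ bump = no λ ()
cross ≟ᵀ cross = yes refl

module _ {m n i : ℕ} (1≤i : 1 ≤ i) (i<n : i < n) {L L′ : List (RPD m n)} (L-unique : Unique L) (L′-unique : Unique L′)
  (L⊆L′ : ∀ {D} → D ∈ L → D ∈ L′)
  (L′-closed : ∀ {D D′} → RStep i D D′ → D ∈ L′ ⇔ D′ ∈ L′)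
  (L-highest : ∀ {D} → εʷ (wordR i D) ≡ 0 → D ∈ L′ → D ∈ L)
  (L-nonhighest : ∀ {D D′} → RStep i D D′ → 0 < εʷ (wordR i D) → D ∈ L ⇔ D′ ∈ L) where

  private
    _≟ᴿ_ : DecidableEquality (RPD m n)
    _≟ᴿ_ = Vec.≡-dec (Vec.≡-dec _≟ᵀ_)

    open DecMembership _≟ᴿ_ using (_∈?_)

    string : RPD m n → List (RPD m n)
    string = iString 1≤i i<n

    in-L : RPD m n → List (RPD m n)
    in-L D = List.filter (_∈? L) (string D)

    highest : List (RPD m n)
    highest = List.filter (λ D → εʷ (wordR i D) ≟ 0) L′

    highest⁻ : ∀ {D} → D ∈ highest → D ∈ L′ × εʷ (wordR i D) ≡ 0
    highest⁻ = ∈-filter⁻ (λ D → εʷ (wordR i D) ≟ 0) {xs = L′}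

    highest-unique : Unique highest
    highest-unique = Unique.filter⁺ (λ D → εʷ (wordR i D) ≟ 0) L′-unique

    strings-disjoint : ∀ {D D′ E} → D ∈ highest → D′ ∈ highest → E ∈ string D → E ∈ string D′ → D ≡ D′
    strings-disjoint {D} {D′} D∈ D′∈ E∈ E∈′ = Reach-source-unique 1≤i i<n (proj₂ (highest⁻ D∈)) (proj₂ (highest⁻ D′∈))
      (Chain-Reach (iString-Chain 1≤i i<n D) E∈) (Chain-Reach (iString-Chain 1≤i i<n D′) E∈′)

    Chain-L′ : ∀ {D E l} → Chain i D l → D ∈ L′ → E ∈ l → E ∈ L′
    Chain-L′ (end _) D∈ (here refl) = D∈
    Chain-L′ (next _ _) D∈ (here refl) = D∈
    Chain-L′ (next st c) D∈ (there E∈) = Chain-L′ c (Equivalence.to (L′-closed st) D∈) E∈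

    in-some-string : ∀ k E → εʷ (wordR i E) ≡ k → E ∈ L′ → ∃[ D ] (D ∈ highest × E ∈ string D)
    in-some-string zero E ε≡ E∈ = E , ∈-filter⁺ (λ D → εʷ (wordR i D) ≟ 0) E∈ ε≡ , Chain-head (iString-Chain 1≤i i<n E)
    in-some-string (suc k) E ε≡ E∈ with E₀ , st ← RStep-exists⁻ 1≤i i<n E (subst (0 <_) (sym ε≡) z<s)
      with D , D∈ , E₀∈ ← in-some-string k E₀ (suc-injective (trans (sym (RStep-ε st)) ε≡)) (Equivalence.from (L′-closed st) E∈) =
      D , D∈ , Chain-closed 1≤i i<n (iString-Chain 1≤i i<n D) E₀∈ st

    Chain-L-all : ∀ {D l} → Chain i D l → 0 < εʷ (wordR i D) → D ∈ L → All (_∈ L) l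
    Chain-L-all (end _) _ D∈ = D∈ ∷ []
    Chain-L-all (next st c) 0<ε D∈ = D∈ ∷ Chain-L-all c
      (subst (0 <_) (sym (RStep-ε st)) z<s) (Equivalence.to (L-nonhighest st 0<ε) D∈)

    Chain-L-none : ∀ {D l} → Chain i D l → 0 < εʷ (wordR i D) → D ∉ L → All (_∉ L) l
    Chain-L-none (end _) _ D∉ = D∉ ∷ []
    Chain-L-none (next st c) 0<ε D∉ = D∉ ∷ Chain-L-none c
      (subst (0 <_) (sym (RStep-ε st)) z<s) (D∉ ∘ Equivalence.from (L-nonhighest st 0<ε))

    -- Only the step away from the highest element can leave `L`; membership of the second element
    -- decides that of all later ones.
    filter-Chain : ∀ {D l} → Chain i D l → D ∈ L → List.filter (_∈? L) l ≡ l ⊎ List.filter (_∈? L) l ≡ D ∷ []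
    filter-Chain (end _) D∈ = inj₁ (List.filter-accept (_∈? L) D∈)
    filter-Chain {D} (next {D′ = D′} st c) D∈ with D′ ∈? L
    ... | yes D′∈ = inj₁ (trans (List.filter-accept (_∈? L) D∈) (cong (D ∷_) (List.filter-all (_∈? L)
            (Chain-L-all c (subst (0 <_) (sym (RStep-ε st)) z<s) D′∈))))
    ... | no D′∉ = inj₂ (trans (List.filter-accept (_∈? L) D∈) (cong (D ∷_) (List.filter-none (_∈? L)
            (Chain-L-none c (subst (0 <_) (sym (RStep-ε st)) z<s) D′∉))))

    sum-string : ∀ Φ {D} → D ∈ highest →
      sumOf (divided i Φ ∘ wt) (string D) ≡ sumOf (antisymmetrized i Φ ∘ wt) (in-L D)
    sum-string Φ {D} D∈ with c ← iString-Chain 1≤i i<n D | D∈L′ , ε≡0 ← highest⁻ D∈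
      with filter-Chain c (L-highest ε≡0 D∈L′)
    ... | inj₁ eq = trans (Chain-sum-full 1≤i i<n Φ c ε≡0) (cong (sumOf (antisymmetrized i Φ ∘ wt)) (sym eq))
    ... | inj₂ eq = trans (Chain-sum-head 1≤i i<n Φ c ε≡0) (cong (sumOf (antisymmetrized i Φ ∘ wt)) (sym eq))

  -- `L′` is the disjoint union of the strings of its highest elements, and each of them meets `L`
  -- in full or in its head. The hypotheses speak of the enumerations because membership in a finite
  -- list is decidable, whereas C is an arbitrary predicate.
  ch-πK : IsπK i (ch L) (ch L′)
  ch-πK = IsπK-intro i L L′ λ Φ → begin
    sumOf (divided i Φ ∘ wt) L′
      ≡⟨ sumOf-unique _ L′-unique
           (concatMap-unique string highest-unique (λ {D} _ → Chain-unique (iString-Chain 1≤i i<n D)) strings-disjoint)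
           (λ {E} E∈ → let D , D∈ , E∈D = in-some-string _ E refl E∈ in ∈-concatMap-intro string D∈ E∈D)
           (λ E∈ → let D , D∈ , E∈D = ∈-concatMap-elim string highest E∈ in
                   Chain-L′ (iString-Chain 1≤i i<n D) (proj₁ (highest⁻ D∈)) E∈D) ⟩
    sumOf (divided i Φ ∘ wt) (concatMap string highest)
      ≡⟨ sumOf-concatMap _ string highest ⟩
    sumOf (sumOf (divided i Φ ∘ wt) ∘ string) highest
      ≡⟨ sumOf-cong highest (sum-string Φ) ⟩
    sumOf (sumOf (antisymmetrized i Φ ∘ wt) ∘ in-L) highest
      ≡⟨ sumOf-concatMap _ in-L highest ⟨
    sumOf (antisymmetrized i Φ ∘ wt) (concatMap in-L highest)
      ≡⟨ sumOf-unique _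
           (concatMap-unique in-L highest-unique (λ {D} _ → Unique.filter⁺ (_∈? L) (Chain-unique (iString-Chain 1≤i i<n D)))
             (λ {D} {D′} D∈ D′∈ E∈ E∈′ → strings-disjoint D∈ D′∈ (proj₁ (in-L⁻ D E∈)) (proj₁ (in-L⁻ D′ E∈′))))
           L-unique
           (λ E∈ → let D , _ , E∈D = ∈-concatMap-elim in-L highest E∈ in proj₂ (in-L⁻ D E∈D))
           (λ {E} E∈ → let D , D∈ , E∈D = in-some-string _ E refl (L⊆L′ E∈) in
                   ∈-concatMap-intro in-L D∈ (∈-filter⁺ (_∈? L) E∈D E∈)) ⟩
    sumOf (antisymmetrized i Φ ∘ wt) L ∎
    where
    open ≡-Reasoning
    in-L⁻ : ∀ D {E} → E ∈ in-L D → E ∈ string D × E ∈ L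
    in-L⁻ D = ∈-filter⁻ (_∈? L) {xs = string D}

-- Demazure operators and the theorem

-- `eRPow` recurses on the last application of e_i; climbing a string splits off the first.
eRPow-suc : ∀ {m n} i k {D E : RPD m n} → eR i D ≡ just E → eRPow i (suc k) D ≡ eRPow i k E
eRPow-suc i zero eq = eq
eRPow-suc i (suc k) {D} {E} eq with eRPow i (suc k) D | eRPow-suc i k {D} {E} eq
... | _ | refl = refl

module _ {m n i : ℕ} (1≤i : 1 ≤ i) (i<n : i < n) (C : RPD m n → Set) (C-union : UnionOfFullSubcrystals C)
         (w : Perm n) (w-ascent : app w i < app w (suc i)) where

  private
    s = sᵢ n i 1≤i i<n

    C-RStep : ∀ {D D′} → RStep i D D′ → C D ⇔ C D′
    C-RStep {D} {D′} st = mk⇔ (C-union D D′ (return edge)) (C-union D′ D (symmetric Edge (return edge)))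
      where
      edge : Edge D D′
      edge = i , 1≤i , i<n , RStep⇒fR 1≤i i<n st

  Cw-raise : ∀ {D} → Cw C w D → Cw C (w · s) D
  Cw-raise (CD , b) = CD , Below-raise 1≤i i<n w-ascent b

  Cw-RStep : ∀ {D D′} → RStep i D D′ → Cw C (w · s) D ⇔ Cw C (w · s) D′
  Cw-RStep st = mk⇔
    (λ { (CD , b) → Equivalence.to (C-RStep st) CD , Equivalence.to (Below-RStep 1≤i i<n w-ascent st) b })
    (λ { (CD , b) → Equivalence.from (C-RStep st) CD , Equivalence.from (Below-RStep 1≤i i<n w-ascent st) b })

  Cw-highest : ∀ {D} → εʷ (wordR i D) ≡ 0 → Cw C (w · s) D → Cw C w D
  Cw-highest ε≡0 (CD , b) = CD , Below-highest 1≤i i<n w-ascent ε≡0 b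

  Cw-RStep-nonhighest : ∀ {D D′} → RStep i D D′ → 0 < εʷ (wordR i D) → Cw C w D ⇔ Cw C w D′
  Cw-RStep-nonhighest st 0<ε = mk⇔
    (λ { (CD , b) → Equivalence.to (C-RStep st) CD , Equivalence.to (Below-RStep-nonhighest 1≤i i<n st 0<ε) b })
    (λ { (CD , b) → Equivalence.from (C-RStep st) CD , Equivalence.from (Below-RStep-nonhighest 1≤i i<n st 0<ε) b })

  -- The exponent is ε: applying e_i up to the highest element never leaves the larger set, and
  -- there `Cw-highest` passes to the smaller one.
  Cw⇒𝔇 : ∀ k D → εʷ (wordR i D) ≡ k → Cw C (w · s) D → 𝔇 i (Cw C w) D
  Cw⇒𝔇 zero D ε≡ D∈ = 0 , D , refl , Cw-highest ε≡ D∈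
  Cw⇒𝔇 (suc k) D ε≡ D∈ with E , st ← RStep-exists⁻ 1≤i i<n D (subst (0 <_) (sym ε≡) z<s)
    with j , b , pow , b∈ ← Cw⇒𝔇 k E (suc-injective (trans (sym (RStep-ε st)) ε≡)) (Equivalence.from (Cw-RStep st) D∈) =
    suc j , b , trans (eRPow-suc i j (RStep⇒eR 1≤i i<n st)) pow , b∈

  eRPow-Cw : ∀ k D {b} → eRPow i k D ≡ just b → Cw C (w · s) b → Cw C (w · s) D
  eRPow-Cw zero D refl b∈ = b∈
  eRPow-Cw (suc k) D eq b∈ with eRPow i k D in eq′
  ... | just E = eRPow-Cw k D eq′ (Equivalence.to (Cw-RStep (eR⇒RStep 1≤i i<n eq)) b∈)

  Cw⇔𝔇 : ∀ D → Cw C (w · s) D ⇔ 𝔇 i (Cw C w) D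
  Cw⇔𝔇 D = mk⇔ (Cw⇒𝔇 _ D refl) λ { (k , b , pow , b∈) → eRPow-Cw k D pow (Cw-raise b∈) }

theorem4p10 : (m n : ℕ) (C : RPD m n → Set) → UnionOfFullSubcrystals C →
    (i : ℕ) (hi₁ : 1 ≤ i) (hi₂ : i < n) (w : Perm n) →
    app w i < app w (suc i) →
    ((D : RPD m n) → Cw C (w · sᵢ n i hi₁ hi₂) D ⇔ 𝔇 i (Cw C w) D)
    × ((L L′ : List (RPD m n)) → Enumerates (Cw C w) L →
    Enumerates (Cw C (w · sᵢ n i hi₁ hi₂)) L′ →
    IsπK i (ch L) (ch L′))
theorem4p10 m n C C-union i 1≤i i<n w w-ascent = Cw⇔𝔇 1≤i i<n C C-union w w-ascent ,
  λ { L L′ (L-unique , L-enum) (L′-unique , L′-enum) →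
    let in-Cw : ∀ {D} → D ∈ L → Cw C w D
        in-Cw {D} = Equivalence.to (L-enum D)
        Cw-in : ∀ {D} → Cw C w D → D ∈ L
        Cw-in {D} = Equivalence.from (L-enum D)
        in-Cw′ : ∀ {D} → D ∈ L′ → Cw C (w · sᵢ n i 1≤i i<n) D
        in-Cw′ {D} = Equivalence.to (L′-enum D)
        Cw-in′ : ∀ {D} → Cw C (w · sᵢ n i 1≤i i<n) D → D ∈ L′
        Cw-in′ {D} = Equivalence.from (L′-enum D)
    in ch-πK 1≤i i<n L-unique L′-unique
      (Cw-in′ ∘ Cw-raise 1≤i i<n C C-union w w-ascent ∘ in-Cw)
      (λ st → let c = Cw-RStep 1≤i i<n C C-union w w-ascent st in
              mk⇔ (Cw-in′ ∘ Equivalence.to c ∘ in-Cw′) (Cw-in′ ∘ Equivalence.from c ∘ in-Cw′))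
      (λ ε≡0 → Cw-in ∘ Cw-highest 1≤i i<n C C-union w w-ascent ε≡0 ∘ in-Cw′)
      (λ st 0<ε → let c = Cw-RStep-nonhighest 1≤i i<n C C-union w w-ascent st 0<ε in
              mk⇔ (Cw-in ∘ Equivalence.to c ∘ in-Cw) (Cw-in ∘ Equivalence.from c ∘ in-Cw)) }
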